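{- Let $p$ be a prime and $n\ge 2$ an integer. Let $F_n(X,Y)=X^n+Y^n-(X+Y-1)^n-1\in\mathbb F_p[X,Y]$ and $$N_n=\#\{(x,y)\in\mathbb F_p^2:\ F_n(x,y)=0\}.$$ Then $$N_n\ll p+n^{4/3}p^{2/3}.$$
   Context: $\mathbb F_p$ is the finite field with $p$ elements. The notation $U\ll V$ means $|U|\le cV$ for an absolute constant $c>0$. -}

module Defs where

open import Data.Nat using (ℕ)
open import Data.Nat.Divisibility using (_∣?_)
open import Data.Integer using (ℤ; +_; _+_; _-_; _^_; ∣_∣)
open import Data.List using (List; upTo; filter; length; cartesianProduct)
open import Data.Product using (_×_; _,_)

Fn : ℕ → ℤ → ℤ → ℤ
Fn n x y = x ^ n + y ^ n - (x + y - + 1) ^ n - + 1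

-- N_n = #{(x,y) ∈ F_p^2 : F_n(x,y) = 0}, with F_p represented by
-- residues 0..p-1; F_n(x,y) = 0 in F_p iff p divides the integer value.
Nn : ℕ → ℕ → ℕ
Nn p n = length (filter (λ { (x , y) → p ∣? ∣ Fn n (+ x) (+ y) ∣ })
                        (cartesianProduct (upTo p) (upTo p)))

{-# OPTIONS --safe #-}
module Submission where

-- If p ≤ 2n the trivial bound p² suffices. Otherwise put v = 1/(x-1), s = y/(x-1): then F_n(x,y) = 0 becomes γ(s) = γ(v)
-- with γ(y) = (y+1)^n - y^n. Let G(V,S) be a prime factor of γ(S) - γ(V) over K[V], other than S - V and S + V + 1.
-- A Wronskian argument for y₁ⁿ - y₂ⁿ = y₃ⁿ - y₄ⁿ on G = 0 shows deg G ≥ (N-5)/3 where N = n - 2. Hence, for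
-- 3(μ+1) + 5 ≤ N, the monomials φ_j of degree at most μ are independent on G = 0, and the Stöhr-Voloch method applies:
-- choose functions u_j of small degree, not all zero, with Σ u_j D^i φ_j = 0 for all small i. Then Ψ = Σ u_j φ_j^p is nonzero
-- and vanishes to high order at every rational point, because there φ_j^p and φ_j agree. Comparing with the degree of Ψ
-- bounds the number of points on G = 0 by O(deg G · p / μ) whenever μ³ n ≤ p. Summing over the factors gives O(n p / μ), and
-- the largest admissible μ, about min(n/3, (p/n)^{1/3}), yields the theorem. The remaining points lie on the two lines,
-- on x = 1, or over one of the at most n critical values of v.

open import Defs
open import Level using (0ℓ)
open import Algebra.Bundles using (CommutativeRing; RawRing)
open import Data.Nat as ℕ using (ℕ; zero; suc; z≤n; s≤s)
import Data.Nat.Properties as ℕ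
open import Data.Nat.Divisibility as ℕ using (_∣_; _∣?_)
open import Data.Nat.Primality as ℕ using (Prime; euclidsLemma; prime⇒nonTrivial; prime⇒nonZero)
open import Data.Integer as ℤ using (ℤ; +_; -[1+_]; ∣_∣)
import Data.Integer.Properties as ℤ
import Data.Integer.Divisibility.Signed as ℤ
open import Data.Fin as Fin using (Fin; zero; suc; _↑ˡ_; _↑ʳ_; combine; toℕ; splitAt)
import Data.Fin.Properties as Fin
open import Data.List as List using (List; []; _∷_; map; length; upTo; _++_; lookup; concatMap; filter; cartesianProduct)
open import Data.List.Properties using (length-map; length-++; length-upTo; length-tabulate; length-filter)
open import Data.List.Membership.Propositional using (_∈_)
open import Data.List.Membership.Propositional.Properties using (∈-lookup; ∈-++⁺ˡ; ∈-++⁺ʳ; ∈-map⁺; ∈-map⁻; ∈-upTo⁺)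
open import Data.List.Relation.Unary.Any using (here; there)
open import Data.List.Relation.Unary.All as All using (All; []; _∷_)
import Data.List.Relation.Unary.All.Properties as All
open import Data.List.Relation.Unary.AllPairs as AllPairs using (AllPairs; []; _∷_)
import Data.List.Relation.Unary.AllPairs.Properties as AllPairs
import Data.List.Relation.Unary.Unique.Propositional.Properties as Unique
open import Data.Maybe using (Maybe; just; nothing)
open import Data.Product using (∃; _×_; _,_; proj₁; proj₂)
open import Data.Sum using (_⊎_; inj₁; inj₂; [_,_]′)
open import Data.Unit using (⊤; tt)
open import Data.Empty using (⊥; ⊥-elim)
open import Function using (_∘_)
open import Relation.Nullary using (¬_; Dec; yes; no)
open import Relation.Nullary.Decidable using (decidable-stable)
open import Relation.Binary.Definitions using (tri<; tri≈; tri>)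
open import Relation.Binary.PropositionalEquality as ≡ using (_≡_)

-- That Ψ is nonzero is only one of two cases. Write M + 1 for the number of φ_j. If Ψ = 0, the
-- vector of p-th powers φ_j^p and the vectors D^0 φ, ..., D^(M-1) φ are M + 1 vectors orthogonal to
-- u, hence dependent; since D kills p-th powers, this forces every D^i φ to be orthogonal to u. A
-- point where a nonzero u_j does not vanish to order p would then give a K-combination of the φ_j
-- of order p, too much for its degree. So u_j itself vanishes to order p at every point and is
-- counted in place of Ψ. Geometry is replaced by linear algebra: orders of vanishing are read off
-- iterates of D = G_S d/dV - G_V d/dS, and Bezout's bound comes from comparing dimensions. This
-- requires coordinates in which degrees behave well, hence factors that are monic in S with total
-- degree equal to the S-degree. The limit μ³ n ≤ p arises because u has degree about M² n, roughly
-- μ⁴ n, which should not exceed the degree p μ of φ_j^p.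

CRing : Set₁
CRing = CommutativeRing 0ℓ 0ℓ

-- Commutative rings and a ring solver with integer coefficients.

module RingTools (R : CRing) where
  open CommutativeRing R public hiding (zero)
  open import Algebra.Properties.Ring (CommutativeRing.ring R) public
    using (-‿distribˡ-*; -‿distribʳ-*; -‿involutive; -‿+-comm; -0#≈0#; x+x≈x⇒x≈0; +-cancelˡ; +-cancelʳ)
  open import Algebra.Properties.Semiring.Mult.TCOptimised (CommutativeRing.semiring R) public
    using () renaming (_×_ to _·_; ×-homo-+ to ·-homo-+; ×1-homo-* to ·1-homo-*; 1+× to ·-suc; ×-cong to ·-cong; ×-congʳ to ·-congʳ; ×-assocˡ to ·-assocˡ)
  open import Algebra.Properties.Semiring.Exp (CommutativeRing.semiring R) public
    using (_^_; ^-congˡ; ^-homo-*; ^-assocʳ)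
  open import Relation.Binary.Reasoning.Setoid (CommutativeRing.setoid R) public
  open import Algebra.Solver.Ring.AlmostCommutativeRing using (_-Raw-AlmostCommutative⟶_; fromCommutativeRing)

  -- The optimised multiple makes `1 · 1#` reduce to `1#`, so `con (+ 1)` and `con (+ 0)` in solver
  -- goals match the ring constants definitionally. Integer coefficients supply the decidable
  -- equality that the ring itself may not have.
  ⟦_⟧ℤ : ℤ → Carrier
  ⟦ + n ⟧ℤ      = n · 1#
  ⟦ -[1+ n ] ⟧ℤ = - (suc n · 1#)

  private
    minus-minus : ∀ a b c → (a + b) - (a + c) ≈ b - c
    minus-minus a b c = begin
      (a + b) + - (a + c)       ≈⟨ +-congˡ (sym (-‿+-comm a c)) ⟩
      (a + b) + (- a + - c)     ≈⟨ +-congʳ (+-comm a b) ⟩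
      (b + a) + (- a + - c)     ≈⟨ +-assoc b a _ ⟩
      b + (a + (- a + - c))     ≈⟨ +-congˡ (sym (+-assoc a _ _)) ⟩
      b + ((a + - a) + - c)     ≈⟨ +-congˡ (+-congʳ (-‿inverseʳ a)) ⟩
      b + (0# + - c)            ≈⟨ +-congˡ (+-identityˡ _) ⟩
      b - c ∎

    ⊖-homo : ∀ m n → ⟦ m ℤ.⊖ n ⟧ℤ ≈ m · 1# - n · 1#
    ⊖-homo zero zero = sym (trans (+-identityˡ _) -0#≈0#)
    ⊖-homo zero (suc n) = sym (+-identityˡ _)
    ⊖-homo (suc m) zero = sym (trans (+-congˡ -0#≈0#) (+-identityʳ _))
    ⊖-homo (suc m) (suc n) = begin
      ⟦ suc m ℤ.⊖ suc n ⟧ℤ        ≡⟨ ≡.cong ⟦_⟧ℤ (ℤ.[1+m]⊖[1+n]≡m⊖n m n) ⟩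
      ⟦ m ℤ.⊖ n ⟧ℤ                ≈⟨ ⊖-homo m n ⟩
      m · 1# - n · 1#             ≈⟨ sym (minus-minus 1# _ _) ⟩
      (1# + m · 1#) - (1# + n · 1#) ≈⟨ +-cong (sym (·-suc m 1#)) (-‿cong (sym (·-suc n 1#))) ⟩
      suc m · 1# - suc n · 1# ∎

    +-homo : ∀ i j → ⟦ i ℤ.+ j ⟧ℤ ≈ ⟦ i ⟧ℤ + ⟦ j ⟧ℤ
    +-homo (+ m) (+ n) = ·-homo-+ 1# m n
    +-homo (+ m) -[1+ n ] = ⊖-homo m (suc n)
    +-homo -[1+ m ] (+ n) = trans (⊖-homo n (suc m)) (+-comm _ _)
    +-homo -[1+ m ] -[1+ n ] = begin
      - (suc (suc (m ℕ.+ n)) · 1#)  ≡⟨ ≡.cong (λ k → - (suc k · 1#)) (≡.sym (ℕ.+-suc m n)) ⟩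
      - ((suc m ℕ.+ suc n) · 1#)    ≈⟨ -‿cong (·-homo-+ 1# (suc m) (suc n)) ⟩
      - (suc m · 1# + suc n · 1#)   ≈⟨ sym (-‿+-comm _ _) ⟩
      - (suc m · 1#) + - (suc n · 1#) ∎

    neg-homo : ∀ i → ⟦ ℤ.- i ⟧ℤ ≈ - ⟦ i ⟧ℤ
    neg-homo (+ zero) = sym -0#≈0#
    neg-homo (+ suc n) = refl
    neg-homo -[1+ n ] = sym (-‿involutive _)

    *-homo⁺ : ∀ m j → ⟦ + m ℤ.* j ⟧ℤ ≈ m · 1# * ⟦ j ⟧ℤ
    *-homo⁺ m (+ n) = trans (reflexive (≡.cong ⟦_⟧ℤ (≡.sym (ℤ.pos-* m n)))) (·1-homo-* m n)
    *-homo⁺ m -[1+ n ] = begin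
      ⟦ + m ℤ.* -[1+ n ] ⟧ℤ          ≡⟨ ≡.cong ⟦_⟧ℤ (≡.sym (ℤ.neg-distribʳ-* (+ m) (+ suc n))) ⟩
      ⟦ ℤ.- (+ m ℤ.* + suc n) ⟧ℤ     ≈⟨ neg-homo (+ m ℤ.* + suc n) ⟩
      - ⟦ + m ℤ.* + suc n ⟧ℤ         ≈⟨ -‿cong (*-homo⁺ m (+ suc n)) ⟩
      - (m · 1# * suc n · 1#)        ≈⟨ -‿distribʳ-* _ _ ⟩
      m · 1# * - (suc n · 1#) ∎

    *-homo : ∀ i j → ⟦ i ℤ.* j ⟧ℤ ≈ ⟦ i ⟧ℤ * ⟦ j ⟧ℤ
    *-homo (+ m) j = *-homo⁺ m j
    *-homo -[1+ m ] j = begin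
      ⟦ -[1+ m ] ℤ.* j ⟧ℤ            ≡⟨ ≡.cong ⟦_⟧ℤ (≡.sym (ℤ.neg-distribˡ-* (+ suc m) j)) ⟩
      ⟦ ℤ.- (+ suc m ℤ.* j) ⟧ℤ       ≈⟨ neg-homo (+ suc m ℤ.* j) ⟩
      - ⟦ + suc m ℤ.* j ⟧ℤ           ≈⟨ -‿cong (*-homo⁺ (suc m) j) ⟩
      - (suc m · 1# * ⟦ j ⟧ℤ)        ≈⟨ -‿distribˡ-* _ _ ⟩
      - (suc m · 1#) * ⟦ j ⟧ℤ ∎

    ℤ-raw : RawRing 0ℓ 0ℓ
    ℤ-raw = record { Carrier = ℤ ; _≈_ = _≡_ ; _+_ = ℤ._+_ ; _*_ = ℤ._*_ ; -_ = ℤ.-_ ; 0# = + 0 ; 1# = + 1 }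

    morphism : ℤ-raw -Raw-AlmostCommutative⟶ fromCommutativeRing R
    morphism = record { ⟦_⟧ = ⟦_⟧ℤ ; +-homo = +-homo ; *-homo = *-homo ; -‿homo = neg-homo ; 0-homo = refl ; 1-homo = refl }

    dec : ∀ i j → Maybe (⟦ i ⟧ℤ ≈ ⟦ j ⟧ℤ)
    dec i j with i ℤ.≟ j
    ... | yes ≡.refl = just refl
    ... | no _ = nothing

  open import Algebra.Solver.Ring ℤ-raw (fromCommutativeRing R) morphism dec public
    using (solve; con; _:+_; _:*_; _:-_; :-_; _:^_; _:=_)

-- Polynomials as coefficient lists.

module PolyRing (R : CRing) where
  open RingTools R

  coeff : List Carrier → ℕ → Carrier
  coeff [] i = 0#
  coeff (a ∷ p) zero = a
  coeff (a ∷ p) (suc i) = coeff p i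

  infix 4 _≋_
  -- Trailing zeros make lists non-unique, so equality is coefficientwise. Being a record, it lets
  -- Agda recover `p` and `q` from a proof, which the non-injective `coeff` would prevent.
  record _≋_ (p q : List Carrier) : Set where
    constructor mk
    field at : ∀ i → coeff p i ≈ coeff q i
  open _≋_ public

  infixl 6 _⊕_
  infixl 7 _⊗_ _⊙_

  C : Carrier → List Carrier
  C a = a ∷ []

  opaque
    -- Sealed, so that terms over nested polynomial rings are compared by name and not by unfolding
    -- list recursion.
    _⊕_ : List Carrier → List Carrier → List Carrier
    [] ⊕ q = q
    (a ∷ p) ⊕ [] = a ∷ p
    (a ∷ p) ⊕ (b ∷ q) = a + b ∷ p ⊕ q

    _⊙_ : Carrier → List Carrier → List Carrier
    a ⊙ p = map (a *_) p

    ⊖_ : List Carrier → List Carrier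
    ⊖ p = map -_ p

    _⊗_ : List Carrier → List Carrier → List Carrier
    [] ⊗ q = []
    (a ∷ p) ⊗ q = a ⊙ q ⊕ (0# ∷ p ⊗ q)

  opaque
    unfolding _⊕_ _⊙_ ⊖_ _⊗_

    coeff-⊕ : ∀ p q i → coeff (p ⊕ q) i ≈ coeff p i + coeff q i
    coeff-⊕ [] q i = sym (+-identityˡ _)
    coeff-⊕ (a ∷ p) [] i = sym (+-identityʳ _)
    coeff-⊕ (a ∷ p) (b ∷ q) zero = refl
    coeff-⊕ (a ∷ p) (b ∷ q) (suc i) = coeff-⊕ p q i

    coeff-⊙ : ∀ a p i → coeff (a ⊙ p) i ≈ a * coeff p i
    coeff-⊙ a [] i = sym (zeroʳ a)
    coeff-⊙ a (b ∷ p) zero = refl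
    coeff-⊙ a (b ∷ p) (suc i) = coeff-⊙ a p i

    coeff-⊖ : ∀ p i → coeff (⊖ p) i ≈ - coeff p i
    coeff-⊖ [] i = sym -0#≈0#
    coeff-⊖ (b ∷ p) zero = refl
    coeff-⊖ (b ∷ p) (suc i) = coeff-⊖ p i

    ≋-refl : ∀ {p} → p ≋ p
    ≋-refl = mk λ _ → refl
    ≋-sym : ∀ {p q} → p ≋ q → q ≋ p
    ≋-sym e = mk λ i → sym (at e i)
    ≋-trans : ∀ {p q r} → p ≋ q → q ≋ r → p ≋ r
    ≋-trans e f = mk λ i → trans (at e i) (at f i)

    ∷-cong : ∀ {a b p q} → a ≈ b → p ≋ q → (a ∷ p) ≋ (b ∷ q)
    ∷-cong e f = mk λ { zero → e ; (suc i) → at f i }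

    ∷-zero : ∀ {a p} → a ≈ 0# → p ≋ [] → (a ∷ p) ≋ []
    ∷-zero e f = mk λ { zero → e ; (suc i) → at f i }

    tail-≋ : ∀ {a b p q} → (a ∷ p) ≋ (b ∷ q) → p ≋ q
    tail-≋ e = mk λ i → at e (suc i)

    tail-zero : ∀ {a p} → (a ∷ p) ≋ [] → p ≋ []
    tail-zero e = mk λ i → at e (suc i)

    ⊕-cong : ∀ {p p' q q'} → p ≋ p' → q ≋ q' → p ⊕ q ≋ p' ⊕ q'
    ⊕-cong {p} {p'} {q} {q'} e f = mk λ i → begin
      coeff (p ⊕ q) i        ≈⟨ coeff-⊕ p q i ⟩
      coeff p i + coeff q i  ≈⟨ +-cong (at e i) (at f i) ⟩
      coeff p' i + coeff q' i ≈⟨ sym (coeff-⊕ p' q' i) ⟩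
      coeff (p' ⊕ q') i ∎

    ⊕-assoc : ∀ p q r → (p ⊕ q) ⊕ r ≋ p ⊕ (q ⊕ r)
    ⊕-assoc p q r = mk λ i → begin
      coeff ((p ⊕ q) ⊕ r) i                ≈⟨ trans (coeff-⊕ (p ⊕ q) r i) (+-congʳ (coeff-⊕ p q i)) ⟩
      coeff p i + coeff q i + coeff r i    ≈⟨ +-assoc _ _ _ ⟩
      coeff p i + (coeff q i + coeff r i)  ≈⟨ sym (trans (coeff-⊕ p (q ⊕ r) i) (+-congˡ (coeff-⊕ q r i))) ⟩
      coeff (p ⊕ (q ⊕ r)) i ∎

    ⊕-comm : ∀ p q → p ⊕ q ≋ q ⊕ p
    ⊕-comm p q = mk λ i → trans (coeff-⊕ p q i) (trans (+-comm _ _) (sym (coeff-⊕ q p i)))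

    ⊕-identityˡ : ∀ p → [] ⊕ p ≋ p
    ⊕-identityˡ p = ≋-refl

    ⊕-identityʳ : ∀ p → p ⊕ [] ≋ p
    ⊕-identityʳ p = mk λ i → trans (coeff-⊕ p [] i) (+-identityʳ _)

    ⊖-cong : ∀ {p q} → p ≋ q → ⊖ p ≋ ⊖ q
    ⊖-cong {p} {q} e = mk λ i → trans (coeff-⊖ p i) (trans (-‿cong (at e i)) (sym (coeff-⊖ q i)))

    ⊖-inverseʳ : ∀ p → p ⊕ ⊖ p ≋ []
    ⊖-inverseʳ p = mk λ i → trans (coeff-⊕ p (⊖ p) i) (trans (+-congˡ (coeff-⊖ p i)) (-‿inverseʳ _))

    ⊙-cong : ∀ {a b p q} → a ≈ b → p ≋ q → a ⊙ p ≋ b ⊙ q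
    ⊙-cong {a} {b} {p} {q} e f = mk λ i → trans (coeff-⊙ a p i) (trans (*-cong e (at f i)) (sym (coeff-⊙ b q i)))

    zero-⊗ : ∀ {p} q → p ≋ [] → p ⊗ q ≋ []
    zero-⊗ {[]} q e = ≋-refl
    zero-⊗ {a ∷ p} q e = mk λ i → begin
      coeff (a ⊙ q ⊕ (0# ∷ p ⊗ q)) i           ≈⟨ coeff-⊕ (a ⊙ q) _ i ⟩
      coeff (a ⊙ q) i + coeff (0# ∷ p ⊗ q) i   ≈⟨ +-cong (trans (coeff-⊙ a q i) (trans (*-congʳ (at e 0)) (zeroˡ _))) (at (∷-zero refl (zero-⊗ q (tail-zero e))) i) ⟩
      0# + 0#                                  ≈⟨ +-identityˡ _ ⟩
      0# ∎

    ⊗-congʳ : ∀ p p' q → p ≋ p' → p ⊗ q ≋ p' ⊗ q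
    ⊗-congʳ [] p' q e = ≋-sym (zero-⊗ q (≋-sym e))
    ⊗-congʳ (a ∷ p) [] q e = zero-⊗ q e
    ⊗-congʳ (a ∷ p) (b ∷ p') q e = ⊕-cong (⊙-cong (at e 0) ≋-refl) (∷-cong refl (⊗-congʳ p p' q (tail-≋ e)))

    ⊗-congˡ : ∀ p {q q'} → q ≋ q' → p ⊗ q ≋ p ⊗ q'
    ⊗-congˡ [] e = ≋-refl
    ⊗-congˡ (a ∷ p) e = ⊕-cong (⊙-cong refl e) (∷-cong refl (⊗-congˡ p e))

    ⊗-cong : ∀ {p p' q q'} → p ≋ p' → q ≋ q' → p ⊗ q ≋ p' ⊗ q'
    ⊗-cong {p} {p'} {q} e f = ≋-trans (⊗-congʳ p p' q e) (⊗-congˡ p' f)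

    ⊗-[] : ∀ p → p ⊗ [] ≋ []
    ⊗-[] [] = ≋-refl
    ⊗-[] (a ∷ p) = ∷-zero refl (⊗-[] p)

    -- The defining recursion mirrored in the second factor; with it commutativity is a single
    -- induction.
    ⊗-∷ : ∀ p b q → p ⊗ (b ∷ q) ≋ b ⊙ p ⊕ (0# ∷ p ⊗ q)
    ⊗-∷ [] b q = mk λ { zero → refl ; (suc i) → refl }
    ⊗-∷ (a ∷ p) b q = mk λ
      { zero → trans (+-identityʳ _) (trans (*-comm a b) (sym (+-identityʳ _)))
      ; (suc i) → begin
        coeff (a ⊙ q ⊕ p ⊗ (b ∷ q)) i                           ≈⟨ coeff-⊕ (a ⊙ q) _ i ⟩
        coeff (a ⊙ q) i + coeff (p ⊗ (b ∷ q)) i                 ≈⟨ +-congˡ (trans (at (⊗-∷ p b q) i) (coeff-⊕ (b ⊙ p) _ i)) ⟩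
        coeff (a ⊙ q) i + (coeff (b ⊙ p) i + coeff (0# ∷ p ⊗ q) i) ≈⟨ solve 3 (λ x y z → x :+ (y :+ z) := y :+ (x :+ z)) refl _ _ _ ⟩
        coeff (b ⊙ p) i + (coeff (a ⊙ q) i + coeff (0# ∷ p ⊗ q) i) ≈⟨ sym (trans (coeff-⊕ (b ⊙ p) _ i) (+-congˡ (coeff-⊕ (a ⊙ q) _ i))) ⟩
        coeff (b ⊙ p ⊕ (a ⊙ q ⊕ (0# ∷ p ⊗ q))) i ∎ }

    ⊗-comm : ∀ p q → p ⊗ q ≋ q ⊗ p
    ⊗-comm [] q = ≋-sym (⊗-[] q)
    ⊗-comm (a ∷ p) q = ≋-trans (⊕-cong ≋-refl (∷-cong refl (⊗-comm p q))) (≋-sym (⊗-∷ q a p))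

    ⊙-⊕ : ∀ a p q → a ⊙ (p ⊕ q) ≋ a ⊙ p ⊕ a ⊙ q
    ⊙-⊕ a p q = mk λ i → begin
      coeff (a ⊙ (p ⊕ q)) i             ≈⟨ trans (coeff-⊙ a (p ⊕ q) i) (*-congˡ (coeff-⊕ p q i)) ⟩
      a * (coeff p i + coeff q i)       ≈⟨ distribˡ _ _ _ ⟩
      a * coeff p i + a * coeff q i     ≈⟨ sym (trans (coeff-⊕ (a ⊙ p) _ i) (+-cong (coeff-⊙ a p i) (coeff-⊙ a q i))) ⟩
      coeff (a ⊙ p ⊕ a ⊙ q) i ∎

    ⊗-distribˡ : ∀ p q r → p ⊗ (q ⊕ r) ≋ p ⊗ q ⊕ p ⊗ r
    ⊗-distribˡ [] q r = ≋-refl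
    ⊗-distribˡ (a ∷ p) q r = mk λ i → begin
      coeff (a ⊙ (q ⊕ r) ⊕ (0# ∷ p ⊗ (q ⊕ r))) i ≈⟨ coeff-⊕ (a ⊙ (q ⊕ r)) _ i ⟩
      coeff (a ⊙ (q ⊕ r)) i + coeff (0# ∷ p ⊗ (q ⊕ r)) i
        ≈⟨ +-cong (trans (at (⊙-⊕ a q r) i) (coeff-⊕ (a ⊙ q) _ i))
                  (trans (at (∷-cong (sym (+-identityˡ 0#)) (⊗-distribˡ p q r)) i) (coeff-⊕ (0# ∷ p ⊗ q) (0# ∷ p ⊗ r) i)) ⟩
      (coeff (a ⊙ q) i + coeff (a ⊙ r) i) + (coeff (0# ∷ p ⊗ q) i + coeff (0# ∷ p ⊗ r) i)
        ≈⟨ solve 4 (λ x y z w → (x :+ y) :+ (z :+ w) := (x :+ z) :+ (y :+ w)) refl _ _ _ _ ⟩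
      (coeff (a ⊙ q) i + coeff (0# ∷ p ⊗ q) i) + (coeff (a ⊙ r) i + coeff (0# ∷ p ⊗ r) i)
        ≈⟨ sym (trans (coeff-⊕ ((a ∷ p) ⊗ q) _ i) (+-cong (coeff-⊕ (a ⊙ q) _ i) (coeff-⊕ (a ⊙ r) _ i))) ⟩
      coeff ((a ∷ p) ⊗ q ⊕ (a ∷ p) ⊗ r) i ∎

    ⊗-distribʳ : ∀ p q r → (q ⊕ r) ⊗ p ≋ q ⊗ p ⊕ r ⊗ p
    ⊗-distribʳ p q r = ≋-trans (⊗-comm (q ⊕ r) p) (≋-trans (⊗-distribˡ p q r) (⊕-cong (⊗-comm p q) (⊗-comm p r)))

    ⊙-⊗ : ∀ a p q → (a ⊙ p) ⊗ q ≋ a ⊙ (p ⊗ q)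
    ⊙-⊗ a [] q = ≋-refl
    ⊙-⊗ a (b ∷ p) q = mk λ i → begin
      coeff ((a * b) ⊙ q ⊕ (0# ∷ (a ⊙ p) ⊗ q)) i ≈⟨ coeff-⊕ ((a * b) ⊙ q) _ i ⟩
      coeff ((a * b) ⊙ q) i + coeff (0# ∷ (a ⊙ p) ⊗ q) i
        ≈⟨ +-cong (trans (coeff-⊙ (a * b) q i) (trans (*-assoc _ _ _) (*-congˡ (sym (coeff-⊙ b q i)))))
                  (trans (at (∷-cong (sym (zeroʳ a)) (⊙-⊗ a p q)) i) (coeff-⊙ a (0# ∷ p ⊗ q) i)) ⟩
      a * coeff (b ⊙ q) i + a * coeff (0# ∷ p ⊗ q) i ≈⟨ sym (distribˡ _ _ _) ⟩
      a * (coeff (b ⊙ q) i + coeff (0# ∷ p ⊗ q) i) ≈⟨ *-congˡ (sym (coeff-⊕ (b ⊙ q) _ i)) ⟩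
      a * coeff ((b ∷ p) ⊗ q) i ≈⟨ sym (coeff-⊙ a ((b ∷ p) ⊗ q) i) ⟩
      coeff (a ⊙ ((b ∷ p) ⊗ q)) i ∎

    shift-⊗ : ∀ p q → (0# ∷ p) ⊗ q ≋ 0# ∷ p ⊗ q
    shift-⊗ p q = mk λ i → trans (coeff-⊕ (0# ⊙ q) _ i) (trans (+-congʳ (trans (coeff-⊙ 0# q i) (zeroˡ _))) (+-identityˡ _))

    ⊗-assoc : ∀ p q r → (p ⊗ q) ⊗ r ≋ p ⊗ (q ⊗ r)
    ⊗-assoc [] q r = ≋-refl
    ⊗-assoc (a ∷ p) q r = ≋-trans (⊗-distribʳ r (a ⊙ q) (0# ∷ p ⊗ q))
      (⊕-cong (⊙-⊗ a q r) (≋-trans (shift-⊗ (p ⊗ q) r) (∷-cong refl (⊗-assoc p q r))))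

    C-⊗ : ∀ a q → C a ⊗ q ≋ a ⊙ q
    C-⊗ a q = ≋-trans (⊕-cong ≋-refl (∷-zero refl ≋-refl)) (⊕-identityʳ _)

    ⊗-identityˡ : ∀ q → C 1# ⊗ q ≋ q
    ⊗-identityˡ q = ≋-trans (C-⊗ 1# q) (mk λ i → trans (coeff-⊙ 1# q i) (*-identityˡ _))

    C-⊕ : ∀ a b → C (a + b) ≋ C a ⊕ C b
    C-⊕ a b = ≋-refl

    C-⊗-C : ∀ a b → C (a * b) ≋ C a ⊗ C b
    C-⊗-C a b = ≋-sym (C-⊗ a (C b))

    ⊙-[] : ∀ a → a ⊙ [] ≋ []
    ⊙-[] a = ≋-refl

    ⊙-∷ : ∀ a b p → a ⊙ (b ∷ p) ≋ (a * b) ∷ (a ⊙ p)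
    ⊙-∷ a b p = ≋-refl

  poly : CRing
  poly = record
    { Carrier = List Carrier ; _≈_ = _≋_ ; _+_ = _⊕_ ; _*_ = _⊗_ ; -_ = ⊖_ ; 0# = [] ; 1# = C 1#
    ; isCommutativeRing = record
      { isRing = record
        { +-isAbelianGroup = record
          { isGroup = record
            { isMonoid = record
              { isSemigroup = record
                { isMagma = record
                  { isEquivalence = record { refl = ≋-refl ; sym = ≋-sym ; trans = ≋-trans }
                  ; ∙-cong = ⊕-cong }
                ; assoc = ⊕-assoc }
              ; identity = ⊕-identityˡ , ⊕-identityʳ }
            ; inverse = (λ p → ≋-trans (⊕-comm (⊖ p) p) (⊖-inverseʳ p)) , ⊖-inverseʳ
            ; ⁻¹-cong = ⊖-cong }
          ; comm = ⊕-comm }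
        ; *-cong = ⊗-cong
        ; *-assoc = ⊗-assoc
        ; *-identity = ⊗-identityˡ , (λ q → ≋-trans (⊗-comm q (C 1#)) (⊗-identityˡ q))
        ; distrib = ⊗-distribˡ , ⊗-distribʳ }
      ; *-comm = ⊗-comm } }

  X : List Carrier
  X = 0# ∷ 1# ∷ []

  opaque
    unfolding _⊕_ _⊙_ ⊖_ _⊗_

    ∷-decomp : ∀ a p → (a ∷ p) ≋ C a ⊕ X ⊗ p
    ∷-decomp a p = ≋-sym (≋-trans (⊕-cong (≋-refl {C a}) (≋-trans (shift-⊗ (C 1#) p) (∷-cong refl (⊗-identityˡ p)))) (∷-cong (+-identityʳ a) ≋-refl))

-- Homomorphisms and evaluation of polynomials.

Car : CRing → Set
Car = CommutativeRing.Carrier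

record Hom (R T : CRing) : Set where
  private
    module R = RingTools R
    module T = RingTools T
  field
    f      : R.Carrier → T.Carrier
    f-cong : ∀ {x y} → x R.≈ y → f x T.≈ f y
    f-+    : ∀ x y → f (x R.+ y) T.≈ f x T.+ f y
    f-*    : ∀ x y → f (x R.* y) T.≈ f x T.* f y
    f-1    : f R.1# T.≈ T.1#
  f-0 : f R.0# T.≈ T.0#
  f-0 = T.x+x≈x⇒x≈0 _ (T.trans (T.sym (f-+ R.0# R.0#)) (f-cong (R.+-identityˡ R.0#)))
  f-neg : ∀ x → f (R.- x) T.≈ T.- f x
  f-neg x = T.+-cancelʳ (f x) _ _ (T.trans (T.sym (f-+ (R.- x) x)) (T.trans (f-cong (R.-‿inverseˡ x)) (T.trans f-0 (T.sym (T.-‿inverseˡ (f x))))))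
  f-sub : ∀ x y → f (x R.- y) T.≈ f x T.- f y
  f-sub x y = T.trans (f-+ x (R.- y)) (T.+-congˡ (f-neg y))
  f-^ : ∀ x n → f (x R.^ n) T.≈ f x T.^ n
  f-^ x zero = f-1
  f-^ x (suc n) = T.trans (f-* x (x R.^ n)) (T.*-congˡ (f-^ x n))
  f-zero : ∀ {x} → x R.≈ R.0# → f x T.≈ T.0#
  f-zero e = T.trans (f-cong e) f-0
  f-· : ∀ n → f (n R.· R.1#) T.≈ n T.· T.1#
  f-· zero = f-0
  f-· (suc n) = T.trans (f-cong (R.·-suc n R.1#)) (T.trans (f-+ _ _) (T.trans (T.+-cong f-1 (f-· n)) (T.sym (T.·-suc n T.1#))))

idHom : ∀ R → Hom R R
idHom R = record { f = λ x → x ; f-cong = λ e → e ; f-+ = λ _ _ → refl ; f-* = λ _ _ → refl ; f-1 = refl }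
  where open RingTools R

_∘H_ : ∀ {R S T} → Hom S T → Hom R S → Hom R T
_∘H_ {R} {S} {T} g h = record
  { f = λ x → g.f (h.f x) ; f-cong = λ e → g.f-cong (h.f-cong e)
  ; f-+ = λ x y → T.trans (g.f-cong (h.f-+ x y)) (g.f-+ _ _)
  ; f-* = λ x y → T.trans (g.f-cong (h.f-* x y)) (g.f-* _ _)
  ; f-1 = T.trans (g.f-cong h.f-1) g.f-1 }
  where
  module g = Hom g
  module h = Hom h
  module T = RingTools T

CHom : ∀ R → Hom R (PolyRing.poly R)
CHom R = record
  { f = P.C ; f-cong = λ e → P.∷-cong e P.≋-refl ; f-+ = P.C-⊕
  ; f-* = P.C-⊗-C ; f-1 = P.≋-refl }
  where module P = PolyRing R

module Evaluation {R T : CRing} (h : Hom R T) (x : Car T) where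
  private
    module R = RingTools R
  open PolyRing R
  open RingTools T
  open Hom h

  ev : List R.Carrier → Carrier
  ev [] = 0#
  ev (a ∷ p) = f a + x * ev p

  ev-zero : ∀ {p} → p ≋ [] → ev p ≈ 0#
  ev-zero {[]} e = refl
  ev-zero {a ∷ p} e = trans (+-cong (f-zero (at e 0)) (trans (*-congˡ (ev-zero (tail-zero e))) (zeroʳ x))) (+-identityˡ 0#)

  ev-cong : ∀ {p q} → p ≋ q → ev p ≈ ev q
  ev-cong {[]} {q} e = sym (ev-zero (≋-sym e))
  ev-cong {a ∷ p} {[]} e = ev-zero e
  ev-cong {a ∷ p} {b ∷ q} e = +-cong (f-cong (at e 0)) (*-congˡ (ev-cong (tail-≋ e)))

  opaque
    unfolding _⊕_ _⊙_ ⊖_ _⊗_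

    ev-⊕ : ∀ p q → ev (p ⊕ q) ≈ ev p + ev q
    ev-⊕ [] q = sym (+-identityˡ _)
    ev-⊕ (a ∷ p) [] = sym (+-identityʳ _)
    ev-⊕ (a ∷ p) (b ∷ q) = trans (+-cong (f-+ a b) (*-congˡ (ev-⊕ p q)))
      (solve 5 (λ a b x p q → (a :+ b) :+ x :* (p :+ q) := (a :+ x :* p) :+ (b :+ x :* q)) refl (f a) (f b) x (ev p) (ev q))

    ev-⊙ : ∀ a p → ev (a ⊙ p) ≈ f a * ev p
    ev-⊙ a [] = sym (zeroʳ _)
    ev-⊙ a (b ∷ p) = trans (+-cong (f-* a b) (*-congˡ (ev-⊙ a p)))
      (solve 4 (λ a b x p → a :* b :+ x :* (a :* p) := a :* (b :+ x :* p)) refl (f a) (f b) x (ev p))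

    ev-⊗ : ∀ p q → ev (p ⊗ q) ≈ ev p * ev q
    ev-⊗ [] q = sym (zeroˡ _)
    ev-⊗ (a ∷ p) q = begin
      ev (a ⊙ q ⊕ (R.0# ∷ p ⊗ q))        ≈⟨ ev-⊕ (a ⊙ q) _ ⟩
      ev (a ⊙ q) + (f R.0# + x * ev (p ⊗ q)) ≈⟨ +-cong (ev-⊙ a q) (+-cong f-0 (*-congˡ (ev-⊗ p q))) ⟩
      f a * ev q + (0# + x * (ev p * ev q))
        ≈⟨ solve 4 (λ a q x p → a :* q :+ (con (+ 0) :+ x :* (p :* q)) := (a :+ x :* p) :* q) refl (f a) (ev q) x (ev p) ⟩
      (f a + x * ev p) * ev q ∎

  ev-C : ∀ a → ev (C a) ≈ f a
  ev-C a = trans (+-congˡ (zeroʳ x)) (+-identityʳ _)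

  ev-X : ev X ≈ x
  ev-X = trans (+-cong f-0 (*-congˡ (trans (ev-C R.1#) f-1))) (trans (+-identityˡ _) (*-identityʳ x))

  evHom : Hom poly T
  evHom = record { f = ev ; f-cong = ev-cong ; f-+ = ev-⊕ ; f-* = ev-⊗ ; f-1 = trans (ev-C R.1#) f-1 }

-- Extended derivations live over this evaluation; the lemma lets `transportDer` turn them into
-- derivations of the polynomial ring itself.
ev-id : ∀ R p → let open PolyRing R in Evaluation.ev (CHom R) X p ≋ p
ev-id R [] = PolyRing.≋-refl R
ev-id R (a ∷ p) = ≋-trans (⊕-cong (≋-refl {C a}) (⊗-cong (≋-refl {X}) (ev-id R p))) (≋-sym (∷-decomp a p))
  where open PolyRing R

-- Derivations along a homomorphism and their extension to polynomials.

record Der {R T : CRing} (h : Hom R T) : Set where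
  private
    module R = RingTools R
    module T = RingTools T
    module h = Hom h
  field
    d      : R.Carrier → T.Carrier
    d-cong : ∀ {x y} → x R.≈ y → d x T.≈ d y
    d-+    : ∀ x y → d (x R.+ y) T.≈ d x T.+ d y
    d-*    : ∀ x y → d (x R.* y) T.≈ h.f x T.* d y T.+ h.f y T.* d x
  d-0 : d R.0# T.≈ T.0#
  d-0 = T.x+x≈x⇒x≈0 _ (T.trans (T.sym (d-+ R.0# R.0#)) (d-cong (R.+-identityˡ R.0#)))
  d-neg : ∀ x → d (R.- x) T.≈ T.- d x
  d-neg x = T.+-cancelʳ (d x) _ _ (T.trans (T.sym (d-+ (R.- x) x)) (T.trans (d-cong (R.-‿inverseˡ x)) (T.trans d-0 (T.sym (T.-‿inverseˡ (d x))))))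
  d-sub : ∀ x y → d (x R.- y) T.≈ d x T.- d y
  d-sub x y = T.trans (d-+ x (R.- y)) (T.+-congˡ (d-neg y))
  d-1 : d R.1# T.≈ T.0#
  d-1 = T.x+x≈x⇒x≈0 _ (T.sym (T.trans (d-cong (R.sym (R.*-identityˡ R.1#))) (T.trans (d-* R.1# R.1#)
          (T.+-cong (T.trans (T.*-congʳ h.f-1) (T.*-identityˡ _)) (T.trans (T.*-congʳ h.f-1) (T.*-identityˡ _))))))
  d-^ : ∀ x n → d (x R.^ suc n) T.≈ (suc n T.· T.1#) T.* h.f x T.^ n T.* d x
  d-^ x zero = T.trans (d-* x R.1#) (T.trans (T.+-cong (T.trans (T.*-congˡ d-1) (T.zeroʳ _)) (T.*-congʳ h.f-1))
     (T.solve 1 (λ y → T.con (+ 0) T.:+ T.con (+ 1) T.:* y T.:= T.con (+ 1) T.:* T.con (+ 1) T.:* y) T.refl (d x)))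
  d-^ x (suc n) = T.trans (d-* x (x R.^ suc n)) (T.trans (T.+-cong (T.*-congˡ (d-^ x n)) (T.*-congʳ (h.f-^ x (suc n))))
     (T.trans (T.solve 4 (λ x m y d → x T.:* (m T.:* y T.:* d) T.:+ (x T.:* y) T.:* d T.:= (T.con (+ 1) T.:+ m) T.:* (x T.:* y) T.:* d) T.refl (h.f x) (suc n T.· T.1#) (h.f x T.^ n) (d x))
        (T.*-congʳ (T.*-congʳ (T.sym (T.·-suc (suc n) T.1#))))))
  d-zero : ∀ {x} → x R.≈ R.0# → d x T.≈ T.0#
  d-zero e = T.trans (d-cong e) d-0

zeroDer : ∀ {R T} (h : Hom R T) → Der h
zeroDer {R} {T} h = record { d = λ _ → 0# ; d-cong = λ _ → refl ; d-+ = λ _ _ → sym (+-identityˡ _)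
  ; d-* = λ x y → sym (trans (+-cong (zeroʳ _) (zeroʳ _)) (+-identityˡ _)) }
  where open RingTools T

transportDer : ∀ {R T} {h h' : Hom R T} → (∀ x → CommutativeRing._≈_ T (Hom.f h x) (Hom.f h' x)) → Der h → Der h'
transportDer {R} {T} e δ = record { d = d ; d-cong = d-cong ; d-+ = d-+
  ; d-* = λ x y → trans (d-* x y) (+-cong (*-congʳ (e x)) (*-congʳ (e y))) }
  where
  open RingTools T
  open Der δ

module ExtendDer {R T : CRing} (h : Hom R T) (δ : Der h) (x b : Car T) where
  private
    module R = RingTools R
  open PolyRing R
  open RingTools T
  open Hom h
  open Evaluation h x
  open Der δ

  -- The Leibniz rule for `a + X p`: it extends `δ`, along evaluation at `x`, by sending `X` to `b`.
  D : List R.Carrier → Carrier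
  D [] = 0#
  D (a ∷ p) = d a + (b * ev p + x * D p)

  D-zero : ∀ {p} → p ≋ [] → D p ≈ 0#
  D-zero {[]} e = refl
  D-zero {a ∷ p} e = trans (+-cong (d-zero (at e 0)) (+-cong (*-congˡ (ev-zero (tail-zero e))) (*-congˡ (D-zero (tail-zero e)))))
    (solve 2 (λ b x → con (+ 0) :+ (b :* con (+ 0) :+ x :* con (+ 0)) := con (+ 0)) refl b x)

  D-cong : ∀ {p q} → p ≋ q → D p ≈ D q
  D-cong {[]} {q} e = sym (D-zero (≋-sym e))
  D-cong {a ∷ p} {[]} e = D-zero e
  D-cong {a ∷ p} {c ∷ q} e = +-cong (d-cong (at e 0)) (+-cong (*-congˡ (ev-cong (tail-≋ e))) (*-congˡ (D-cong (tail-≋ e))))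

  opaque
    unfolding _⊕_ _⊙_ ⊖_ _⊗_

    D-⊕ : ∀ p q → D (p ⊕ q) ≈ D p + D q
    D-⊕ [] q = sym (+-identityˡ _)
    D-⊕ (a ∷ p) [] = sym (+-identityʳ _)
    D-⊕ (a ∷ p) (c ∷ q) = trans (+-cong (d-+ a c) (+-cong (*-congˡ (ev-⊕ p q)) (*-congˡ (D-⊕ p q))))
      (solve 8 (λ a c b p q x u v → (a :+ c) :+ (b :* (p :+ q) :+ x :* (u :+ v)) := (a :+ (b :* p :+ x :* u)) :+ (c :+ (b :* q :+ x :* v)))
        refl (d a) (d c) b (ev p) (ev q) x (D p) (D q))

    D-⊙ : ∀ a p → D (a ⊙ p) ≈ f a * D p + ev p * d a
    D-⊙ a [] = sym (trans (+-cong (zeroʳ _) (zeroˡ _)) (+-identityˡ _))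
    D-⊙ a (c ∷ p) = trans (+-cong (d-* a c) (+-cong (*-congˡ (ev-⊙ a p)) (*-congˡ (D-⊙ a p))))
      (solve 8 (λ fa dc fc da b e x dp → (fa :* dc :+ fc :* da) :+ (b :* (fa :* e) :+ x :* (fa :* dp :+ e :* da))
          := fa :* (dc :+ (b :* e :+ x :* dp)) :+ (fc :+ x :* e) :* da) refl (f a) (d c) (f c) (d a) b (ev p) x (D p))

    D-⊗ : ∀ p q → D (p ⊗ q) ≈ ev p * D q + ev q * D p
    D-⊗ [] q = sym (trans (+-cong (zeroˡ _) (zeroʳ _)) (+-identityˡ _))
    D-⊗ (a ∷ p) q = begin
      D (a ⊙ q ⊕ (R.0# ∷ p ⊗ q)) ≈⟨ D-⊕ (a ⊙ q) _ ⟩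
      D (a ⊙ q) + (d R.0# + (b * ev (p ⊗ q) + x * D (p ⊗ q)))
        ≈⟨ +-cong (D-⊙ a q) (+-cong d-0 (+-cong (*-congˡ (ev-⊗ p q)) (*-congˡ (D-⊗ p q)))) ⟩
      (f a * D q + ev q * d a) + (0# + (b * (ev p * ev q) + x * (ev p * D q + ev q * D p)))
        ≈⟨ solve 8 (λ fa dq q da b p x dp → (fa :* dq :+ q :* da) :+ (con (+ 0) :+ (b :* (p :* q) :+ x :* (p :* dq :+ q :* dp)))
             := (fa :+ x :* p) :* dq :+ q :* (da :+ (b :* p :+ x :* dp))) refl (f a) (D q) (ev q) (d a) b (ev p) x (D p) ⟩
      (f a + x * ev p) * D q + ev q * (d a + (b * ev p + x * D p)) ∎

  D-C : ∀ a → D (C a) ≈ d a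
  D-C a = solve 3 (λ a b x → a :+ (b :* con (+ 0) :+ x :* con (+ 0)) := a) refl (d a) b x

  D-X : D X ≈ b
  D-X = trans (+-cong d-0 (+-cong (*-congˡ (trans (ev-C R.1#) f-1)) (*-congˡ (trans (D-C R.1#) d-1))))
    (solve 2 (λ b x → con (+ 0) :+ (b :* con (+ 1) :+ x :* con (+ 0)) := b) refl b x)

  DDer : Der evHom
  DDer = record { d = D ; d-cong = D-cong ; d-+ = D-⊕ ; d-* = D-⊗ }

-- Integral domains with decidable vanishing, and degrees.

record Domain (R : CRing) : Set where
  open RingTools R
  field
    zd   : ∀ x y → x * y ≈ 0# → x ≈ 0# ⊎ y ≈ 0#
    dec0 : ∀ x → Dec (x ≈ 0#)
    1≉0  : ¬ (1# ≈ 0#)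
  *≉0 : ∀ {x y} → ¬ x ≈ 0# → ¬ y ≈ 0# → ¬ x * y ≈ 0#
  *≉0 a b e with zd _ _ e
  ... | inj₁ x = a x
  ... | inj₂ y = b y
  ^≉0 : ∀ {x} n → ¬ x ≈ 0# → ¬ x ^ n ≈ 0#
  ^≉0 zero a = 1≉0
  ^≉0 (suc n) a = *≉0 a (^≉0 n a)
  cancel0 : ∀ {x y} → ¬ x ≈ 0# → x * y ≈ 0# → y ≈ 0#
  cancel0 a e with zd _ _ e
  ... | inj₁ x = ⊥-elim (a x)
  ... | inj₂ y = y
  x-y≈0 : ∀ {x y} → x - y ≈ 0# → x ≈ y
  x-y≈0 {x} {y} e = trans (solve 2 (λ x y → x := (x :- y) :+ y) refl x y) (trans (+-congʳ e) (+-identityˡ y))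
  cancelˡ : ∀ {x y z} → ¬ x ≈ 0# → x * y ≈ x * z → y ≈ z
  cancelˡ {x} {y} {z} a e = x-y≈0 (cancel0 a (trans (solve 3 (λ x y z → x :* (y :- z) := x :* y :- x :* z) refl x y z)
     (trans (+-congʳ e) (-‿inverseʳ _))))

module Degree (R : CRing) where
  open RingTools R
  open PolyRing R

  -- A strict bound: degree below `N`. Zero then satisfies every bound and `Deg 0` characterises it,
  -- so no degree has to be invented for it.
  record Deg (N : ℕ) (p : List Carrier) : Set where
    constructor deg
    field vanish : ∀ i → N ℕ.≤ i → coeff p i ≈ 0#
  open Deg public

  deg-cong : ∀ {N p q} → p ≋ q → Deg N p → Deg N q
  deg-cong e d = deg λ i l → trans (sym (at e i)) (vanish d i l)

  deg-mono : ∀ {M N p} → M ℕ.≤ N → Deg M p → Deg N p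
  deg-mono l d = deg λ i k → vanish d i (ℕ.≤-trans l k)

  deg-0 : ∀ {p} → Deg 0 p → p ≋ []
  deg-0 d = mk λ i → vanish d i z≤n

  deg-[] : ∀ {N} → Deg N []
  deg-[] = deg λ _ _ → refl

  deg-zero : ∀ {N p} → p ≋ [] → Deg N p
  deg-zero e = deg λ i _ → at e i

  deg-tail : ∀ {N a p} → Deg (suc N) (a ∷ p) → Deg N p
  deg-tail d = deg λ i l → vanish d (suc i) (s≤s l)

  deg-∷ : ∀ {N a p} → Deg N p → Deg (suc N) (a ∷ p)
  deg-∷ d = deg λ { (suc i) (s≤s l) → vanish d i l }

  deg-C : ∀ {a} → Deg 1 (C a)
  deg-C = deg-∷ deg-[]

  deg-length : ∀ p → Deg (List.length p) p
  deg-length [] = deg-[]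
  deg-length (a ∷ p) = deg-∷ (deg-length p)

  deg-⊕ : ∀ {N p q} → Deg N p → Deg N q → Deg N (p ⊕ q)
  deg-⊕ {_} {p} {q} d e = deg λ i l → trans (coeff-⊕ p q i) (trans (+-cong (vanish d i l) (vanish e i l)) (+-identityˡ _))

  deg-⊖ : ∀ {N p} → Deg N p → Deg N (⊖ p)
  deg-⊖ {_} {p} d = deg λ i l → trans (coeff-⊖ p i) (trans (-‿cong (vanish d i l)) -0#≈0#)

  deg-⊙ : ∀ {N} a {p} → Deg N p → Deg N (a ⊙ p)
  deg-⊙ a {p} d = deg λ i l → trans (coeff-⊙ a p i) (trans (*-congˡ (vanish d i l)) (zeroʳ _))

  opaque
    unfolding _⊕_ _⊙_ ⊖_ _⊗_

    -- One strict bound and one written as a successor, so that the bounds add up without a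
    -- predecessor.
    deg-⊗ : ∀ {M N} p {q} → Deg M p → Deg (suc N) q → Deg (M ℕ.+ N) (p ⊗ q)
    deg-⊗ [] d e = deg-[]
    deg-⊗ {zero} {N} (a ∷ p) {q} d e = deg-zero (zero-⊗ q (deg-0 d))
    deg-⊗ {suc M} {N} (a ∷ p) {q} d e = deg-⊕ (deg-⊙ a (deg-mono (s≤s (ℕ.m≤n+m N M)) e)) (deg-∷ (deg-⊗ p (deg-tail d) e))

    top-⊗ : ∀ {M N} p {q} → Deg (suc M) p → Deg (suc N) q → coeff (p ⊗ q) (M ℕ.+ N) ≈ coeff p M * coeff q N
    top-⊗ [] d e = sym (zeroˡ _)
    top-⊗ {zero} {N} (a ∷ p) {q} d e = trans (coeff-⊕ (a ⊙ q) _ N) (trans (+-cong (coeff-⊙ a q N)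
       (at (∷-zero refl (zero-⊗ q (deg-0 (deg-tail d)))) N)) (+-identityʳ _))
    top-⊗ {suc M} {N} (a ∷ p) {q} d e = trans (coeff-⊕ (a ⊙ q) (0# ∷ p ⊗ q) (suc (M ℕ.+ N)))
      (trans (+-cong (trans (coeff-⊙ a q (suc (M ℕ.+ N))) (trans (*-congˡ (vanish e _ (s≤s (ℕ.m≤n+m N M)))) (zeroʳ a))) (top-⊗ p (deg-tail d) e)) (+-identityˡ _))

  deg-pred : ∀ {N p} → Deg (suc N) p → coeff p N ≈ 0# → Deg N p
  deg-pred {N} {p} d e = deg go
    where
    go : ∀ i → N ℕ.≤ i → coeff p i ≈ 0#
    go i l with N ℕ.≟ i
    ... | yes ≡.refl = e
    ... | no ne = vanish d i (ℕ.≤∧≢⇒< l ne)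

  module _ (dom : Domain R) where
    open Domain dom

    leading : ∀ N p → Deg N p → p ≋ [] ⊎ ∃ λ m → m ℕ.< N × Deg (suc m) p × ¬ coeff p m ≈ 0#
    leading zero p d = inj₁ (deg-0 d)
    leading (suc N) p d with dec0 (coeff p N)
    ... | no ne = inj₂ (N , ℕ.≤-refl , d , ne)
    ... | yes e with leading N p (deg-pred d e)
    ... | inj₁ z = inj₁ z
    ... | inj₂ (m , l , dm , ne) = inj₂ (m , ℕ.m<n⇒m<1+n l , dm , ne)

    poly-zd : ∀ p q → p ⊗ q ≋ [] → p ≋ [] ⊎ q ≋ []
    poly-zd p q e with leading _ p (deg-length p) | leading _ q (deg-length q)
    ... | inj₁ z | _ = inj₁ z
    ... | inj₂ _ | inj₁ z = inj₂ z
    ... | inj₂ (m , _ , dm , nm) | inj₂ (n , _ , dn , nn) = ⊥-elim (*≉0 nm nn (trans (sym (top-⊗ p dm dn)) (at e (m ℕ.+ n))))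

    poly-dec0 : ∀ p → Dec (p ≋ [])
    poly-dec0 p with leading _ p (deg-length p)
    ... | inj₁ z = yes z
    ... | inj₂ (m , _ , _ , ne) = no λ z → ne (at z m)

    polyDomain : Domain poly
    polyDomain = record { zd = poly-zd ; dec0 = poly-dec0 ; 1≉0 = λ e → 1≉0 (at e 0) }

-- Quotient rings.

module Quotient (R : CRing) (g : Car R) where
  open RingTools R

  infix 4 _≃_
  -- The quotient keeps the carrier and only coarsens the equality, so reduction is the identity on
  -- representatives.
  record _≃_ (x y : Carrier) : Set where
    constructor quo
    field
      q  : Carrier
      eq : x - y ≈ g * q

  ≈⇒≃ : ∀ {x y} → x ≈ y → x ≃ y
  ≈⇒≃ {x} {y} e = quo 0# (trans (+-congʳ e) (trans (-‿inverseʳ y) (sym (zeroʳ g))))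

  ≃-sym : ∀ {x y} → x ≃ y → y ≃ x
  ≃-sym {x} {y} (quo q e) = quo (- q) (trans (solve 2 (λ x y → y :- x := :- (x :- y)) refl x y)
     (trans (-‿cong e) (-‿distribʳ-* g q)))

  ≃-trans : ∀ {x y z} → x ≃ y → y ≃ z → x ≃ z
  ≃-trans {x} {y} {z} (quo q e) (quo r f) = quo (q + r) (trans (solve 3 (λ x y z → x :- z := (x :- y) :+ (y :- z)) refl x y z)
     (trans (+-cong e f) (sym (distribˡ g q r))))

  +-cong' : ∀ {x y u v} → x ≃ y → u ≃ v → x + u ≃ y + v
  +-cong' {x} {y} {u} {v} (quo q e) (quo r f) = quo (q + r) (trans (solve 4 (λ x y u v → (x :+ u) :- (y :+ v) := (x :- y) :+ (u :- v)) refl x y u v)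
     (trans (+-cong e f) (sym (distribˡ g q r))))

  *-cong' : ∀ {x y u v} → x ≃ y → u ≃ v → x * u ≃ y * v
  *-cong' {x} {y} {u} {v} (quo q e) (quo r f) = quo (u * q + y * r)
     (trans (solve 4 (λ x y u v → (x :* u) :- (y :* v) := u :* (x :- y) :+ y :* (u :- v)) refl x y u v)
     (trans (+-cong (*-congˡ e) (*-congˡ f)) (solve 5 (λ u g q y r → u :* (g :* q) :+ y :* (g :* r) := g :* (u :* q :+ y :* r)) refl u g q y r)))

  neg-cong' : ∀ {x y} → x ≃ y → - x ≃ - y
  neg-cong' {x} {y} (quo q e) = quo (- q) (trans (solve 2 (λ x y → :- x :- :- y := :- (x :- y)) refl x y) (trans (-‿cong e) (-‿distribʳ-* g q)))

  quotient : CRing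
  quotient = record
    { Carrier = Carrier ; _≈_ = _≃_ ; _+_ = _+_ ; _*_ = _*_ ; -_ = -_ ; 0# = 0# ; 1# = 1#
    ; isCommutativeRing = record
      { isRing = record
        { +-isAbelianGroup = record
          { isGroup = record
            { isMonoid = record
              { isSemigroup = record
                { isMagma = record
                  { isEquivalence = record { refl = ≈⇒≃ refl ; sym = ≃-sym ; trans = ≃-trans }
                  ; ∙-cong = +-cong' }
                ; assoc = λ x y z → ≈⇒≃ (+-assoc x y z) }
              ; identity = (λ x → ≈⇒≃ (+-identityˡ x)) , (λ x → ≈⇒≃ (+-identityʳ x)) }
            ; inverse = (λ x → ≈⇒≃ (-‿inverseˡ x)) , (λ x → ≈⇒≃ (-‿inverseʳ x))
            ; ⁻¹-cong = neg-cong' }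
          ; comm = λ x y → ≈⇒≃ (+-comm x y) }
        ; *-cong = *-cong'
        ; *-assoc = λ x y z → ≈⇒≃ (*-assoc x y z)
        ; *-identity = (λ x → ≈⇒≃ (*-identityˡ x)) , (λ x → ≈⇒≃ (*-identityʳ x))
        ; distrib = (λ x y z → ≈⇒≃ (distribˡ x y z)) , (λ x y z → ≈⇒≃ (distribʳ x y z)) }
      ; *-comm = λ x y → ≈⇒≃ (*-comm x y) } }

  infix 4 ∣_
  record ∣_ (x : Carrier) : Set where
    constructor div
    field
      q  : Carrier
      eq : x ≈ g * q

  ≃0⇒∣ : ∀ {x} → x ≃ 0# → ∣ x
  ≃0⇒∣ {x} (quo q e) = div q (trans (solve 1 (λ x → x := x :- con (+ 0)) refl x) e)

  ∣⇒≃0 : ∀ {x} → ∣ x → x ≃ 0#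
  ∣⇒≃0 {x} (div q e) = quo q (trans (solve 1 (λ x → x :- con (+ 0) := x) refl x) e)

  quotHom : Hom R quotient
  quotHom = record { f = λ x → x ; f-cong = ≈⇒≃ ; f-+ = λ _ _ → ≈⇒≃ refl ; f-* = λ _ _ → ≈⇒≃ refl ; f-1 = ≈⇒≃ refl }

-- Finite sums and homogeneous linear systems.

module Sums (R : CRing) where
  open RingTools R

  opaque
    sum : ∀ {n} → (Fin n → Carrier) → Carrier
    sum {zero} t = 0#
    sum {suc n} t = t zero + sum (t ∘ suc)

  opaque
    unfolding sum

    sum-zero : ∀ {t : Fin 0 → Carrier} → sum t ≈ 0#
    sum-zero = refl

    sum-suc : ∀ {n} (t : Fin (suc n) → Carrier) → sum t ≈ t zero + sum (t ∘ suc)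
    sum-suc t = refl

    sum-cong : ∀ {n} {s t : Fin n → Carrier} → (∀ i → s i ≈ t i) → sum s ≈ sum t
    sum-cong {zero} e = refl
    sum-cong {suc n} e = +-cong (e zero) (sum-cong (λ i → e (suc i)))

    sum-0 : ∀ {n} {t : Fin n → Carrier} → (∀ i → t i ≈ 0#) → sum t ≈ 0#
    sum-0 {zero} e = refl
    sum-0 {suc n} e = trans (+-cong (e zero) (sum-0 (λ i → e (suc i)))) (+-identityˡ 0#)

    sum-+ : ∀ {n} (s t : Fin n → Carrier) → sum (λ i → s i + t i) ≈ sum s + sum t
    sum-+ {zero} s t = sym (+-identityˡ 0#)
    sum-+ {suc n} s t = trans (+-congˡ (sum-+ (s ∘ suc) (t ∘ suc)))
      (solve 4 (λ a b c d → (a :+ b) :+ (c :+ d) := (a :+ c) :+ (b :+ d)) refl (s zero) (t zero) _ _)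

    sum-*ˡ : ∀ {n} a (t : Fin n → Carrier) → sum (λ i → a * t i) ≈ a * sum t
    sum-*ˡ {zero} a t = sym (zeroʳ a)
    sum-*ˡ {suc n} a t = trans (+-congˡ (sum-*ˡ a (t ∘ suc))) (sym (distribˡ a _ _))

    sum-single : ∀ {n} (t : Fin n → Carrier) j → (∀ i → ¬ i ≡ j → t i ≈ 0#) → sum t ≈ t j
    sum-single t zero e = trans (+-congˡ (sum-0 {t = t ∘ suc} (λ i → e (suc i) λ ()))) (+-identityʳ _)
    sum-single t (suc j) e = trans (+-cong (e zero λ ()) (sum-single (t ∘ suc) j (λ i ne → e (suc i) λ { ≡.refl → ne ≡.refl }))) (+-identityˡ _)

    sum-split : ∀ m n (t : Fin (m ℕ.+ n) → Carrier) → sum t ≈ sum (λ i → t (i ↑ˡ n)) + sum (λ i → t (m ↑ʳ i))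
    sum-split zero n t = sym (+-identityˡ _)
    sum-split (suc m) n t = trans (+-congˡ (sum-split m n (t ∘ suc))) (sym (+-assoc _ _ _))

    sum-combine : ∀ m n (t : Fin (m ℕ.* n) → Carrier) → sum t ≈ sum {m} (λ i → sum {n} (λ j → t (combine i j)))
    sum-combine zero n t = refl
    sum-combine (suc m) n t = trans (sum-split n (m ℕ.* n) t) (+-congˡ (sum-combine m n (t ∘ (n ↑ʳ_))))

  sum-comm : ∀ {m n} (t : Fin m → Fin n → Carrier) → sum (λ i → sum (t i)) ≈ sum (λ j → sum (λ i → t i j))
  sum-comm {zero} t = trans sum-zero (sym (sum-0 λ j → sum-zero))
  sum-comm {suc m} t = trans (sum-suc _) (trans (+-congˡ (sum-comm (t ∘ suc))) (trans (sym (sum-+ _ _)) (sum-cong λ j → sym (sum-suc _))))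

  without : ∀ {n} → Fin n → (Fin n → Carrier) → Fin n → Carrier
  without l t i with i Fin.≟ l
  ... | yes _ = 0#
  ... | no _ = t i

  sum-without : ∀ {n} l (t : Fin n → Carrier) → sum t ≈ t l + sum (without l t)
  sum-without l t = trans (sum-cong split) (trans (sum-+ _ _) (+-congʳ (trans (sum-single only l off) on)))
    where
    only : ∀ i → Carrier
    only i = t i - without l t i
    split : ∀ i → t i ≈ only i + without l t i
    split i = solve 2 (λ a b → a := (a :- b) :+ b) refl (t i) _
    off : ∀ i → ¬ i ≡ l → only i ≈ 0#
    off i ne with i Fin.≟ l
    ... | yes e = ⊥-elim (ne e)
    ... | no _ = -‿inverseʳ _
    on : only l ≈ t l
    on with l Fin.≟ l
    ... | yes _ = trans (+-congˡ -0#≈0#) (+-identityʳ _)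
    ... | no ne = ⊥-elim (ne ≡.refl)

  dot : ∀ {n} → (Fin n → Carrier) → (Fin n → Carrier) → Carrier
  dot a x = sum (λ i → a i * x i)

  dot-comb : ∀ {n} a b (r s x : Fin n → Carrier) → dot (λ i → a * r i - b * s i) x ≈ a * dot r x - b * dot s x
  dot-comb {zero} a b r s x = trans sum-zero (trans (solve 2 (λ a b → con (+ 0) := a :* con (+ 0) :- b :* con (+ 0)) refl a b)
    (+-cong (*-congˡ (sym sum-zero)) (-‿cong (*-congˡ (sym sum-zero)))))
  dot-comb {suc n} a b r s x = trans (sum-suc _) (trans (+-congˡ (dot-comb a b (r ∘ suc) (s ∘ suc) (x ∘ suc)))
    (trans (solve 7 (λ a b r s x u v → (a :* r :- b :* s) :* x :+ (a :* u :- b :* v) := a :* (r :* x :+ u) :- b :* (s :* x :+ v)) refl a b (r zero) (s zero) (x zero) _ _)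
    (+-cong (*-congˡ (sym (sum-suc _))) (-‿cong (*-congˡ (sym (sum-suc _)))))))

module SumHom {R T : CRing} (h : Hom R T) where
  private
    module R = RingTools R
    module T = RingTools T
    module SR = Sums R
    module ST = Sums T
  open Hom h
  f-sum : ∀ {n} (t : Fin n → R.Carrier) → f (SR.sum t) T.≈ ST.sum (λ i → f (t i))
  f-sum {zero} t = T.trans (f-cong SR.sum-zero) (T.trans f-0 (T.sym ST.sum-zero))
  f-sum {suc n} t = T.trans (f-cong (SR.sum-suc t)) (T.trans (f-+ _ _) (T.trans (T.+-congˡ (f-sum (t ∘ suc))) (T.sym (ST.sum-suc _))))

module LinearAlgebra (K : CRing) (dom : Domain K) where
  open RingTools K
  open Domain dom
  open Sums K

  private
    -- The last component reassembles a property of all equations from the pivot equation and the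
    -- others, so the position of the pivot never has to be recorded.
    pivot : ∀ {n} (es : List (Fin (suc n) → Carrier)) → All (λ e → e zero ≈ 0#) es ⊎
      ∃ λ e₀ → ∃ λ rest → ¬ (e₀ zero ≈ 0#) × suc (length rest) ≡ length es ×
        (∀ {P : (Fin (suc n) → Carrier) → Set} → P e₀ → All P rest → All P es)
    pivot [] = inj₁ []
    pivot (e ∷ es) with dec0 (e zero)
    ... | no ne = inj₂ (e , es , ne , ≡.refl , _∷_)
    ... | yes z with pivot es
    ... | inj₁ a = inj₁ (z ∷ a)
    ... | inj₂ (e₀ , rest , ne , l , k) = inj₂ (e₀ , e ∷ rest , ne , ≡.cong suc l , λ { p (q ∷ r) → q ∷ k p r })

  -- Fraction-free elimination of the first unknown.
  solution : ∀ n (es : List (Fin n → Carrier)) → length es ℕ.< n →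
    ∃ λ x → (∃ λ i → ¬ (x i ≈ 0#)) × All (λ e → dot e x ≈ 0#) es
  solution (suc n) es l with pivot es
  -- No equation involves the first unknown, so the first unit vector is a nonzero solution.
  ... | inj₁ zs = δ , (zero , 1≉0) , All.map (λ {e} z → trans (sum-suc _) (trans (+-cong (trans (*-identityʳ _) z) (sum-0 (λ i → zeroʳ _))) (+-identityˡ 0#))) zs
    where
    δ : Fin (suc n) → Carrier
    δ zero = 1#
    δ (suc _) = 0#
  ... | inj₂ (e₀ , rest , ne , len , k) with solution n (map reduce rest) (ℕ.≤-pred (ℕ.≤-trans (s≤s (ℕ.≤-reflexive (≡.trans (≡.cong suc (length-map reduce rest)) len))) l))
    where
    reduce : (Fin (suc n) → Carrier) → Fin n → Carrier
    reduce e i = e₀ zero * e (suc i) - e zero * e₀ (suc i)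
  ... | x' , (i , nz) , sol = x , (suc i , *≉0 ne nz) , k eq₀ (All.map (λ {e} → eq e) (All.map⁻ sol))
    where
    x : Fin (suc n) → Carrier
    x zero = - dot (e₀ ∘ suc) x'
    x (suc i) = e₀ zero * x' i
    scaled : ∀ (r : Fin n → Carrier) → sum (λ i → r i * (e₀ zero * x' i)) ≈ e₀ zero * dot r x'
    scaled r = trans (sum-cong (λ i → solve 3 (λ r e x → r :* (e :* x) := e :* (r :* x)) refl (r i) (e₀ zero) (x' i))) (sum-*ˡ _ _)
    eq₀ : dot e₀ x ≈ 0#
    eq₀ = trans (sum-suc _) (trans (+-congˡ (scaled (e₀ ∘ suc))) (solve 2 (λ e d → e :* (:- d) :+ e :* d := con (+ 0)) refl (e₀ zero) _))
    eq : ∀ e → _ → dot e x ≈ 0#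
    eq e s = trans (sum-suc _) (trans (+-congˡ (scaled (e ∘ suc))) (trans (solve 4 (λ a d b c → a :* (:- d) :+ b :* c := b :* c :- a :* d) refl (e zero) _ (e₀ zero) _)
       (trans (sym (dot-comb (e₀ zero) (e zero) (e ∘ suc) (e₀ ∘ suc) x')) s)))

-- Exponents of monomials on a plane curve.

idx : ℕ → ℕ → List (ℕ × ℕ)
idx zero U = []
idx (suc d) zero = (0 , 0) ∷ []
idx (suc d) (suc U) = map (λ i → i , 0) (upTo (2 ℕ.+ U)) ++ map (λ ij → proj₁ ij , suc (proj₂ ij)) (idx d U)

-- `idx d U` lists the exponents of `V^i S^j` with `i + j ≤ U` and `j < d`, row by row in `j`: a
-- basis of the functions of degree at most `U` on a curve monic of degree `d` in `S`. So `len d` is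
-- the Hilbert function of such a curve.
len : ℕ → ℕ → ℕ
len zero U = 0
len (suc d) zero = 1
len (suc d) (suc U) = 2 ℕ.+ U ℕ.+ len d U

length-idx : ∀ d U → length (idx d U) ≡ len d U
length-idx zero U = ≡.refl
length-idx (suc d) zero = ≡.refl
length-idx (suc d) (suc U) = ≡.trans (length-++ (map (λ i → i , 0) (upTo (2 ℕ.+ U))))
  (≡.cong₂ ℕ._+_ (≡.trans (length-map _ (upTo (2 ℕ.+ U))) (length-upTo (2 ℕ.+ U))) (≡.trans (length-map _ (idx d U)) (length-idx d U)))

-- From `U = d - 1` on, all `d` rows are present and each grows by `δ`. The slope `d` is what
-- becomes the degree of the curve in Bezout's bound.
len-+ : ∀ d U δ → d ℕ.≤ suc U → len d (U ℕ.+ δ) ≡ len d U ℕ.+ d ℕ.* δ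
len-+ zero U δ l = ≡.refl
len-+ (suc zero) zero zero l = ≡.refl
len-+ (suc zero) zero (suc δ) l = ≡.trans (ℕ.+-identityʳ (suc (suc δ))) (≡.cong suc (≡.sym (ℕ.+-identityʳ (suc δ))))
len-+ (suc (suc d)) zero δ (s≤s ())
len-+ (suc d) (suc U) δ (s≤s l) = begin
  2 ℕ.+ (U ℕ.+ δ) ℕ.+ len d (U ℕ.+ δ)             ≡⟨ ≡.cong (2 ℕ.+ (U ℕ.+ δ) ℕ.+_) (len-+ d U δ l) ⟩
  2 ℕ.+ (U ℕ.+ δ) ℕ.+ (len d U ℕ.+ d ℕ.* δ)       ≡⟨ solve 4 (λ u e l m → con 2 :+ (u :+ e) :+ (l :+ m) := con 2 :+ u :+ l :+ (e :+ m)) ≡.refl U δ (len d U) (d ℕ.* δ) ⟩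
  2 ℕ.+ U ℕ.+ len d U ℕ.+ (δ ℕ.+ d ℕ.* δ) ∎
  where
  open ≡.≡-Reasoning
  open import Data.Nat.Solver
  open +-*-Solver

-- Below degree `d` the equation of the curve imposes nothing, so the whole triangle of monomials in
-- two variables is counted.
len-triangle : ∀ d μ → μ ℕ.< d → 2 ℕ.* len d μ ≡ suc μ ℕ.* (2 ℕ.+ μ)
len-triangle (suc d) zero l = ≡.refl
len-triangle (suc d) (suc μ) (s≤s l) = ≡.trans (ℕ.*-distribˡ-+ 2 (2 ℕ.+ μ) (len d μ))
  (≡.trans (≡.cong (2 ℕ.* (2 ℕ.+ μ) ℕ.+_) (len-triangle d μ l))
    (solve 1 (λ m → con 2 :* (con 2 :+ m) :+ (con 1 :+ m) :* (con 2 :+ m) := (con 2 :+ m) :* (con 3 :+ m)) ≡.refl μ))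
  where
  open import Data.Nat.Solver
  open +-*-Solver

-- R stands for the coordinate ring of a plane curve of degree e + 1: Fil U is the image of the polynomials of
-- degree at most U, and coord (i , j) reads off the coefficient of V^i S^j in a reduced representative.
record Curve (K R : CRing) : Set₁ where
  field
    domK : Domain K
    domR : Domain R
    ι    : Hom K R
    der  : Der (idHom R)
  private
    module K = RingTools K
  open RingTools R
  open Hom ι renaming (f to inj)
  open Der der
  field
    d-ι     : ∀ c → d (inj c) ≈ 0#
    V S     : Carrier
    e       : ℕ
    Fil     : ℕ → Carrier → Set
    fil-cong : ∀ {U x y} → x ≈ y → Fil U x → Fil U y
    fil-mono : ∀ {U U' x} → U ℕ.≤ U' → Fil U x → Fil U' x
    fil-+   : ∀ {U x y} → Fil U x → Fil U y → Fil U (x + y)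
    fil-*   : ∀ {U U' x y} → Fil U x → Fil U' y → Fil (U ℕ.+ U') (x * y)
    fil-ι   : ∀ c → Fil 0 (inj c)
    fil-V   : Fil 1 V
    fil-S   : Fil 1 S
    fil-d   : ∀ {U x} → Fil U x → Fil (U ℕ.+ suc e) (d x)
    coord   : ℕ × ℕ → Carrier → K.Carrier
    coord-cong : ∀ ij {x y} → x ≈ y → coord ij x K.≈ coord ij y
    coord-+ : ∀ ij x y → coord ij (x + y) K.≈ coord ij x K.+ coord ij y
    coord-ι : ∀ ij c x → coord ij (inj c * x) K.≈ c K.* coord ij x
  mon : ℕ × ℕ → Carrier
  mon (i , j) = V ^ i * S ^ j
  field
    complete : ∀ {U x} → Fil U x → All (λ ij → coord ij x K.≈ K.0#) (idx (suc e) U) → x ≈ 0#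
    independent : ∀ U (α : Fin (length (idx (suc e) U)) → K.Carrier) →
      Sums.sum R (λ l → inj (α l) * mon (lookup (idx (suc e) U) l)) ≈ 0# → ∀ l → α l K.≈ K.0#
    p       : ℕ
    p·1     : p · 1# ≈ 0#
    fermat  : ∀ c → c K.^ p K.≈ c
    small   : ∀ i → 0 ℕ.< i → i ℕ.< p → ¬ (i K.· K.1# K.≈ K.0#)

idx-bound : ∀ d U → All (λ ij → proj₁ ij ℕ.+ proj₂ ij ℕ.≤ U) (idx d U)
idx-bound zero U = []
idx-bound (suc d) zero = z≤n ∷ []
idx-bound (suc d) (suc U) = All.++⁺ (All.map⁺ (All.applyUpTo⁺₁ _ (2 ℕ.+ U) λ {i} l → ℕ.≤-trans (ℕ.≤-reflexive (ℕ.+-identityʳ i)) (ℕ.≤-pred l)))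
  (All.map⁺ (All.map (λ {ij} l → ℕ.≤-trans (ℕ.≤-reflexive (ℕ.+-suc (proj₁ ij) (proj₂ ij))) (s≤s l)) (idx-bound d U)))

-- Points of the curve, orders of vanishing, Bezout's bound.

module OnCurve {K R : CRing} (curve : Curve K R) where
  open Curve curve
  private
    module K = RingTools K
    module SK = Sums K
    module dK = Domain domK
  open RingTools R
  open Sums R
  open Hom ι renaming (f to inj)
  open Der der
  open Domain domR

  coord-0 : ∀ ij → coord ij 0# K.≈ K.0#
  coord-0 ij = K.x+x≈x⇒x≈0 _ (K.trans (K.sym (coord-+ ij 0# 0#)) (coord-cong ij (+-identityˡ 0#)))

  coord-sum : ∀ ij {n} (α : Fin n → K.Carrier) (y : Fin n → Carrier) →
    coord ij (sum (λ l → inj (α l) * y l)) K.≈ SK.dot (λ l → coord ij (y l)) α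
  coord-sum ij {zero} α y = K.trans (coord-cong ij sum-zero) (K.trans (coord-0 ij) (K.sym SK.sum-zero))
  coord-sum ij {suc n} α y = K.trans (coord-cong ij (sum-suc _)) (K.trans (coord-+ ij _ _)
    (K.trans (K.+-cong (K.trans (coord-ι ij (α zero) (y zero)) (K.*-comm _ _)) (coord-sum ij (α ∘ suc) (y ∘ suc))) (K.sym (SK.sum-suc _))))

  fil-0 : ∀ {U} → Fil U 0#
  fil-0 = fil-mono z≤n (fil-cong f-0 (fil-ι K.0#))

  fil-1 : ∀ {U} → Fil U 1#
  fil-1 = fil-mono z≤n (fil-cong f-1 (fil-ι K.1#))

  fil-sum : ∀ {U n} (t : Fin n → Carrier) → (∀ i → Fil U (t i)) → Fil U (sum t)
  fil-sum {n = zero} t a = fil-cong (sym sum-zero) fil-0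
  fil-sum {n = suc n} t a = fil-cong (sym (sum-suc t)) (fil-+ (a zero) (fil-sum (t ∘ suc) (a ∘ suc)))

  fil-^ : ∀ {U x} n → Fil U x → Fil (n ℕ.* U) (x ^ n)
  fil-^ zero a = fil-1
  fil-^ (suc n) a = fil-* a (fil-^ n a)

  fil-ι* : ∀ {U x} c → Fil U x → Fil U (inj c * x)
  fil-ι* c a = fil-* (fil-ι c) a

  fil-mon : ∀ {U} l → Fil U (mon (lookup (idx (suc e) U) l))
  fil-mon {U} l = fil-mono (ℕ.≤-trans (ℕ.≤-reflexive (≡.cong₂ ℕ._+_ (ℕ.*-identityʳ i) (ℕ.*-identityʳ j))) (All.lookup (idx-bound (suc e) U) (∈-lookup l)))
      (fil-* (fil-^ i fil-V) (fil-^ j fil-S))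
    where
    i = proj₁ (lookup (idx (suc e) U) l)
    j = proj₂ (lookup (idx (suc e) U) l)

  -- Coordinates place these functions in a space of dimension `len (suc e) U`; `complete` carries
  -- the linear relation back to `R`.
  dependent : ∀ n U (y : Fin n → Carrier) → (∀ l → Fil U (y l)) → len (suc e) U ℕ.< n →
    ∃ λ α → (∃ λ l → ¬ α l K.≈ K.0#) × sum (λ l → inj (α l) * y l) ≈ 0#
  dependent n U y fy lt with LinearAlgebra.solution K domK n (map (λ ij l → coord ij (y l)) (idx (suc e) U))
      (≡.subst (ℕ._< n) (≡.sym (≡.trans (length-map _ (idx (suc e) U)) (length-idx (suc e) U))) lt)
  ... | α , nz , sol = α , nz , complete (fil-sum _ (λ l → fil-ι* (α l) (fy l)))
        (All.map (λ {ij} s → K.trans (coord-sum ij α y) s) (All.map⁻ sol))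

  d-sum : ∀ {n} (t : Fin n → Carrier) → d (sum t) ≈ sum (λ l → d (t l))
  d-sum {zero} t = trans (d-cong sum-zero) (trans d-0 (sym sum-zero))
  d-sum {suc n} t = trans (d-cong (sum-suc t)) (trans (d-+ _ _) (trans (+-congˡ (d-sum (t ∘ suc))) (sym (sum-suc _))))

  d-ι* : ∀ c x → d (inj c * x) ≈ inj c * d x
  d-ι* c x = trans (d-* _ _) (trans (+-congˡ (trans (*-congˡ (d-ι c)) (zeroʳ _))) (+-identityʳ _))

  -- A `K`-rational point, given by the evaluation it induces. `smooth` makes `S` minus its value a
  -- local parameter that the derivation can see.
  record Point : Set where
    field
      at     : Hom R K
      at-ι   : ∀ c → Hom.f at (inj c) K.≈ c
      smooth : ¬ Hom.f at (d S) K.≈ K.0#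
    open Hom at public renaming (f to ev; f-cong to ev-cong; f-+ to ev-+; f-* to ev-*; f-0 to ev-0; f-1 to ev-1; f-sub to ev-sub; f-^ to ev-^)
      using ()
    ev-zero : ∀ {x} → x ≈ 0# → ev x K.≈ K.0#
    ev-zero e = K.trans (ev-cong e) ev-0
  open Point using (ev; smooth)

  Distinct : Point → Point → Set
  Distinct P Q = ¬ (ev P V K.≈ ev Q V × ev P S K.≈ ev Q S)

  -- Order of vanishing at least `i`, by iterated derivatives instead of a valuation. Only orders up
  -- to the characteristic `p` are used; beyond it derivatives no longer detect the order.
  Ord : Point → ℕ → Carrier → Set
  Ord P zero x = ⊤
  Ord P (suc i) x = ev P x K.≈ K.0# × Ord P i (d x)

  module _ (P : Point) where
    open Point P hiding (ev; smooth)

    ord-cong : ∀ i {x y} → x ≈ y → Ord P i x → Ord P i y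
    ord-cong zero e o = tt
    ord-cong (suc i) e (a , o) = K.trans (ev-cong (sym e)) a , ord-cong i (d-cong e) o

    ord-0 : ∀ i → Ord P i 0#
    ord-0 zero = tt
    ord-0 (suc i) = ev-0 , ord-cong i (sym d-0) (ord-0 i)

    ord-+ : ∀ i {x y} → Ord P i x → Ord P i y → Ord P i (x + y)
    ord-+ zero a b = tt
    ord-+ (suc i) (a , a') (b , b') = K.trans (ev-+ _ _) (K.trans (K.+-cong a b) (K.+-identityˡ _)) , ord-cong i (sym (d-+ _ _)) (ord-+ i a' b')

    ord-pred : ∀ i {x} → Ord P (suc i) x → Ord P i x
    ord-pred zero o = tt
    ord-pred (suc i) (a , o) = a , ord-pred i o

    ord-* : ∀ i {x} y → Ord P i x → Ord P i (y * x)
    ord-* zero y o = tt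
    ord-* (suc i) {x} y (a , o) = K.trans (ev-* _ _) (K.trans (K.*-congˡ a) (K.zeroʳ _)) ,
      ord-cong i (sym (d-* y x)) (ord-+ i (ord-* i y o) (ord-cong i (*-comm _ _) (ord-* i (d y) (ord-pred i {x} (a , o)))))

    ord-neg : ∀ i {x} → Ord P i x → Ord P i (- x)
    ord-neg i {x} o = ord-cong i (solve 1 (λ x → (:- con (+ 1)) :* x := :- x) refl x) (ord-* i (- 1#) o)

    ord-step : ∀ i {x y} → ev P y K.≈ K.0# → Ord P i x → Ord P (suc i) (y * x)
    ord-step zero {x} {y} z o = K.trans (ev-* _ _) (K.trans (K.*-congʳ z) (K.zeroˡ _)) , tt
    ord-step (suc i) {x} {y} z o = K.trans (ev-* _ _) (K.trans (K.*-congʳ z) (K.zeroˡ _)) ,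
      ord-cong (suc i) (sym (d-* y x)) (ord-+ (suc i) (ord-step i z (proj₂ o)) (ord-cong (suc i) (*-comm _ _) (ord-* (suc i) (d y) o)))

    ord-^ : ∀ i {y} → ev P y K.≈ K.0# → Ord P i (y ^ i)
    ord-^ zero z = tt
    ord-^ (suc i) z = ord-step i z (ord-^ i z)

    -- Leibniz gives `y dx = d (y x) - x dy`. By induction `x` has order `i`, hence so has `y dx`,
    -- and `y` cancels from it once more by induction.
    ord-cancel : ∀ i {x y} → ¬ ev P y K.≈ K.0# → Ord P i (y * x) → Ord P i x
    ord-cancel zero ne o = tt
    ord-cancel (suc i) {x} {y} ne (a , o) = dK.cancel0 ne (K.trans (K.sym (ev-* _ _)) a) ,
      ord-cancel i ne (ord-cong i (trans (+-congʳ (d-* y x)) (solve 3 (λ a b c → (a :+ b :* c) :- c :* b := a) refl (y * d x) x (d y)))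
        (ord-+ i o (ord-neg i (ord-* i (d y) (ord-cancel i ne (ord-pred i {y * x} (a , o)))))))

    ord-sum : ∀ i {n} (t : Fin n → Carrier) → (∀ l → Ord P i (t l)) → Ord P i (sum t)
    ord-sum i {zero} t a = ord-cong i (sym sum-zero) (ord-0 i)
    ord-sum i {suc n} t a = ord-cong i (sym (sum-suc t)) (ord-+ i (a zero) (ord-sum i (t ∘ suc) (a ∘ suc)))

    local : Carrier
    local = S - inj (ev P S)

    ev-local : ev P local K.≈ K.0#
    ev-local = K.trans (ev-sub _ _) (K.trans (K.+-congˡ (K.-‿cong (at-ι _))) (K.-‿inverseʳ _))

    d-local : d local ≈ d S
    d-local = trans (d-sub _ _) (trans (+-congˡ (trans (-‿cong (d-ι _)) -0#≈0#)) (+-identityʳ _))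

    jet : ∀ {n} → (Fin n → K.Carrier) → Carrier
    jet β = sum (λ l → inj (β l) * local ^ toℕ l)

    ∂ : ∀ {n} → (Fin (suc n) → K.Carrier) → Fin n → K.Carrier
    ∂ β l = (suc (toℕ l) K.· K.1#) K.* β (suc l)

    d-jet : ∀ {n} (β : Fin (suc n) → K.Carrier) → d (jet β) ≈ d S * jet (∂ β)
    d-jet β = begin
      d (jet β)                 ≈⟨ trans (d-sum _) (sum-suc _) ⟩
      d (inj (β zero) * 1#) + sum (λ l → d (inj (β (suc l)) * local ^ suc (toℕ l)))
        ≈⟨ +-cong (trans (d-ι* _ _) (trans (*-congˡ d-1) (zeroʳ _))) (sum-cong λ l → trans (d-ι* _ _) (trans (*-congˡ (d-^ local (toℕ l))) (term l))) ⟩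
      0# + sum (λ l → d S * (inj (∂ β l) * local ^ toℕ l)) ≈⟨ trans (+-identityˡ _) (sum-*ˡ _ _) ⟩
      d S * jet (∂ β) ∎
      where
      term : ∀ l → inj (β (suc l)) * ((suc (toℕ l) · 1#) * local ^ toℕ l * d local) ≈ d S * (inj (∂ β l) * local ^ toℕ l)
      term l = trans (*-congˡ (*-congˡ d-local)) (trans
        (solve 4 (λ b m x s → b :* (m :* x :* s) := s :* ((m :* b) :* x)) refl (inj (β (suc l))) (suc (toℕ l) · 1#) (local ^ toℕ l) (d S))
        (*-congˡ (*-congʳ (sym (trans (f-* _ _) (*-congʳ (f-· (suc (toℕ l)))))))))

    -- Evaluation yields the constant coefficient. Differentiation yields `d S` times the jet with
    -- coefficients `l β_l`, where `d S` is nonzero at the point and `l` is nonzero in `K` as long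
    -- as `l < p`; hence `n ≤ p`.
    jet-zero : ∀ n (β : Fin n → K.Carrier) → n ℕ.≤ p → Ord P n (jet β) → ∀ l → β l K.≈ K.0#
    jet-zero (suc n) β le (a , o) zero = K.trans (K.sym (K.trans (ev-cong (trans (sum-suc _) (+-congʳ (*-identityʳ _)))) (K.trans (ev-+ _ _)
        (K.trans (K.+-cong (at-ι _) (K.trans (ev-cong (trans (sum-cong λ l → solve 3 (λ b x y → b :* (x :* y) := x :* (b :* y)) refl (inj (β (suc l))) local (local ^ toℕ l)) (sum-*ˡ local _)))
          (K.trans (ev-* _ _) (K.trans (K.*-congʳ ev-local) (K.zeroˡ _))))) (K.+-identityʳ _))))) a
    jet-zero (suc n) β le (a , o) (suc l) = dK.cancel0 (small (suc (toℕ l)) (s≤s z≤n) (ℕ.≤-trans (s≤s (Fin.toℕ<n l)) le))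
      (jet-zero n (∂ β) (ℕ.≤-trans (ℕ.n≤1+n n) le) (ord-cancel n (smooth P) (ord-cong n (d-jet β) o)) l)

  -- A linear function that vanishes at `Q` and, for distinct points, not at `P`; it uses `V` unless
  -- the two points agree there.
  separator : Point → Point → Carrier
  separator P Q with dK.dec0 (ev P V K.- ev Q V)
  ... | yes _ = S - inj (ev Q S)
  ... | no _  = V - inj (ev Q V)

  ev-shift : ∀ P x c → ev P (x - inj c) K.≈ ev P x K.- c
  ev-shift P x c = K.trans (Point.ev-sub P _ _) (K.+-congˡ (K.-‿cong (Point.at-ι P c)))

  separator-Q : ∀ P Q → ev Q (separator P Q) K.≈ K.0#
  separator-Q P Q with dK.dec0 (ev P V K.- ev Q V)
  ... | yes _ = K.trans (ev-shift Q S _) (K.-‿inverseʳ _)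
  ... | no _ = K.trans (ev-shift Q V _) (K.-‿inverseʳ _)

  separator-P : ∀ P Q → Distinct P Q → ¬ ev P (separator P Q) K.≈ K.0#
  separator-P P Q ne with dK.dec0 (ev P V K.- ev Q V)
  ... | yes z = λ w → ne (dK.x-y≈0 z , dK.x-y≈0 (K.trans (K.sym (ev-shift P S _)) w))
  ... | no nz = λ w → nz (K.trans (K.sym (ev-shift P V _)) w)

  fil-shift : ∀ {x} c → Fil 1 x → Fil 1 (x - inj c)
  fil-shift c a = fil-+ a (fil-cong (f-neg c) (fil-mono z≤n (fil-ι (K.- c))))

  fil-separator : ∀ P Q → Fil 1 (separator P Q)
  fil-separator P Q with dK.dec0 (ev P V K.- ev Q V)
  ... | yes _ = fil-shift _ fil-S
  ... | no _ = fil-shift _ fil-V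

  module Bezout (M : ℕ) (M≤p : M ℕ.≤ p) where

    away : List Point → Point → Carrier
    away [] P = 1#
    away (Q ∷ Qs) P = separator P Q ^ M * away Qs P

    fil-away : ∀ Qs P → Fil (length Qs ℕ.* M) (away Qs P)
    fil-away [] P = fil-1
    fil-away (Q ∷ Qs) P = fil-* (fil-mono (ℕ.≤-reflexive (ℕ.*-identityʳ M)) (fil-^ M (fil-separator P Q))) (fil-away Qs P)

    away-∈ : ∀ {Q} Qs P → Q ∈ Qs → Ord Q M (away Qs P)
    away-∈ {Q} (_ ∷ Qs) P (here ≡.refl) = ord-cong Q M (*-comm _ _) (ord-* Q M _ (ord-^ Q M (separator-Q P Q)))
    away-∈ {Q} (_ ∷ Qs) P (there m) = ord-* Q M _ (away-∈ Qs P m)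

    away-≉ : ∀ Qs P → All (Distinct P) Qs → ¬ ev P (away Qs P) K.≈ K.0#
    away-≉ [] P [] z = dK.1≉0 (K.trans (K.sym (Point.ev-1 P)) z)
    away-≉ (Q ∷ Qs) P (n ∷ ns) z = dK.*≉0 (dK.^≉0 M (separator-P P Q n)) (away-≉ Qs P ns)
      (K.trans (K.trans (K.*-congʳ (K.sym (Point.ev-^ P _ M))) (K.sym (Point.ev-* P _ _))) z)

    -- `M` functions for each point: they realise the jets of order `M` there and vanish to order
    -- `M` at all earlier points, which makes independence block triangular.
    family : List Point → (Ps : List Point) → Fin (length Ps ℕ.* M) → Carrier
    family prev (P ∷ Ps) i = [ (λ l → away prev P * local P ^ toℕ l) , family (P ∷ prev) Ps ]′ (splitAt M i)

    family-∈ : ∀ {Q} prev Ps → Q ∈ prev → ∀ i → Ord Q M (family prev Ps i)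
    family-∈ {Q} prev (P ∷ Ps) m i with splitAt M i
    ... | inj₁ l = ord-cong Q M (*-comm _ _) (ord-* Q M _ (away-∈ prev P m))
    ... | inj₂ j = family-∈ (P ∷ prev) Ps (there m) j

    fil-local : ∀ P {l} → l ℕ.≤ M → Fil M (local P ^ l)
    fil-local P {l} le = fil-mono (ℕ.≤-trans (ℕ.≤-reflexive (ℕ.*-identityʳ l)) le) (fil-^ l (fil-shift _ fil-S))

    fil-family : ∀ prev Ps i → Fil ((length prev ℕ.+ length Ps) ℕ.* M) (family prev Ps i)
    fil-family prev (P ∷ Ps) i with splitAt M i
    ... | inj₁ l = fil-mono (ℕ.≤-trans (ℕ.≤-reflexive (ℕ.+-comm (length prev ℕ.* M) M))
                     (ℕ.≤-trans (ℕ.*-monoˡ-≤ M (s≤s (ℕ.m≤m+n (length prev) (length Ps)))) (ℕ.≤-reflexive (≡.cong (ℕ._* M) (≡.sym (ℕ.+-suc (length prev) (length Ps)))))))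
                     (fil-* (fil-away prev P) (fil-local P (ℕ.<⇒≤ (Fin.toℕ<n l))))
    ... | inj₂ j = fil-mono (ℕ.≤-reflexive (≡.cong (ℕ._* M) (≡.sym (ℕ.+-suc (length prev) (length Ps))))) (fil-family (P ∷ prev) Ps j)

    -- At the first point the later functions and `x` vanish to order `M`, so the first block does
    -- too. Its factor `away` is nonzero there and cancels, and `jet-zero` kills the coefficients;
    -- the remaining points follow by induction.
    family-indep : ∀ prev Ps → All (λ P → All (Distinct P) prev) Ps → AllPairs (λ P Q → Distinct Q P) Ps → ∀ x → All (λ P → Ord P M x) Ps →
      (β : Fin (length Ps ℕ.* M) → K.Carrier) → sum (λ i → inj (β i) * family prev Ps i) + x ≈ 0# → ∀ i → β i K.≈ K.0#
    family-indep prev (P ∷ Ps) (dp ∷ dps) (pp ∷ pps) x (ox ∷ oxs) β eq i =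
      ≡.subst (λ k → β k K.≈ K.0#) (Fin.join-splitAt M N i) (go (splitAt M i))
      where
      N = length Ps ℕ.* M
      rest = sum (λ j → inj (β (M ↑ʳ j)) * family prev (P ∷ Ps) (M ↑ʳ j))
      block = sum (λ l → inj (β (l ↑ˡ N)) * family prev (P ∷ Ps) (l ↑ˡ N))
      eq₁ : block + rest + x ≈ 0#
      eq₁ = trans (+-congʳ (sym (sum-split M N _))) eq
      block≈ : block ≈ away prev P * jet P (λ l → β (l ↑ˡ N))
      block≈ = trans (sum-cong λ l → trans (*-congˡ (reflexive (≡.cong [ _ , _ ]′ (Fin.splitAt-↑ˡ M l N))))
        (solve 3 (λ a b c → a :* (b :* c) := b :* (a :* c)) refl _ _ _)) (sum-*ˡ _ _)
      later : ∀ j → family prev (P ∷ Ps) (M ↑ʳ j) ≈ family (P ∷ prev) Ps j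
      later j = reflexive (≡.cong [ _ , _ ]′ (Fin.splitAt-↑ʳ M N j))
      total : away prev P * jet P (λ l → β (l ↑ˡ N)) ≈ - rest + - x
      total = trans (sym block≈) (trans (solve 3 (λ a r x → a := (a :+ r :+ x) :+ (:- r :+ :- x)) refl block rest x)
        (trans (+-congʳ eq₁) (+-identityˡ _)))
      β₀ : ∀ l → β (l ↑ˡ N) K.≈ K.0#
      β₀ = jet-zero P M _ M≤p (ord-cancel P M (away-≉ prev P dp) (ord-cong P M (sym total)
        (ord-+ P M (ord-neg P M (ord-sum P M _ λ j → ord-* P M _ (ord-cong P M (sym (later j)) (family-∈ (P ∷ prev) Ps (here ≡.refl) j))))
          (ord-neg P M ox))))
      eq₂ : sum (λ j → inj (β (M ↑ʳ j)) * family (P ∷ prev) Ps j) + x ≈ 0#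
      eq₂ = trans (+-congʳ (sum-cong λ j → *-congˡ (sym (later j)))) (trans (sym (trans (+-congʳ
        (+-congʳ (sum-0 λ l → trans (*-congʳ (f-zero (β₀ l))) (zeroˡ _)))) (+-congʳ (+-identityˡ rest)))) eq₁)
      go : ∀ s → β (Fin.join M N s) K.≈ K.0#
      go (inj₁ l) = β₀ l
      go (inj₂ j) = family-indep (P ∷ prev) Ps (All.zipWith (λ { (a , b) → a ∷ b }) (pp , dps)) pps x oxs (β ∘ (M ↑ʳ_)) eq₂ j

    -- A dimension count: the multiples of `x` by monomials of degree at most `U` fill `len U`
    -- dimensions, and `family` adds `N` independent ones. For `N > (e + 1) δ` these would be more
    -- than the `len (U + δ) = len U + (e + 1) δ` that are available.
    bezout : ∀ Ps → AllPairs (λ P Q → Distinct Q P) Ps → ∀ {δ x} → Fil δ x → ¬ x ≈ 0# → All (λ P → Ord P M x) Ps →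
      length Ps ℕ.* M ℕ.≤ suc e ℕ.* δ
    bezout Ps dist {δ} {x} fx nx ords = ℕ.≮⇒≥ λ lt → absurd lt
      where
      N = length Ps ℕ.* M
      -- `N` leaves room for `family`, and `e` puts `U` in the range where the Hilbert function is
      -- linear.
      U = N ℕ.+ e
      L = length (idx (suc e) U)
      y : Fin (L ℕ.+ N) → Carrier
      y i = [ (λ l → mon (lookup (idx (suc e) U) l) * x) , family [] Ps ]′ (splitAt L i)
      fy : ∀ i → Fil (U ℕ.+ δ) (y i)
      fy i with splitAt L i
      ... | inj₁ l = fil-* (fil-mon l) fx
      ... | inj₂ j = fil-mono (ℕ.≤-trans (ℕ.m≤m+n N e) (ℕ.m≤m+n U δ)) (fil-family [] Ps j)
      absurd : suc e ℕ.* δ ℕ.< N → ⊥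
      absurd lt with dependent (L ℕ.+ N) (U ℕ.+ δ) y fy
          (≡.subst (ℕ._< L ℕ.+ N) (≡.sym (≡.trans (len-+ (suc e) U δ (s≤s (ℕ.m≤n+m e N))) (≡.cong (ℕ._+ suc e ℕ.* δ) (≡.sym (length-idx (suc e) U))))) (ℕ.+-monoʳ-< L lt))
      ... | α , (i , nz) , eq = nz (≡.subst (λ k → α k K.≈ K.0#) (Fin.join-splitAt L N i) (go (splitAt L i)))
        where
        ψ = sum (λ l → inj (α (l ↑ˡ N)) * mon (lookup (idx (suc e) U) l))
        left : sum (λ l → inj (α (l ↑ˡ N)) * y (l ↑ˡ N)) ≈ x * ψ
        left = trans (sum-cong λ l → trans (*-congˡ (reflexive (≡.cong [ _ , _ ]′ (Fin.splitAt-↑ˡ L l N))))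
          (solve 3 (λ a b c → a :* (b :* c) := c :* (a :* b)) refl _ _ _)) (sum-*ˡ _ _)
        right : sum (λ j → inj (α (L ↑ʳ j)) * y (L ↑ʳ j)) ≈ sum (λ j → inj (α (L ↑ʳ j)) * family [] Ps j)
        right = sum-cong λ j → *-congˡ (reflexive (≡.cong [ _ , _ ]′ (Fin.splitAt-↑ʳ L N j)))
        eq' : sum (λ j → inj (α (L ↑ʳ j)) * family [] Ps j) + ψ * x ≈ 0#
        eq' = trans (+-comm _ _) (trans (+-congʳ (*-comm ψ x)) (trans (sym (trans (sum-split L N _) (+-cong left right))) eq))
        β₀ : ∀ j → α (L ↑ʳ j) K.≈ K.0#
        β₀ = family-indep [] Ps (All.universal (λ _ → []) Ps) dist (ψ * x) (All.map (λ {P} o → ord-* P M ψ o) ords) _ eq'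
        α₀ : ∀ l → α (l ↑ˡ N) K.≈ K.0#
        α₀ = independent U _ (cancel0 nx (trans (*-comm _ _) (trans (sym (trans (+-congʳ (sum-0 λ j → trans (*-congʳ (f-zero (β₀ j))) (zeroˡ _))) (+-identityˡ _))) eq')))
        go : ∀ s → α (Fin.join L N s) K.≈ K.0#
        go (inj₁ l) = α₀ l
        go (inj₂ j) = β₀ j

-- The auxiliary function of Stöhr and Voloch.

module StohrVoloch {K R : CRing} (curve : Curve K R) (M μ : ℕ)
  (φ : Fin (suc M) → CommutativeRing.Carrier R) (φ-fil : ∀ j → Curve.Fil curve μ (φ j))
  (φ-indep : (α : Fin (suc M) → CommutativeRing.Carrier K) → CommutativeRing._≈_ R (Sums.sum R (λ j → CommutativeRing._*_ R (Hom.f (Curve.ι curve) (α j)) (φ j))) (CommutativeRing.0# R) →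
     ∀ j → CommutativeRing._≈_ K (α j) (CommutativeRing.0# K)) where
  open Curve curve
  open OnCurve curve
  open Point using (ev)
  private
    module K = RingTools K
    module SK = Sums K
    module dK = Domain domK
  open RingTools R
  open Sums R
  open Hom ι renaming (f to inj)
  open Der der
  open Domain domR

  D^ : ℕ → Carrier → Carrier
  D^ zero x = x
  D^ (suc i) x = d (D^ i x)

  D^-suc : ∀ i x → D^ i (d x) ≡ D^ (suc i) x
  D^-suc zero x = ≡.refl
  D^-suc (suc i) x = ≡.cong d (D^-suc i x)

  Vector : Set
  Vector = Fin (suc M) → Carrier

  D^φ : ℕ → Vector
  D^φ i j = D^ i (φ j)

  fil-D^ : ∀ i {U x} → Fil U x → Fil (U ℕ.+ i ℕ.* suc e) (D^ i x)
  fil-D^ zero {U} a = fil-mono (ℕ.≤-reflexive (≡.sym (ℕ.+-identityʳ U))) a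
  fil-D^ (suc i) {U} a = fil-mono (ℕ.≤-reflexive (≡.trans (ℕ.+-assoc U (i ℕ.* suc e) (suc e)) (≡.cong (U ℕ.+_) (ℕ.+-comm (i ℕ.* suc e) (suc e))))) (fil-d (fil-D^ i a))

  ord-D^ : ∀ P n {x} → (∀ i → i ℕ.< n → ev P (D^ i x) K.≈ K.0#) → Ord P n x
  ord-D^ P zero a = tt
  ord-D^ P (suc n) {x} a = a 0 (s≤s z≤n) , ord-D^ P n (λ i l → ≡.subst (λ y → ev P y K.≈ K.0#) (≡.sym (D^-suc i x)) (a (suc i) (s≤s l)))

  ord-or : ∀ P n x → Ord P n x ⊎ ∃ λ l → ¬ ev P (D^ l x) K.≈ K.0#
  ord-or P zero x = inj₁ tt
  ord-or P (suc n) x with dK.dec0 (ev P x) | ord-or P n (d x)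
  ... | no ne | _ = inj₂ (0 , ne)
  ... | yes z | inj₁ o = inj₁ (z , o)
  ... | yes z | inj₂ (l , ne) = inj₂ (suc l , λ w → ne (≡.subst (λ y → ev P y K.≈ K.0#) (≡.sym (D^-suc l x)) w))

  d-dot : (a b : Vector) → d (dot a b) ≈ dot (d ∘ a) b + dot a (d ∘ b)
  d-dot a b = trans (d-sum _) (trans (sum-cong λ i → trans (d-* (a i) (b i)) (trans (+-comm _ _) (+-congʳ (*-comm _ _)))) (sum-+ _ _))

  ev-dot : ∀ P (a b : Vector) → ev P (dot a b) K.≈ SK.sum (λ j → ev P (a j) K.* ev P (b j))
  ev-dot P a b = K.trans (SumHom.f-sum (Point.at P) _) (SK.sum-cong λ j → Point.ev-* P _ _)

  -- `Y` bounds the degrees of the `D^i φ_j` with `i ≤ M`. With `X = M Y`, the surplus of unknowns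
  -- over equations in `siegel` is at least `L - (e + 1) X = len (suc e) e`, which is positive; the
  -- summand `e` in `U` also keeps `len-+` applicable.
  Y X U : ℕ
  Y = μ ℕ.+ M ℕ.* suc e
  X = M ℕ.* Y
  U = e ℕ.+ X

  private
    L : ℕ
    L = length (idx (suc e) U)

    len>0 : ∀ d U → 0 ℕ.< len (suc d) U
    len>0 d zero = s≤s z≤n
    len>0 d (suc U) = s≤s z≤n

    L> : suc e ℕ.* X ℕ.< L
    L> = ≡.subst (suc e ℕ.* X ℕ.<_) (≡.sym (≡.trans (length-idx (suc e) U) (len-+ (suc e) e X ℕ.≤-refl)))
      (ℕ.+-monoˡ-≤ (suc e ℕ.* X) (len>0 e e))

    monomial : Fin L → Carrier
    monomial l = mon (lookup (idx (suc e) U) l)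

    y : ℕ → Fin (suc M ℕ.* L) → Carrier
    y i k = monomial (proj₂ (Fin.remQuot {suc M} L k)) * D^φ i (proj₁ (Fin.remQuot {suc M} L k))

    block : ℕ → List (Fin (suc M ℕ.* L) → K.Carrier)
    block i = map (λ ij k → coord ij (y i k)) (idx (suc e) (U ℕ.+ (μ ℕ.+ i ℕ.* suc e)))

    B : ℕ
    B = L ℕ.+ suc e ℕ.* Y

    length-block : ∀ {i} → i ℕ.< M → length (block i) ℕ.≤ B
    length-block {i} lt = ℕ.≤-trans (ℕ.≤-reflexive (≡.trans (length-map _ (idx (suc e) (U ℕ.+ (μ ℕ.+ i ℕ.* suc e))))
      (≡.trans (length-idx (suc e) (U ℕ.+ (μ ℕ.+ i ℕ.* suc e))) (≡.trans (len-+ (suc e) U _ (s≤s (ℕ.m≤m+n e X))) (≡.cong (ℕ._+ suc e ℕ.* (μ ℕ.+ i ℕ.* suc e)) (≡.sym (length-idx (suc e) U)))))))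
      (ℕ.+-monoʳ-≤ L (ℕ.*-monoʳ-≤ (suc e) (ℕ.+-monoʳ-≤ μ (ℕ.*-monoˡ-≤ (suc e) (ℕ.<⇒≤ lt)))))

    length-blocks : ∀ is → All (ℕ._< M) is → length (concatMap block is) ℕ.≤ length is ℕ.* B
    length-blocks [] [] = z≤n
    length-blocks (i ∷ is) (l ∷ ls) = ℕ.≤-trans (ℕ.≤-reflexive (length-++ (block i))) (ℕ.+-mono-≤ (length-block l) (length-blocks is ls))

    M*B< : M ℕ.* B ℕ.< suc M ℕ.* L
    M*B< = ℕ.≤-trans (s≤s (ℕ.≤-reflexive (≡.trans (ℕ.*-distribˡ-+ M L (suc e ℕ.* Y)) (≡.trans (≡.cong (M ℕ.* L ℕ.+_) eq) (ℕ.+-comm (M ℕ.* L) (suc e ℕ.* X))))))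
       (ℕ.+-monoˡ-≤ (M ℕ.* L) L>)
      where
      eq : M ℕ.* (suc e ℕ.* Y) ≡ suc e ℕ.* X
      eq = ≡.trans (≡.sym (ℕ.*-assoc M (suc e) Y)) (≡.trans (≡.cong (ℕ._* Y) (ℕ.*-comm M (suc e))) (ℕ.*-assoc (suc e) M Y))

  -- Siegel's lemma: the coefficients of the u j in a monomial basis outnumber the linear conditions.
  siegel : ∃ λ (u : Vector) → (∀ j → Fil U (u j)) × (∃ λ j → ¬ u j ≈ 0#) × (∀ i → i ℕ.< M → dot u (D^φ i) ≈ 0#)
  siegel with LinearAlgebra.solution K domK (suc M ℕ.* L) (concatMap block (upTo M))
     (ℕ.≤-<-trans (ℕ.≤-trans (length-blocks (upTo M) (All.applyUpTo⁺₁ _ M λ l → l)) (ℕ.≤-reflexive (≡.cong (ℕ._* B) (length-upTo M)))) M*B<)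
  ... | α , (k , nz) , sol = u , (λ j → fil-sum _ (λ l → fil-ι* _ (fil-mon l))) , (proj₁ jl , λ z → nz (αk z)) , orth
    where
    u : Vector
    u j = sum (λ l → inj (α (combine j l)) * monomial l)
    jl = Fin.remQuot {suc M} L k
    αk : u (proj₁ jl) ≈ 0# → α k K.≈ K.0#
    αk z = ≡.subst (λ k → α k K.≈ K.0#) (Fin.combine-remQuot {suc M} L k) (independent U _ z (proj₂ jl))
    orth : ∀ i → i ℕ.< M → dot u (D^φ i) ≈ 0#
    orth i lt = trans (sum-cong λ j → trans (*-comm _ _) (trans (sym (sum-*ˡ _ _)) (sum-cong λ l → trans (solve 3 (λ a b c → a :* (b :* c) := b :* (c :* a)) refl _ _ _)
        (*-congˡ (reflexive (≡.cong (λ jl → monomial (proj₂ jl) * D^φ i (proj₁ jl)) (≡.sym (Fin.remQuot-combine {suc M} {L} j l))))))))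
      (trans (sym (sum-combine (suc M) L _)) (complete {U ℕ.+ (μ ℕ.+ i ℕ.* suc e)} (fil-sum _ λ k → fil-ι* (α k) (fil-* {U} (fil-mon {U} (proj₂ (Fin.remQuot {suc M} L k))) (fil-D^ i {μ} (φ-fil (proj₁ (Fin.remQuot {suc M} L k))))))
        (All.map (λ {ij} s → K.trans (coord-sum ij α (y i)) s) (All.map⁻ (All.applyUpTo⁻ _ M (All.map⁻ (All.concat⁻ {xss = map block (upTo M)} sol)) lt)))))

  module _ (u : Vector) where

    Orth : ℕ → Set
    Orth i = dot u (D^φ i) ≈ 0#

    D^u : ℕ → Vector
    D^u l j = D^ l (u j)

    -- Differentiating `u · D^i φ = 0` trades a derivative of `φ` for one of `u`.
    mixed : ∀ n → (∀ i → i ℕ.< n → Orth i) → ∀ l i → l ℕ.+ i ℕ.< n → dot (D^u l) (D^φ i) ≈ 0#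
    mixed n o zero i lt = o i lt
    mixed n o (suc l) i lt = begin
      dot (D^u (suc l)) (D^φ i)                              ≈⟨ solve 2 (λ a b → a := (a :+ b) :- b) refl _ (dot (D^u l) (D^φ (suc i))) ⟩
      dot (D^u (suc l)) (D^φ i) + dot (D^u l) (D^φ (suc i)) - dot (D^u l) (D^φ (suc i))
         ≈⟨ +-cong (trans (sym (d-dot (D^u l) (D^φ i))) (d-zero (mixed n o l i (ℕ.≤-trans (ℕ.n≤1+n _) lt)))) (-‿cong (mixed n o l (suc i) (ℕ.≤-trans (s≤s (ℕ.≤-reflexive (ℕ.+-suc l i))) lt))) ⟩
      0# - 0# ≈⟨ -‿inverseʳ 0# ⟩
      0# ∎

    φ^p : Vector
    φ^p j = φ j ^ p

    d-frobenius : ∀ q x → q · 1# ≈ 0# → d (x ^ q) ≈ 0#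
    d-frobenius zero x z = d-1
    d-frobenius (suc q) x z = trans (d-^ x q) (trans (*-congʳ (trans (*-congʳ z) (zeroˡ _))) (zeroˡ _))

    Ψ : Carrier
    Ψ = dot u φ^p

    D^Ψ : ∀ i → D^ i Ψ ≈ dot (D^u i) φ^p
    D^Ψ zero = refl
    D^Ψ (suc i) = trans (d-cong (D^Ψ i)) (trans (d-dot _ _) (trans (+-congˡ (sum-0 λ j → trans (*-congˡ (d-frobenius p (φ j) p·1)) (zeroʳ _))) (+-identityʳ _)))

    -- `D` kills p-th powers and so acts on `u` alone; at a rational point Fermat replaces `φ^p` by
    -- `φ`, and `mixed` applies.
    ord-Ψ : (∀ i → i ℕ.< M → Orth i) → ∀ P → Ord P M Ψ
    ord-Ψ o P = ord-D^ P M λ i lt → K.trans (Point.ev-cong P (D^Ψ i)) (K.trans (ev-dot P _ _)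
      (K.trans (SK.sum-cong λ j → K.*-congˡ (K.trans (Point.ev-^ P _ p) (fermat _)))
      (K.trans (K.sym (ev-dot P (D^u i) (D^φ 0))) (Point.ev-zero P (mixed M o i 0 (≡.subst (ℕ._< M) (≡.sym (ℕ.+-identityʳ i)) lt))))))

    -- The `R`-linear span of `D^0 φ, ..., D^(i-1) φ`, encoded by peeling off a multiple of the last
    -- generator.
    LS : ℕ → Vector → Set
    LS zero w = ∀ j → w j ≈ 0#
    LS (suc i) w = ∃ λ b → LS i (λ j → w j - b * D^φ i j)

    ls-cong : ∀ i {v w : Vector} → (∀ j → v j ≈ w j) → LS i v → LS i w
    ls-cong zero e a j = trans (sym (e j)) (a j)
    ls-cong (suc i) e (b , a) = b , ls-cong i (λ j → +-congʳ (e j)) a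

    ls-+ : ∀ i {v w : Vector} → LS i v → LS i w → LS i (λ j → v j + w j)
    ls-+ zero a b j = trans (+-cong (a j) (b j)) (+-identityˡ _)
    ls-+ (suc i) {v} {w} (b , a) (b' , a') = b + b' , ls-cong i (λ j → solve 5 (λ v b x w b' → (v :- b :* x) :+ (w :- b' :* x) := (v :+ w) :- (b :+ b') :* x) refl (v j) b (D^φ i j) (w j) b') (ls-+ i a a')

    ls-* : ∀ i {v : Vector} c → LS i v → LS i (λ j → c * v j)
    ls-* zero c a j = trans (*-congˡ (a j)) (zeroʳ c)
    ls-* (suc i) {v} c (b , a) = c * b , ls-cong i (λ j → solve 4 (λ c v b x → c :* (v :- b :* x) := c :* v :- (c :* b) :* x) refl c (v j) b (D^φ i j)) (ls-* i c a)

    ls-0 : ∀ i {v : Vector} → (∀ j → v j ≈ 0#) → LS i v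
    ls-0 zero a = a
    ls-0 (suc i) a = 0# , ls-0 i λ j → trans (+-cong (a j) (-‿cong (zeroˡ _))) (-‿inverseʳ 0#)

    ls-suc : ∀ i {v : Vector} → LS i v → LS (suc i) v
    ls-suc i a = 0# , ls-cong i (λ j → solve 2 (λ v x → v := v :- con (+ 0) :* x) refl _ (D^φ i j)) a

    ls-top : ∀ i → LS (suc i) (D^φ i)
    ls-top i = 1# , ls-0 i λ j → solve 1 (λ x → x :- con (+ 1) :* x := con (+ 0)) refl _

    ls-gen : ∀ i l → l ℕ.< i → LS i (D^φ l)
    ls-gen (suc i) l (s≤s le) with l ℕ.≟ i
    ... | yes ≡.refl = ls-top i
    ... | no ne = ls-suc i (ls-gen i l (ℕ.≤∧≢⇒< le ne))

    ls-sum : ∀ i {n} (t : Fin n → Vector) → (∀ k → LS i (t k)) → LS i (λ j → sum (λ k → t k j))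
    ls-sum i {zero} t a = ls-0 i λ j → sum-zero
    ls-sum i {suc n} t a = ls-cong i (λ j → sym (sum-suc _)) (ls-+ i (a zero) (ls-sum i (t ∘ suc) (a ∘ suc)))

    ls-d : ∀ i {v : Vector} → LS i v → LS (suc i) (λ j → d (v j))
    ls-d zero a = ls-0 1 λ j → d-zero (a j)
    ls-d (suc i) {v} (b , a) = b , ls-cong (suc i) (λ j → trans (+-congʳ (trans (d-sub _ _) (+-congˡ (-‿cong (d-* b (D^φ i j))))))
          (solve 5 (λ v b y x b' → v :- (b :* y :+ x :* b') :+ b' :* x := v :- b :* y) refl (d (v j)) b (D^φ (suc i) j) (D^φ i j) (d b)))
        (ls-+ (suc i) (ls-d i a) (ls-* (suc i) (d b) (ls-top i)))

    ls-orth : ∀ i → (∀ l → l ℕ.< i → Orth l) → ∀ {v : Vector} → LS i v → dot u v ≈ 0#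
    ls-orth zero o a = sum-0 λ j → trans (*-congˡ (a j)) (zeroʳ _)
    ls-orth (suc i) o {v} (b , a) = begin
      dot u v ≈⟨ sum-cong (λ j → solve 4 (λ u v b x → u :* v := u :* (v :- b :* x) :+ b :* (u :* x)) refl (u j) (v j) b (D^φ i j)) ⟩
      sum (λ j → u j * (v j - b * D^φ i j) + b * (u j * D^φ i j)) ≈⟨ sum-+ _ _ ⟩
      dot u (λ j → v j - b * D^φ i j) + sum (λ j → b * (u j * D^φ i j))
        ≈⟨ +-cong (ls-orth i (λ l lt → o l (ℕ.m<n⇒m<1+n lt)) a) (trans (sum-*ˡ b _) (trans (*-congˡ (o i ℕ.≤-refl)) (zeroʳ b))) ⟩
      0# + 0# ≈⟨ +-identityˡ _ ⟩
      0# ∎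

    -- Differentiating a relation for `c D^J φ` gives one for `c D^(J+1) φ`, since the extra term
    -- `dc D^J φ` lies in the larger span. The factor `c` is carried along because `R` has no
    -- division.
    ls-higher : ∀ J c → LS J (λ j → c * D^φ J j) → ∀ i → LS (i ℕ.+ J) (λ j → c * D^φ (i ℕ.+ J) j)
    ls-higher J c a zero = a
    ls-higher J c a (suc i) = ls-cong (suc (i ℕ.+ J)) (λ j → trans (+-congʳ (d-* c _)) (solve 4 (λ c y x c' → (c :* y :+ x :* c') :+ (:- c') :* x := c :* y) refl c _ (D^φ (i ℕ.+ J) j) (d c)))
      (ls-+ (suc (i ℕ.+ J)) (ls-d (i ℕ.+ J) (ls-higher J c a i)) (ls-* (suc (i ℕ.+ J)) (- d c) (ls-top (i ℕ.+ J))))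

    -- One dependence at a level `J ≤ M` with nonzero leading coefficient propagates upwards, so
    -- orthogonality of the first `M` derivatives extends to all. `n` is fuel for strong induction.
    orth-all : (∀ i → i ℕ.< M → Orth i) → ∀ J → J ℕ.≤ M → ∀ c → ¬ c ≈ 0# → LS J (λ j → c * D^φ J j) → ∀ n i → i ℕ.< n → Orth i
    orth-all o J J≤M c nc a (suc n) i (s≤s le) with i ℕ.<? J
    ... | yes lt = o i (ℕ.<-≤-trans lt J≤M)
    ... | no nlt = cancel0 nc (trans (sym (trans (sum-cong λ j → solve 3 (λ u c x → u :* (c :* x) := c :* (u :* x)) refl _ _ _) (sum-*ˡ c _)))
        (ls-orth i (λ l lt → orth-all o J J≤M c nc a n l (ℕ.<-≤-trans lt le)) (≡.subst (λ k → LS k (λ j → c * D^φ k j)) (ℕ.m∸n+n≡m (ℕ.≮⇒≥ nlt)) (ls-higher J c a (i ℕ.∸ J)))))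

    topmost : ∀ {n} (c : Fin n → Carrier) → (∀ l → c l ≈ 0#) ⊎ ∃ λ l → ¬ c l ≈ 0# × (∀ l' → toℕ l ℕ.< toℕ l' → c l' ≈ 0#)
    topmost {zero} c = inj₁ λ ()
    topmost {suc n} c with topmost (c ∘ suc)
    ... | inj₂ (l , nz , above) = inj₂ (suc l , nz , λ { (suc l') (s≤s lt) → above l' lt })
    ... | inj₁ z with dec0 (c zero)
    ... | yes z₀ = inj₁ λ { zero → z₀ ; (suc l) → z l }
    ... | no nz = inj₂ (zero , nz , λ { (suc l') lt → z l' })

    φ≉0 : ¬ φ zero ≈ 0#
    φ≉0 z = dK.1≉0 (φ-indep δ (trans (sum-suc _) (trans (+-cong (trans (*-congˡ z) (zeroʳ _)) (sum-0 λ j → trans (*-congʳ f-0) (zeroˡ _))) (+-identityˡ _))) zero)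
      where
      δ : Fin (suc M) → K.Carrier
      δ zero = K.1#
      δ (suc _) = K.0#

    module Degenerate (orth : ∀ i → i ℕ.< M → Orth i) (j₀ : Fin (suc M)) (nu : ¬ u j₀ ≈ 0#) (Ψ≈0 : Ψ ≈ 0#) where

      w : Fin (suc M) → Vector
      w zero = φ^p
      w (suc i) = D^φ (toℕ i)

      w-orth : ∀ l → dot u (w l) ≈ 0#
      w-orth zero = Ψ≈0
      w-orth (suc i) = orth (toℕ i) (Fin.toℕ<n i)

      -- The `M + 1` vectors `w l` lie in the hyperplane orthogonal to `u`. Only the coordinates
      -- other than `j₀` enter the linear system; the last one follows because `u j₀` is nonzero.
      relation : ∃ λ c → (∃ λ l → ¬ c l ≈ 0#) × (∀ j → dot (λ l → w l j) c ≈ 0#)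
      relation with LinearAlgebra.solution R domR (suc M) (List.tabulate (λ t l → w l (Fin.punchIn j₀ t))) (s≤s (ℕ.≤-reflexive (length-tabulate _)))
      ... | c , nz , sol = c , nz , rel
        where
        off : ∀ j → ¬ j ≡ j₀ → dot (λ l → w l j) c ≈ 0#
        off j ne = ≡.subst (λ j → dot (λ l → w l j) c ≈ 0#) (Fin.punchIn-punchOut {i = j₀} (ne ∘ ≡.sym)) (All.tabulate⁻ sol (Fin.punchOut (ne ∘ ≡.sym)))
        on : dot (λ l → w l j₀) c ≈ 0#
        on = cancel0 nu (begin
          u j₀ * dot (λ l → w l j₀) c                ≈⟨ sym (sum-single (λ j → u j * dot (λ l → w l j) c) j₀ λ j ne → trans (*-congˡ (off j ne)) (zeroʳ _)) ⟩
          sum (λ j → u j * dot (λ l → w l j) c)      ≈⟨ sum-cong (λ j → sym (sum-*ˡ _ _)) ⟩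
          sum (λ j → sum (λ l → u j * (w l j * c l))) ≈⟨ sum-comm _ ⟩
          sum (λ l → sum (λ j → u j * (w l j * c l)))
            ≈⟨ sum-0 (λ l → trans (sum-cong λ j → solve 3 (λ u w c → u :* (w :* c) := c :* (u :* w)) refl (u j) (w l j) (c l)) (trans (sum-*ˡ _ _) (trans (*-congˡ (w-orth l)) (zeroʳ _)))) ⟩
          0# ∎)
        rel : ∀ j → dot (λ l → w l j) c ≈ 0#
        rel j with j Fin.≟ j₀
        ... | yes ≡.refl = on
        ... | no ne = off j ne

      module Top (c : Vector) (rel : ∀ j → dot (λ l → w l j) c ≈ 0#) (l : Fin M) (nl : ¬ c (suc l) ≈ 0#)
          (above : ∀ l' → toℕ l ℕ.< toℕ l' → c (suc l') ≈ 0#) where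
        I : ℕ
        I = toℕ l

        c₀ c₁ : Carrier
        c₀ = c zero
        c₁ = c (suc l)

        rest : Vector
        rest j = sum (without l (λ k → D^φ (toℕ k) j * c (suc k)))

        rel' : ∀ j → φ^p j * c₀ + (c₁ * D^φ I j + rest j) ≈ 0#
        rel' j = trans (sym (trans (sum-suc _) (+-congˡ (trans (sum-without l _) (+-congʳ (*-comm _ _)))))) (rel j)

        ls-term : ∀ k → LS I (λ j → without l (λ k → D^φ (toℕ k) j * c (suc k)) k)
        ls-term k with k Fin.≟ l
        ... | yes _ = ls-0 I λ j → refl
        ... | no ne with ℕ.<-cmp (toℕ k) I
        ... | tri< lt _ _ = ls-cong I (λ j → *-comm _ _) (ls-* I (c (suc k)) (ls-gen I (toℕ k) lt))
        ... | tri≈ _ eq _ = ⊥-elim (ne (Fin.toℕ-injective eq))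
        ... | tri> _ _ gt = ls-0 I λ j → trans (*-congˡ (above k gt)) (zeroʳ _)

        ls-rest : LS I rest
        ls-rest = ls-sum I _ ls-term

        -- Without its Frobenius term the relation is itself a dependence at level `I`.
        case-zero : c₀ ≈ 0# → LS I (λ j → c₁ * D^φ I j)
        case-zero z₀ = ls-cong I eq (ls-* I (- 1#) ls-rest)
          where
          eq : ∀ j → - 1# * rest j ≈ c₁ * D^φ I j
          eq j = begin
            - 1# * rest j
              ≈⟨ solve 3 (λ r a f → (:- con (+ 1)) :* r := (a :- (f :+ (a :+ r))) :+ f) refl (rest j) (c₁ * D^φ I j) (φ^p j * c₀) ⟩
            (c₁ * D^φ I j - (φ^p j * c₀ + (c₁ * D^φ I j + rest j))) + φ^p j * c₀
              ≈⟨ +-cong (trans (+-congˡ (trans (-‿cong (rel' j)) -0#≈0#)) (+-identityʳ _)) (trans (*-congˡ z₀) (zeroʳ _)) ⟩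
            c₁ * D^φ I j + 0# ≈⟨ +-identityʳ _ ⟩
            c₁ * D^φ I j ∎

        drel : ∀ j → φ^p j * d c₀ + ((c₁ * D^φ (suc I) j + D^φ I j * d c₁) + d (rest j)) ≈ 0#
        drel j = begin
          φ^p j * d c₀ + ((c₁ * D^φ (suc I) j + D^φ I j * d c₁) + d (rest j))
            ≈⟨ +-cong (sym (trans (d-* (φ^p j) c₀) (trans (+-congˡ (trans (*-congˡ (d-frobenius p (φ j) p·1)) (zeroʳ c₀))) (+-identityʳ _))))
                      (sym (trans (d-+ (c₁ * D^φ I j) (rest j)) (+-congʳ (d-* c₁ (D^φ I j))))) ⟩
          d (φ^p j * c₀) + d (c₁ * D^φ I j + rest j) ≈⟨ sym (d-+ _ _) ⟩
          d (φ^p j * c₀ + (c₁ * D^φ I j + rest j)) ≈⟨ d-zero (rel' j) ⟩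
          0# ∎

        -- Eliminate the Frobenius vector between the relation and its derivative.
        eliminate : ∀ f x y r r' k k' l l' → f * k + (l * x + r) ≈ 0# → f * k' + ((l * y + x * l') + r') ≈ 0# →
          (k' * l - k * l') * x + (k' * r + (- k) * r') ≈ k * l * y
        eliminate f x y r r' k k' l l' e e' = sym (begin
          k * l * y
            ≈⟨ solve 9 (λ c₀ cl y f c₀' x cl' r r' → c₀ :* cl :* y := ((c₀' :* cl :- c₀ :* cl') :* x :+ (c₀' :* r :+ (:- c₀) :* r')) :+ (c₀ :* (f :* c₀' :+ ((cl :* y :+ x :* cl') :+ r')) :- c₀' :* (f :* c₀ :+ (cl :* x :+ r))))
                 refl k l y f k' x l' r r' ⟩
          ((k' * l - k * l') * x + (k' * r + (- k) * r')) + (k * (f * k' + ((l * y + x * l') + r')) - k' * (f * k + (l * x + r)))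
            ≈⟨ +-congˡ (+-cong (trans (*-congˡ e') (zeroʳ k)) (-‿cong (trans (*-congˡ e) (zeroʳ k')))) ⟩
          ((k' * l - k * l') * x + (k' * r + (- k) * r')) + (0# - 0#) ≈⟨ trans (+-congˡ (-‿inverseʳ 0#)) (+-identityʳ _) ⟩
          (k' * l - k * l') * x + (k' * r + (- k) * r') ∎)

        -- Since `φ^p` is constant for `D`, the dependence moves only one level up, and `suc I ≤ M`
        -- still holds; its leading coefficient `c₀ c₁` is nonzero.
        case-nonzero : LS (suc I) (λ j → c₀ * c₁ * D^φ (suc I) j)
        case-nonzero = ls-cong (suc I) (λ j → eliminate (φ^p j) (D^φ I j) (D^φ (suc I) j) (rest j) (d (rest j)) c₀ (d c₀) c₁ (d c₁) (rel' j) (drel j))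
          (ls-+ (suc I) (ls-* (suc I) (d c₀ * c₁ - c₀ * d c₁) (ls-top I))
            (ls-+ (suc I) (ls-* (suc I) (d c₀) (ls-suc I ls-rest)) (ls-* (suc I) (- c₀) (ls-d I ls-rest))))

        result : ∀ n i → i ℕ.< n → Orth i
        result with dec0 c₀
        ... | yes z₀ = orth-all orth I (ℕ.<⇒≤ (Fin.toℕ<n l)) c₁ nl (case-zero z₀)
        ... | no n₀ = orth-all orth (suc I) (Fin.toℕ<n l) (c₀ * c₁) (*≉0 n₀ nl) case-nonzero

      all-orth : ∀ n i → i ℕ.< n → Orth i
      all-orth with relation
      ... | c , (l₀ , nz) , rel with topmost (c ∘ suc)
      ... | inj₂ (l , nl , above) = Top.result c rel l nl above
      -- Only the Frobenius vector would be left in the relation, forcing `φ zero` to vanish.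
      ... | inj₁ z = ⊥-elim (^≉0 p φ≉0 (cancel0 c₀≉0 (trans (*-comm _ _) (trans (sym (trans (sum-suc _) (trans (+-congˡ (sum-0 λ l → trans (*-congˡ (z l)) (zeroʳ _))) (+-identityʳ _)))) (rel zero)))))
        where
        all : c zero ≈ 0# → ∀ l → c l ≈ 0#
        all z₀ zero = z₀
        all z₀ (suc l) = z l
        c₀≉0 : ¬ c zero ≈ 0#
        c₀≉0 z₀ = nz (all z₀ l₀)

  module Count (eμ<p : suc e ℕ.* μ ℕ.< p) (M≤p : M ℕ.≤ p) (Ps : List Point) (dist : AllPairs (λ P Q → Distinct Q P) Ps)
      (u : Vector) (fu : ∀ j → Fil U (u j)) (j₀ : Fin (suc M)) (nu : ¬ u j₀ ≈ 0#) (orth : ∀ i → i ℕ.< M → Orth u i) where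

    generic : ¬ Ψ u ≈ 0# → length Ps ℕ.* M ℕ.≤ suc e ℕ.* (U ℕ.+ p ℕ.* μ)
    generic nΨ = Bezout.bezout M M≤p Ps dist {U ℕ.+ p ℕ.* μ} {Ψ u} (fil-sum _ λ j → fil-* {U} {p ℕ.* μ} (fu j) (fil-^ {μ} p (φ-fil j))) nΨ (All.universal (ord-Ψ u orth) Ps)

    module _ (zΨ : Ψ u ≈ 0#) (P : Point) (l : ℕ) (ne : ¬ ev P (D^ l (u j₀)) K.≈ K.0#) where
      α : Fin (suc M) → K.Carrier
      α j = ev P (D^ l (u j))

      Ψ₀ : Carrier
      Ψ₀ = sum (λ j → inj (α j) * φ j)

      D^Ψ₀ : ∀ i → D^ i Ψ₀ ≈ sum (λ j → inj (α j) * D^φ i j)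
      D^Ψ₀ zero = refl
      D^Ψ₀ (suc i) = trans (d-cong (D^Ψ₀ i)) (trans (d-sum _) (sum-cong λ j → d-ι* (α j) (D^φ i j)))

      -- At `P` the derivative `D^i Ψ₀` takes the value of `D^l u · D^i φ`, which is zero because
      -- `u` is orthogonal to every derivative of `φ`.
      ordΨ₀ : Ord P p Ψ₀
      ordΨ₀ = ord-D^ P p λ i _ → K.trans (Point.ev-cong P (D^Ψ₀ i)) (K.trans (ev-dot P (λ j → inj (α j)) (D^φ i))
        (K.trans (SK.sum-cong λ j → K.*-congʳ (Point.at-ι P (α j))) (K.trans (K.sym (ev-dot P (D^u u l) (D^φ i)))
          (Point.ev-zero P (mixed u (suc (l ℕ.+ i)) (Degenerate.all-orth u orth j₀ nu zΨ (suc (l ℕ.+ i))) l i ℕ.≤-refl)))))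

      p≤ : 1 ℕ.* p ℕ.≤ suc e ℕ.* μ
      p≤ = Bezout.bezout p ℕ.≤-refl (P ∷ []) ([] ∷ []) {μ} {Ψ₀} (fil-sum {μ} _ λ j → fil-ι* (α j) (φ-fil j)) (λ z → ne (φ-indep α z j₀)) (ordΨ₀ ∷ [])

      -- `Ψ₀` is nonzero of degree at most `μ`, but order `p` at a single point requires
      -- `p ≤ (e + 1) μ`.
      impossible : ⊥
      impossible = ℕ.<⇒≱ eμ<p (ℕ.≤-trans (ℕ.≤-reflexive (≡.sym (ℕ.+-identityʳ p))) p≤)

    ord-u : Ψ u ≈ 0# → ∀ P → Ord P p (u j₀)
    ord-u zΨ P = [ (λ o → o) , (λ { (l , ne) → ⊥-elim (impossible zΨ P l ne) }) ]′ (ord-or P p (u j₀))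

    degenerate : Ψ u ≈ 0# → length Ps ℕ.* p ℕ.≤ suc e ℕ.* U
    degenerate zΨ = Bezout.bezout p ℕ.≤-refl Ps dist {U} {u j₀} (fu j₀) nu (All.universal (ord-u zΨ) Ps)

    count : Dec (Ψ u ≈ 0#) → (length Ps ℕ.* M ℕ.≤ suc e ℕ.* (U ℕ.+ p ℕ.* μ)) ⊎ (length Ps ℕ.* p ℕ.≤ suc e ℕ.* U)
    count (yes z) = inj₂ (degenerate z)
    count (no n) = inj₁ (generic n)

  -- The second alternative is the case Ψ = 0, in which a nonzero component of `u` enters Bezout's
  -- bound with multiplicity `p` in place of `M`.
  stohr-voloch : suc e ℕ.* μ ℕ.< p → M ℕ.≤ p → ∀ Ps → AllPairs (λ P Q → Distinct Q P) Ps →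
    (length Ps ℕ.* M ℕ.≤ suc e ℕ.* (U ℕ.+ p ℕ.* μ)) ⊎ (length Ps ℕ.* p ℕ.≤ suc e ℕ.* U)
  stohr-voloch eμ<p M≤p Ps dist = go siegel
    where
    go : (∃ λ (u : Vector) → (∀ j → Fil U (u j)) × (∃ λ j → ¬ u j ≈ 0#) × (∀ i → i ℕ.< M → dot u (D^φ i) ≈ 0#)) → _
    go (u , fu , (j₀ , nu) , orth) = Count.count eμ<p M≤p Ps dist u fu j₀ nu orth (dec0 (Ψ u))

-- Division with remainder and irreducible polynomials over a domain.

module Division (R : CRing) (dom : Domain R) where
  private
    module R = RingTools R
    module dR = Domain dom
  open PolyRing R public
  open Degree R public
  open RingTools poly public
  open Hom (CHom R) public using () renaming (f-cong to C-cong; f-* to C-*; f-1 to C-1; f-0 to C-0; f-^ to C-^; f-zero to C-zero)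
  domP : Domain poly
  domP = polyDomain dom
  open Domain domP public

  Lead : ℕ → List R.Carrier → Set
  Lead m p = Deg (suc m) p × ¬ coeff p m R.≈ R.0#

  Monic : ℕ → List R.Carrier → Set
  Monic m p = Deg (suc m) p × coeff p m R.≈ R.1#

  lead? : ∀ p → p ≈ 0# ⊎ ∃ λ m → Lead m p
  lead? p = [ inj₁ , (λ { (m , _ , l) → inj₂ (m , l) }) ]′ (leading dom _ p (deg-length p))

  lead< : ∀ {N} p → Deg N p → ¬ p ≈ 0# → ∃ λ m → m ℕ.< N × Lead m p
  lead< {N} p d n = [ (λ z → ⊥-elim (n z)) , (λ { (m , l , a) → m , l , a }) ]′ (leading dom N p d)

  lead≉0 : ∀ {m p} → Lead m p → ¬ p ≈ 0#
  lead≉0 {m} (_ , ne) z = ne (at z m)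

  lead-cong : ∀ {m p q} → p ≈ q → Lead m p → Lead m q
  lead-cong e (a , b) = deg-cong e a , λ z → b (R.trans (at e _) z)

  monic⇒lead : ∀ {m p} → Monic m p → Lead m p
  monic⇒lead (a , b) = a , λ z → dR.1≉0 (R.trans (R.sym b) z)

  lead-* : ∀ {m n p q} → Lead m p → Lead n q → Lead (m ℕ.+ n) (p * q)
  lead-* {m} {n} {p} {q} (a , b) (c , d) = deg-⊗ p a c , λ z → dR.*≉0 b d (R.trans (R.sym (top-⊗ p a c)) z)

  lead-unique : ∀ {m n p} → Lead m p → Lead n p → m ≡ n
  lead-unique {m} {n} (a , b) (c , d) with ℕ.<-cmp m n
  ... | tri< l _ _ = ⊥-elim (d (vanish a n l))
  ... | tri≈ _ e _ = e
  ... | tri> _ _ l = ⊥-elim (b (vanish c m l))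

  lead-deg : ∀ {m N p} → Lead m p → Deg N p → m ℕ.< N
  lead-deg {m} {N} (a , b) d = ℕ.≰⇒> λ l → b (vanish d m l)

  deg-C* : ∀ {N} c {p} → Deg N p → Deg N (C c * p)
  deg-C* c d = deg-cong (≋-sym (C-⊗ c _)) (deg-⊙ c d)

  coeff-C* : ∀ c p i → coeff (C c * p) i R.≈ c R.* coeff p i
  coeff-C* c p i = R.trans (at (C-⊗ c p) i) (coeff-⊙ c p i)

  coeff-sub : ∀ p q i → coeff (p - q) i R.≈ coeff p i R.- coeff q i
  coeff-sub p q i = R.trans (coeff-⊕ p (- q) i) (R.+-congˡ (coeff-⊖ q i))

  deg-sub : ∀ {N p q} → Deg N p → Deg N q → Deg N (p - q)
  deg-sub a b = deg-⊕ a (deg-⊖ b)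

  C≉0 : ∀ {c} → ¬ c R.≈ R.0# → ¬ C c ≈ 0#
  C≉0 n z = n (at z 0)

  deg1⇒C : ∀ {p} → Deg 1 p → p ≈ C (coeff p 0)
  deg1⇒C {[]} d = mk λ { zero → R.refl ; (suc i) → R.refl }
  deg1⇒C {a ∷ p} d = ∷-cong R.refl (deg-0 (deg-tail d))

  monic-X^ : ∀ k → Monic k (X ^ k)
  monic-X^ zero = deg-C , R.refl
  monic-X^ (suc k) with monic-X^ k
  ... | a , b = deg-⊗ X degX a , R.trans (top-⊗ X degX a) (R.trans (R.*-identityˡ _) b)
    where
    degX : Deg 2 X
    degX = deg-∷ deg-C

  record Division (a f : List R.Carrier) (ρ : ℕ) : Set where
    constructor division
    field
      j     : ℕ
      q r   : List R.Carrier
      eq    : C (coeff a ρ R.^ j) * f ≈ a * q + r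
      deg-r : Deg ρ r

  -- The leading coefficient of `a` may fail to be invertible, so a power of it multiplies `f`
  -- first.
  pseudo-divide : ∀ {ρ} a → Deg (suc ρ) a → ∀ N f → Deg N f → Division a f ρ
  pseudo-divide {ρ} a da N f df with N ℕ.≤? ρ
  ... | yes l = division 0 0# f (trans (*-identityˡ f) (sym (trans (+-congʳ (zeroʳ a)) (+-identityˡ f)))) (deg-mono l df)
  pseudo-divide {ρ} a da zero f df | no nl = ⊥-elim (nl z≤n)
  pseudo-divide {ρ} a da (suc m) f df | no nl = step (pseudo-divide a da m f' df')
    where
    λ' = coeff a ρ
    c = coeff f m
    k = m ℕ.∸ ρ
    k+ρ : k ℕ.+ ρ ≡ m
    k+ρ = ℕ.m∸n+n≡m (ℕ.≤-pred (ℕ.≰⇒> nl))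
    h = X ^ k * a
    f' = C λ' * f - C c * h
    dh : Deg (suc m) h
    dh = ≡.subst (λ m → Deg (suc m) h) k+ρ (deg-⊗ (X ^ k) (proj₁ (monic-X^ k)) da)
    top : coeff h m R.≈ λ'
    top = ≡.subst (λ m → coeff h m R.≈ λ') k+ρ (R.trans (top-⊗ (X ^ k) (proj₁ (monic-X^ k)) da) (R.trans (R.*-congʳ (proj₂ (monic-X^ k))) (R.*-identityˡ _)))
    df' : Deg m f'
    df' = deg-pred (deg-sub (deg-C* λ' df) (deg-C* c dh)) (R.trans (coeff-sub (C λ' * f) (C c * h) m)
      (R.trans (R.+-cong (coeff-C* λ' f m) (R.-‿cong (R.trans (coeff-C* c h m) (R.trans (R.*-congˡ top) (R.*-comm c λ'))))) (R.-‿inverseʳ _)))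
    step : Division a f' ρ → Division a f ρ
    step (division j q r eq dr) = division (suc j) (q + C (λ' R.^ j) * C c * X ^ k) r eq' dr
      where
      eq' : C (λ' R.* λ' R.^ j) * f ≈ a * (q + C (λ' R.^ j) * C c * X ^ k) + r
      eq' = begin
        C (λ' R.* λ' R.^ j) * f  ≈⟨ *-congʳ (C-* λ' (λ' R.^ j)) ⟩
        C λ' * C (λ' R.^ j) * f
          ≈⟨ solve 6 (λ l lj f c x a → l :* lj :* f := lj :* (l :* f :- c :* (x :* a)) :+ a :* (lj :* c :* x)) refl (C λ') (C (λ' R.^ j)) f (C c) (X ^ k) a ⟩
        C (λ' R.^ j) * f' + a * (C (λ' R.^ j) * C c * X ^ k) ≈⟨ +-congʳ eq ⟩
        a * q + r + a * (C (λ' R.^ j) * C c * X ^ k)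
          ≈⟨ solve 4 (λ a q r z → a :* q :+ r :+ a :* z := a :* (q :+ z) :+ r) refl a q r (C (λ' R.^ j) * C c * X ^ k) ⟩
        a * (q + C (λ' R.^ j) * C c * X ^ k) + r ∎

  1^ : ∀ {x} j → x R.≈ R.1# → x R.^ j R.≈ R.1#
  1^ zero e = R.refl
  1^ (suc j) e = R.trans (R.*-cong e (1^ j e)) (R.*-identityˡ _)

  divide : ∀ {d G} → Monic d G → ∀ f → ∃ λ q → ∃ λ r → f ≈ G * q + r × Deg d r
  divide {d} {G} (dG , mG) f with pseudo-divide G dG _ f (deg-length f)
  ... | division j q r eq dr = q , r , trans (sym (trans (*-congʳ (trans (C-cong (1^ j mG)) refl)) (*-identityˡ f))) eq , dr

  multiple-small : ∀ {d G} → Lead d G → ∀ q → Deg d (G * q) → q ≈ 0#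
  multiple-small {d} {G} lG q dq with lead? q
  ... | inj₁ z = z
  ... | inj₂ (m , lm) = ⊥-elim (ℕ.<⇒≱ (lead-deg (lead-* lG lm) dq) (ℕ.m≤m+n d m))

  -- The factor `c` clears denominators: this is irreducibility over the fraction field, stated
  -- without constructing that field.
  record Irreducible (d : ℕ) (G : List R.Carrier) : Set where
    constructor irreducible
    field irr : ∀ {ρ a} c q → Lead (suc ρ) a → suc ρ ℕ.< suc d → ¬ c R.≈ R.0# → C c * G ≈ a * q → ⊥

  module PrimeQuotient (d : ℕ) (G : List R.Carrier) (mG : Monic (suc d) G) (irrG : Irreducible d G) where
    open Irreducible irrG
    open Quotient poly G
    private
      module Q = RingTools quotient
      lG = monic⇒lead mG

    small-zero : ∀ {r} → Deg (suc d) r → r ≃ 0# → r ≈ 0#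
    small-zero {r} dr z with ≃0⇒∣ z
    ... | div q e = trans e (trans (*-congˡ (multiple-small lG q (deg-cong e dr))) (zeroʳ G))

    reduce : ∀ {x q r} → x ≈ G * q + r → x ≃ r
    reduce {x} {q} {r} e = quo q (trans (+-congʳ e) (solve 2 (λ a r → a :+ r :- r := a) refl (G * q) r))

    dec-div : ∀ x → Dec (x ≃ 0#)
    dec-div x with divide mG x
    ... | q , r , e , dr with dec0 r
    ... | yes z = yes (Q.trans (reduce e) (≈⇒≃ z))
    ... | no nz = no λ x≃0 → nz (small-zero dr (Q.trans (Q.sym (reduce e)) x≃0))

    -- Euclidean descent: the pseudo-remainder of G by a replaces a, and irreducibility keeps it nonzero.
    divides-constant : ∀ N ρ a → ρ ℕ.< N → Lead ρ a → ρ ℕ.< suc d → ∃ λ z → ∃ λ c → ¬ c R.≈ R.0# × z * a ≃ C c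
    divides-constant (suc N) zero a _ (da , na) _ = 1# , coeff a 0 , na , ≈⇒≃ (trans (*-identityˡ a) (deg1⇒C da))
    divides-constant (suc N) (suc ρ) a (s≤s ρ<N) la@(da , na) ρ<d with pseudo-divide a da _ G (deg-length G)
    ... | division j q r eq dr with dec0 r
    ... | yes z = ⊥-elim (irr (coeff a (suc ρ) R.^ j) q la ρ<d (dR.^≉0 j na) (trans eq (trans (+-congˡ z) (+-identityʳ _))))
    ... | no nz with lead< r dr nz
    ... | m , m<ρ , lm with divides-constant N m r (ℕ.<-≤-trans m<ρ ρ<N) lm (ℕ.<-trans m<ρ ρ<d)
    ... | z , c , nc , e = - (z * q) , c , nc , Q.trans (Q.sym zr≃) e
      where
      zr≃ : z * r ≃ - (z * q) * a
      zr≃ = quo (z * C (coeff a (suc ρ) R.^ j)) (begin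
        z * r - - (z * q) * a  ≈⟨ solve 4 (λ z r q a → z :* r :- (:- (z :* q)) :* a := z :* (a :* q :+ r)) refl z r q a ⟩
        z * (a * q + r)        ≈⟨ *-congˡ (sym eq) ⟩
        z * (C (coeff a (suc ρ) R.^ j) * G) ≈⟨ solve 3 (λ z c g → z :* (c :* g) := g :* (z :* c)) refl z _ G ⟩
        G * (z * C (coeff a (suc ρ) R.^ j)) ∎)

    cancel-constant : ∀ {c} y → ¬ c R.≈ R.0# → C c * y ≃ 0# → y ≃ 0#
    cancel-constant {c} y nc e with divide mG y
    ... | q , r , ye , dr = Q.trans (reduce ye) (≈⇒≃ (cancel0 (C≉0 nc) (small-zero (deg-C* c dr) (Q.trans (Q.*-congˡ (Q.sym (reduce ye))) e))))

    -- If `x` is nonzero modulo `G`, some multiple of it is a nonzero constant `c` modulo `G`. Then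
    -- `c y` vanishes modulo `G`, and since `G` is monic so does `y`.
    quotient-zd : ∀ x y → x * y ≃ 0# → x ≃ 0# ⊎ y ≃ 0#
    quotient-zd x y e with divide mG x
    ... | q , r , xe , dr with dec0 r
    ... | yes z = inj₁ (Q.trans (reduce xe) (≈⇒≃ z))
    ... | no nz with lead< r dr nz
    ... | m , m<d , lm with divides-constant (suc m) m r ℕ.≤-refl lm m<d
    ... | z , c , nc , ze = inj₂ (cancel-constant y nc (begin' e))
      where
      begin' : x * y ≃ 0# → C c * y ≃ 0#
      begin' e = Q.trans (Q.*-congʳ (Q.sym ze)) (Q.trans (Q.*-assoc z r y) (Q.trans (Q.*-congˡ (Q.trans (Q.*-congʳ (Q.sym (reduce xe))) e)) (Q.zeroʳ z)))

    quotientDomain : Domain (Quotient.quotient (PolyRing.poly R) G)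
    quotientDomain = record { zd = quotient-zd ; dec0 = dec-div ; 1≉0 = λ e → 1≉0 (small-zero (deg-mono (s≤s z≤n) deg-C) e) }

-- Fields, contents and prime factors.

record Field (K : CRing) : Set where
  open RingTools K
  field
    dom : Domain K
    recip : Carrier → Carrier
    recip-inverse : ∀ x → ¬ x ≈ 0# → x * recip x ≈ 1#
  inv : ∀ x → ¬ x ≈ 0# → ∃ λ y → x * y ≈ 1#
  inv x ne = recip x , recip-inverse x ne

module MapCoefficients {R T : CRing} (domT : Domain T) (h : Hom R T) where
  private
    module R = RingTools R
    module T = RingTools T
    module PR = PolyRing R
    module PT = PolyRing T
    module E = Evaluation (CHom T ∘H h) PT.X
  open Hom h

  coeff-ev : ∀ p i → PT.coeff (E.ev p) i T.≈ f (PR.coeff p i)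
  coeff-ev [] i = T.sym f-0
  coeff-ev (a ∷ p) zero = PT.at (PT.≋-sym (PT.∷-decomp (f a) (E.ev p))) 0
  coeff-ev (a ∷ p) (suc i) = T.trans (PT.at (PT.≋-sym (PT.∷-decomp (f a) (E.ev p))) (suc i)) (coeff-ev p i)

  -- After `h` is applied to the coefficients, the two images multiply to zero in a polynomial ring
  -- over a domain.
  content : ∀ r q → (∀ i → f (PR.coeff (r PR.⊗ q) i) T.≈ T.0#) →
    (∀ i → f (PR.coeff r i) T.≈ T.0#) ⊎ (∀ i → f (PR.coeff q i) T.≈ T.0#)
  content r q a with Degree.poly-zd T domT (E.ev r) (E.ev q) (PT.≋-trans (PT.≋-sym (E.ev-⊗ r q)) (PT.mk λ i → T.trans (coeff-ev (r PR.⊗ q) i) (a i)))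
  ... | inj₁ z = inj₁ λ i → T.trans (T.sym (coeff-ev r i)) (PT.at z i)
  ... | inj₂ z = inj₂ λ i → T.trans (T.sym (coeff-ev q i)) (PT.at z i)

module Content (A : CRing) (π : Car A) (domQ : Domain (Quotient.quotient A π)) where
  open PolyRing A
  open Quotient A π

  divide-all : ∀ r → (∀ i → ∣ coeff r i) → ∃ λ r₁ → r ≋ C π ⊗ r₁
  divide-all r a = proj₁ (go r a) , ≋-trans (proj₂ (go r a)) (≋-sym (C-⊗ π _))
    where
    go : ∀ r → (∀ i → ∣ coeff r i) → ∃ λ r₁ → r ≋ π ⊙ r₁
    go [] a = [] , ≋-sym (⊙-[] π)
    go (x ∷ r) a with a 0 | go r (λ i → a (suc i))
    ... | div q e | r₁ , f = q ∷ r₁ , ≋-trans (∷-cong e f) (≋-sym (⊙-∷ π q r₁))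

  content : ∀ r q → (∀ i → ∣ coeff (r ⊗ q) i) → (∃ λ r₁ → r ≋ C π ⊗ r₁) ⊎ (∃ λ q₁ → q ≋ C π ⊗ q₁)
  content r q a = [ (λ z → inj₁ (divide-all r λ i → ≃0⇒∣ (z i))) , (λ z → inj₂ (divide-all q λ i → ≃0⇒∣ (z i))) ]′
      (MapCoefficients.content domQ quotHom r q (λ i → ∣⇒≃0 (a i)))

-- The induction scheme behind Gauss's lemma: a nonzero element is a unit or loses a prime and gets
-- smaller. The prime is claimed only up to double negation, because its existence is proved by
-- contradiction and not by a search.
record Splitting (A : CRing) : Set₁ where
  open RingTools A
  field
    Size  : ℕ → Carrier → Set
    size  : ∀ c → ∃ λ N → Size N c
    split : ∀ N c → Size N c → ¬ c ≈ 0# → (∃ λ i → c * i ≈ 1#) ⊎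
      ∃ λ N' → N ≡ suc N' × ¬ ¬ (∃ λ π → ∃ λ c₁ → c ≈ π * c₁ × ¬ π ≈ 0# × Size N' c₁ × Domain (Quotient.quotient A π))

module PrimeFactors (K : CRing) (fld : Field K) where
  open Field fld
  private
    module K = RingTools K
    module dK = Domain dom
  module A = Division K dom

  normalise : ∀ {m} p → A.Lead m p → ∃ λ c → ∃ λ c' → c K.* c' K.≈ K.1# × A.Monic m (A.C c A.* p)
  normalise {m} p (dp , np) with inv (A.coeff p m) np
  ... | c , e = c , A.coeff p m , K.trans (K.*-comm _ _) e , A.deg-C* c dp , K.trans (A.coeff-C* c p m) (K.trans (K.*-comm _ _) e)

  record PrimeFactor (c : List K.Carrier) : Set where
    field
      d      : ℕ
      π c₁   : List K.Carrier
      monic  : A.Monic (suc d) π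
      irr    : A.Irreducible d π
      eq     : c A.≈ π A.* c₁

  -- A polynomial without prime factors would be irreducible itself: a proper divisor has smaller
  -- degree, so by induction it has a prime factor, and this would divide `c`.
  prime-factor : ∀ N m c → m ℕ.< N → A.Lead (suc m) c → ¬ ¬ PrimeFactor c
  prime-factor (suc N) m c (s≤s m≤N) lc none with normalise c lc
  ... | k , k' , kk' , mon = none (record { d = m ; π = A.C k A.* c ; c₁ = A.C k' ; monic = mon ; irr = A.irreducible irr' ; eq = ceq })
    where
    undo : ∀ k k' → k K.* k' K.≈ K.1# → ∀ c → c A.≈ (A.C k A.* c) A.* A.C k'
    undo k k' e c = A.sym (A.trans (A.solve 3 (λ k c k' → (k A.:* c) A.:* k' A.:= (k A.:* k') A.:* c) A.refl (A.C k) c (A.C k'))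
      (A.trans (A.*-congʳ (A.trans (A.sym (A.C-* k k')) (A.C-cong e))) (A.*-identityˡ c)))
    ceq : c A.≈ (A.C k A.* c) A.* A.C k'
    ceq = undo k k' kk' c
    irr' : ∀ {ρ a} b q → A.Lead (suc ρ) a → suc ρ ℕ.< suc m → ¬ b K.≈ K.0# → A.C b A.* (A.C k A.* c) A.≈ a A.* q → ⊥
    irr' {ρ} {a} b q la (s≤s ρ<m) nb e with inv b nb
    ... | b' , bb' = prime-factor N ρ a (ℕ.<-≤-trans ρ<m m≤N) la λ pf →
        none (record { d = PrimeFactor.d pf ; π = PrimeFactor.π pf ; c₁ = PrimeFactor.c₁ pf A.* (q A.* A.C b' A.* A.C k') ; monic = PrimeFactor.monic pf ; irr = PrimeFactor.irr pf
          ; eq = A.trans ceq (A.trans (A.*-congʳ (A.trans (undo b b' bb' (A.C k A.* c)) (A.trans (A.*-congʳ e) (A.*-congʳ (A.*-congʳ (PrimeFactor.eq pf))))))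
                   (A.solve 5 (λ p c q b k → p A.:* c A.:* q A.:* b A.:* k A.:= p A.:* (c A.:* (q A.:* b A.:* k))) A.refl (PrimeFactor.π pf) (PrimeFactor.c₁ pf) q (A.C b') (A.C k'))) })

  -- The degree bound N limits the number of prime factors that can be split off.
  split : ∀ N c → A.Deg N c → ¬ c A.≈ A.0# → (∃ λ i → c A.* i A.≈ A.1#) ⊎
    ∃ λ N' → N ≡ suc N' × ¬ ¬ (∃ λ π → ∃ λ c₁ → c A.≈ π A.* c₁ × ¬ π A.≈ A.0# × A.Deg N' c₁ × Domain (Quotient.quotient (PolyRing.poly K) π))
  split N c dc nc with A.lead< c dc nc
  split N c dc nc | zero , _ , lc with inv (A.coeff c 0) (proj₂ lc)
  ... | i , ci = inj₁ (A.C i , A.trans (A.*-congʳ (A.deg1⇒C (proj₁ lc))) (A.trans (A.sym (A.C-* _ i)) (A.C-cong ci)))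
  split (suc N) c dc nc | suc m , _ , lc = inj₂ (N , ≡.refl , λ none → prime-factor (suc m) m c ℕ.≤-refl lc λ pf → none (found pf))
    where
    found : PrimeFactor c → ∃ λ π → ∃ λ c₁ → c A.≈ π A.* c₁ × ¬ π A.≈ A.0# × A.Deg N c₁ × Domain (Quotient.quotient (PolyRing.poly K) π)
    found pf = π , c₁ , eq , A.lead≉0 (A.monic⇒lead monic) , dc₁ , A.PrimeQuotient.quotientDomain d π monic irr
      where
      open PrimeFactor pf
      dc₁ : A.Deg N c₁
      dc₁ with A.lead? c₁
      ... | inj₁ z = A.deg-zero z
      ... | inj₂ (m₁ , l₁) = A.deg-mono (ℕ.≤-trans (s≤s (ℕ.m≤n+m m₁ d)) (ℕ.≤-pred (A.lead-deg (A.lead-* (A.monic⇒lead monic) l₁) (A.deg-cong eq dc)))) (proj₁ l₁)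

  splitting : Splitting (PolyRing.poly K)
  splitting = record { Size = A.Deg ; size = λ c → length c , A.deg-length c ; split = split }

-- Gauss's lemma: a factorisation of a monic polynomial over the fraction field of A comes from one over A.
module Gauss (A : CRing) (domA : Domain A) (splitting : Splitting A) where
  open Splitting splitting
  private
    module A where
      open RingTools A public
      open Domain domA public
  module B = Division A domA
  Poly : Set
  Poly = List A.Carrier

  Factor : ℕ → Poly → Set
  Factor ρ G = ∃ λ r → ∃ λ q → B.Monic ρ r × r B.* q B.≈ G

  lead-factor : ∀ {ρ p r s} → B.Lead ρ p → ¬ s A.≈ A.0# → p B.≈ B.C s B.* r → B.Lead ρ r
  lead-factor {ρ} {p} {r} {s} (dp , np) ns e = B.deg (λ i l → A.cancel0 ns (A.trans (A.sym (A.trans (B.at e i) (B.coeff-C* s r i))) (B.vanish dp i l)))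
    , λ z → np (A.trans (B.at e ρ) (A.trans (B.coeff-C* s r ρ) (A.trans (A.*-congˡ z) (A.zeroʳ s))))

  -- As `G` is monic, the leading coefficients of `r` and `q` multiply to `c`; when `c` is a unit
  -- both factors can be rescaled, and `r` becomes monic.
  module UnitCase {d ρ κ G} (c i : A.Carrier) (r q : Poly) (ci : c A.* i A.≈ A.1#) (nc : ¬ c A.≈ A.0#) (mG : B.Monic d G)
      (lr : B.Lead ρ r) (lq : B.Lead κ q) (e : B.C c B.* G B.≈ r B.* q) where
    rρ = B.coeff r ρ
    qκ = B.coeff q κ
    lcG : B.Lead d (B.C c B.* G)
    lcG = B.deg-C* c (proj₁ mG) , λ z → nc (A.trans (A.sym (A.trans (A.*-congˡ (proj₂ mG)) (A.*-identityʳ c))) (A.trans (A.sym (B.coeff-C* c G d)) z))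
    d≡ : d ≡ ρ ℕ.+ κ
    d≡ = B.lead-unique lcG (B.lead-cong (B.sym e) (B.lead-* lr lq))
    c≈ : rρ A.* qκ A.≈ c
    c≈ = A.trans (A.sym (B.top-⊗ r (proj₁ lr) (proj₁ lq))) (A.trans (B.at (B.sym e) (ρ ℕ.+ κ)) (≡.subst (λ m → B.coeff (B.C c B.* G) m A.≈ c) d≡
      (A.trans (B.coeff-C* c G d) (A.trans (A.*-congˡ (proj₂ mG)) (A.*-identityʳ c)))))
    unit : (qκ A.* i) A.* rρ A.≈ A.1#
    unit = A.trans (A.solve 3 (λ q i r → (q A.:* i) A.:* r A.:= (r A.:* q) A.:* i) A.refl qκ i rρ) (A.trans (A.*-congʳ c≈) ci)
    eq : (B.C (qκ A.* i) B.* r) B.* (B.C (rρ A.* i) B.* q) B.≈ G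
    eq = B.begin
      (B.C (qκ A.* i) B.* r) B.* (B.C (rρ A.* i) B.* q)
        B.≈⟨ B.solve 4 (λ a r b q → (a B.:* r) B.:* (b B.:* q) B.:= (a B.:* b) B.:* (r B.:* q)) B.refl (B.C (qκ A.* i)) r (B.C (rρ A.* i)) q ⟩
      (B.C (qκ A.* i) B.* B.C (rρ A.* i)) B.* (r B.* q) B.≈⟨ B.*-congˡ (B.sym e) ⟩
      (B.C (qκ A.* i) B.* B.C (rρ A.* i)) B.* (B.C c B.* G) B.≈⟨ B.sym (B.*-assoc _ (B.C c) G) ⟩
      (B.C (qκ A.* i) B.* B.C (rρ A.* i)) B.* B.C c B.* G
        B.≈⟨ B.*-congʳ (B.trans (B.*-congʳ (B.sym (B.C-* _ _))) (B.trans (B.sym (B.C-* _ c)) (B.C-cong (A.trans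
              (A.solve 4 (λ q i r c → ((q A.:* i) A.:* (r A.:* i)) A.:* c A.:= ((q A.:* i) A.:* r) A.:* (c A.:* i)) A.refl qκ i rρ c) (A.trans (A.*-cong unit ci) (A.*-identityˡ _)))))) ⟩
      B.1# B.* G B.≈⟨ B.*-identityˡ G ⟩
      G B.∎
    factor : Factor ρ G
    factor = B.C (qκ A.* i) B.* r , B.C (rρ A.* i) B.* q , (B.deg-C* _ (proj₁ lr) , A.trans (B.coeff-C* _ r ρ) unit) , eq

  -- Induction on the size of `c`: a prime divisor of `c` divides all coefficients of `r q`, hence
  -- those of `r` or those of `q`, and cancels. Only the unit case remains.
  gauss : ∀ N {d ρ G} c r q → Size N c → ¬ c A.≈ A.0# → B.Monic d G → B.Lead ρ r → B.C c B.* G B.≈ r B.* q → ¬ ¬ Factor ρ G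
  gauss N {d} {ρ} {G} c r q sc nc mG lr e none with split N c sc nc
  gauss N {d} {ρ} {G} c r q sc nc mG lr e none | inj₁ (i , ci) with B.lead? q
  ... | inj₁ z = B.*≉0 (B.C≉0 nc) (B.lead≉0 (B.monic⇒lead mG)) (B.trans e (B.trans (B.*-congˡ z) (B.zeroʳ r)))
  ... | inj₂ (κ , lq) = none (UnitCase.factor c i r q ci nc mG lr lq e)
  gauss .(suc N') {d} {ρ} {G} c r q sc nc mG lr e none | inj₂ (N' , ≡.refl , prime) = prime λ { (π , c₁ , ceq , nπ , sc₁ , domQ) →
    let nc₁ : ¬ c₁ A.≈ A.0#
        nc₁ z = nc (A.trans ceq (A.trans (A.*-congˡ z) (A.zeroʳ π)))
        divs : ∀ i → Quotient.∣_ A π (B.coeff (r B.* q) i)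
        divs i = Quotient.div (c₁ A.* B.coeff G i) (A.trans (B.at (B.sym e) i) (A.trans (B.coeff-C* c G i) (A.trans (A.*-congʳ ceq) (A.*-assoc π c₁ _))))
        cancel : ∀ {x} → r B.* q B.≈ B.C π B.* x → B.C c₁ B.* G B.≈ x
        cancel f = B.cancelˡ (B.C≉0 nπ) (B.trans (B.sym (B.trans (B.*-congʳ (B.trans (B.C-cong ceq) (B.C-* π c₁))) (B.*-assoc _ _ _))) (B.trans e f))
    in [ (λ { (r₁ , f) → gauss N' c₁ r₁ q sc₁ nc₁ mG (lead-factor lr nπ f) (cancel (B.trans (B.*-congʳ f) (B.*-assoc _ _ _))) none })
       , (λ { (q₁ , f) → gauss N' c₁ r q₁ sc₁ nc₁ mG lr (cancel (B.trans (B.*-congˡ f) (B.solve 3 (λ r p q → r B.:* (p B.:* q) B.:= p B.:* (r B.:* q)) B.refl r (B.C π) q₁))) none }) ]′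
       (Content.content A π domQ r q divs) }

  record PrimePoly : Set where
    field
      e      : ℕ
      G      : Poly
      monic  : B.Monic (suc e) G
      domain : Domain (Quotient.quotient (PolyRing.poly A) G)
  open PrimePoly

  prod : List PrimePoly → Poly
  prod [] = B.1#
  prod (P ∷ Ps) = G P B.* prod Ps

  degrees : List PrimePoly → ℕ
  degrees [] = 0
  degrees (P ∷ Ps) = suc (e P) ℕ.+ degrees Ps

  Factorisation : ℕ → Poly → Set
  Factorisation d G = ∃ λ Ps → prod Ps B.≈ G × degrees Ps ≡ d

  prod-++ : ∀ Ps Qs → prod (Ps List.++ Qs) B.≈ prod Ps B.* prod Qs
  prod-++ [] Qs = B.sym (B.*-identityˡ _)
  prod-++ (P ∷ Ps) Qs = B.trans (B.*-congˡ (prod-++ Ps Qs)) (B.sym (B.*-assoc _ _ _))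

  degrees-++ : ∀ Ps Qs → degrees (Ps List.++ Qs) ≡ degrees Ps ℕ.+ degrees Qs
  degrees-++ [] Qs = ≡.refl
  degrees-++ (P ∷ Ps) Qs = ≡.trans (≡.cong (suc (e P) ℕ.+_) (degrees-++ Ps Qs)) (≡.sym (ℕ.+-assoc (suc (e P)) (degrees Ps) (degrees Qs)))

  monic-cofactor : ∀ {d ρ G r q} → B.Monic d G → B.Monic ρ r → r B.* q B.≈ G → ∃ λ κ → B.Monic κ q × d ≡ ρ ℕ.+ κ
  monic-cofactor {d} {ρ} {G} {r} {q} mG mr e with B.lead? q
  ... | inj₁ z = ⊥-elim (B.lead≉0 (B.monic⇒lead mG) (B.trans (B.sym e) (B.trans (B.*-congˡ z) (B.zeroʳ r))))
  ... | inj₂ (κ , lq) = κ , (proj₁ lq , A.trans (A.sym (A.trans (A.*-congʳ (proj₂ mr)) (A.*-identityˡ _))) (A.trans (A.sym (B.top-⊗ r (proj₁ mr) (proj₁ lq))) (A.trans (B.at e (ρ ℕ.+ κ)) (≡.subst (λ m → B.coeff G m A.≈ A.1#) d≡ (proj₂ mG))))) , d≡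
    where
    d≡ : d ≡ ρ ℕ.+ κ
    d≡ = B.lead-unique (B.monic⇒lead mG) (B.lead-cong e (B.lead-* (B.monic⇒lead mr) lq))

  -- Suppose there is no factorisation. Then `G` is irreducible, because a factor over the fraction
  -- field yields by `gauss` two monic factors of smaller degree, whose factorisations concatenate.
  -- But an irreducible `G` is a factorisation by itself.
  factorise : ∀ N d G → d ℕ.< N → B.Monic d G → ¬ ¬ Factorisation d G
  factorise (suc N) zero G _ mG none = none ([] , B.sym (B.trans (B.deg1⇒C (proj₁ mG)) (B.C-cong (proj₂ mG))) , ≡.refl)
  factorise (suc N) (suc d) G (s≤s d≤N) mG none = none ((record { e = d ; G = G ; monic = mG ; domain = B.PrimeQuotient.quotientDomain d G mG (B.irreducible irr) } ∷ []) , B.*-identityʳ G , ≡.cong suc (ℕ.+-identityʳ d))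
    where
    irr : ∀ {ρ a} c q → B.Lead (suc ρ) a → suc ρ ℕ.< suc d → ¬ c A.≈ A.0# → B.C c B.* G B.≈ a B.* q → ⊥
    irr {ρ} {a} c q la (s≤s ρ<d) nc e = gauss (proj₁ (size c)) c a q (proj₂ (size c)) nc mG la e λ { (r , s , mr , rs) →
      let (κ , ms , d≡) = monic-cofactor mG mr rs in
      factorise N (suc ρ) r (ℕ.≤-trans (s≤s ρ<d) d≤N) mr λ { (Ps , eP , dP) →
      factorise N κ s (ℕ.≤-trans (s≤s (ℕ.≤-trans (ℕ.m≤n+m κ ρ) (ℕ.≤-reflexive (≡.sym (ℕ.suc-injective d≡))))) (ℕ.≤-trans (ℕ.≤-reflexive (≡.refl)) d≤N) ) ms λ { (Qs , eQ , dQ) →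
      none (Ps List.++ Qs , B.trans (prod-++ Ps Qs) (B.trans (B.*-cong eP eQ) rs) , ≡.trans (degrees-++ Ps Qs) (≡.trans (≡.cong₂ ℕ._+_ dP dQ) (≡.sym d≡))) } } }

-- A stands for K[V], with variable v and i-th coefficient ca i.
record Graded (K A : CRing) : Set₁ where
  private
    module K = RingTools K
    module A = RingTools A
  field
    ι : Hom K A
    v : A.Carrier
    ca : ℕ → A.Carrier → K.Carrier
    ca-cong : ∀ i {a b} → a A.≈ b → ca i a K.≈ ca i b
    ca-+ : ∀ i a b → ca i (a A.+ b) K.≈ ca i a K.+ ca i b
    ca-ι0 : ∀ c → ca 0 (Hom.f ι c) K.≈ c
    ca-ιs : ∀ i c → ca (suc i) (Hom.f ι c) K.≈ K.0#
    ca-v0 : ∀ a → ca 0 (v A.* a) K.≈ K.0#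
    ca-vs : ∀ i a → ca (suc i) (v A.* a) K.≈ ca i a
    ca-ι* : ∀ i c a → ca i (Hom.f ι c A.* a) K.≈ c K.* ca i a
    ca-ext : ∀ {a} → (∀ i → ca i a K.≈ K.0#) → a A.≈ A.0#
    finite : ∀ a → ∃ λ N → ∀ i → N ℕ.≤ i → ca i a K.≈ K.0#
    horner : ∀ a → ∃ λ c → ∃ λ a' → a A.≈ Hom.f ι c A.+ v A.* a'
    dg-* : ∀ {M N a b} → (∀ i → M ℕ.≤ i → ca i a K.≈ K.0#) → (∀ i → suc N ℕ.≤ i → ca i b K.≈ K.0#) →
      ∀ i → M ℕ.+ N ℕ.≤ i → ca i (a A.* b) K.≈ K.0#
    evalT : ∀ {T} → Hom K T → Car T → Hom A T
    eval-ι : ∀ {T} (h : Hom K T) t c → CommutativeRing._≈_ T (Hom.f (evalT h t) (Hom.f ι c)) (Hom.f h c)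
    eval-v : ∀ {T} (h : Hom K T) t → CommutativeRing._≈_ T (Hom.f (evalT h t) v) t
    derT : ∀ {T} (h : Hom A T) → Car T → Der h
    der-ι : ∀ {T} (h : Hom A T) b c → CommutativeRing._≈_ T (Der.d (derT h b) (Hom.f ι c)) (CommutativeRing.0# T)
    der-v : ∀ {T} (h : Hom A T) b → CommutativeRing._≈_ T (Der.d (derT h b) v) b

module PolyGraded (K : CRing) where
  private
    module K = RingTools K
  open PolyRing K
  open Degree K
  private
    module A = RingTools poly
  open Hom (CHom K) using (f-0)

  X* : ∀ p → X ⊗ p ≋ (K.0# ∷ p)
  X* p = ≋-trans (≋-sym (⊕-identityˡ _)) (≋-trans (⊕-cong (≋-sym f-0) ≋-refl) (≋-sym (∷-decomp K.0# p)))

  graded : Graded K poly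
  graded = record
    { ι = CHom K ; v = X ; ca = λ i p → coeff p i ; ca-cong = λ i e → at e i ; ca-+ = λ i a b → coeff-⊕ a b i
    ; ca-ι0 = λ c → K.refl ; ca-ιs = λ i c → K.refl
    ; ca-v0 = λ a → at (X* a) 0 ; ca-vs = λ i a → at (X* a) (suc i)
    ; ca-ι* = λ i c a → K.trans (at (C-⊗ c a) i) (coeff-⊙ c a i)
    ; ca-ext = mk ; finite = λ a → length a , vanish (deg-length a)
    ; horner = split
    ; dg-* = λ {M} {N} {a} {b} x y → vanish (deg-⊗ {M} {N} a {b} (deg x) (deg y))
    ; evalT = λ h t → Evaluation.evHom h t ; eval-ι = λ h t c → Evaluation.ev-C h t c ; eval-v = λ h t → Evaluation.ev-X h t
    ; derT = λ h b → transportDer (same h) (ExtendDer.DDer (h ∘H CHom K) (zeroDer _) (Hom.f h X) b)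
    ; der-ι = λ h b c → ExtendDer.D-C (h ∘H CHom K) (zeroDer _) (Hom.f h X) b c
    ; der-v = λ h b → ExtendDer.D-X (h ∘H CHom K) (zeroDer _) (Hom.f h X) b }
    where
    split : ∀ a → ∃ λ c → ∃ λ a' → a ≋ C c ⊕ X ⊗ a'
    split [] = K.0# , [] , ≋-sym (≋-trans (⊕-cong f-0 (A.zeroʳ X)) (⊕-identityˡ _))
    split (c ∷ a) = c , a , ∷-decomp c a
    same : ∀ {T} (h : Hom poly T) p → CommutativeRing._≈_ T (Evaluation.ev (h ∘H CHom K) (Hom.f h X) p) (Hom.f h p)
    same {T} h [] = CommutativeRing.sym T (Hom.f-0 h)
    same {T} h (a ∷ p) = T.trans (T.+-congˡ (T.*-congˡ (same h p))) (T.trans (T.trans (T.+-congˡ (T.sym (Hom.f-* h X p))) (T.sym (Hom.f-+ h (C a) (X ⊗ p)))) (Hom.f-cong h (≋-sym (∷-decomp a p))))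
      where module T = RingTools T

-- Polynomials in V and S: total degree, derivations, evaluation.

module Bivariate (K A : CRing) (domK : Domain K) (domA : Domain A) (gr : Graded K A) where
  open Graded gr public
  private
    module K = RingTools K
    module A where
      open RingTools A public
      open Domain domA public
    module ι = Hom ι
  open Division A domA public

  Dg : ℕ → A.Carrier → Set
  Dg N a = ∀ i → N ℕ.≤ i → ca i a K.≈ K.0#

  ca-0 : ∀ i → ca i A.0# K.≈ K.0#
  ca-0 i = K.x+x≈x⇒x≈0 _ (K.trans (K.sym (ca-+ i A.0# A.0#)) (ca-cong i (A.+-identityˡ A.0#)))

  ca-neg : ∀ i a → ca i (A.- a) K.≈ K.- ca i a
  ca-neg i a = K.+-cancelʳ (ca i a) _ _ (K.trans (K.sym (ca-+ i (A.- a) a)) (K.trans (ca-cong i (A.-‿inverseˡ a)) (K.trans (ca-0 i) (K.sym (K.-‿inverseˡ _)))))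

  dg-cong : ∀ {N a b} → a A.≈ b → Dg N a → Dg N b
  dg-cong e d i l = K.trans (ca-cong i (A.sym e)) (d i l)

  dg-mono : ∀ {M N a} → M ℕ.≤ N → Dg M a → Dg N a
  dg-mono le d i l = d i (ℕ.≤-trans le l)

  dg-+ : ∀ {N a b} → Dg N a → Dg N b → Dg N (a A.+ b)
  dg-+ d e i l = K.trans (ca-+ i _ _) (K.trans (K.+-cong (d i l) (e i l)) (K.+-identityˡ _))

  dg-neg : ∀ {N a} → Dg N a → Dg N (A.- a)
  dg-neg d i l = K.trans (ca-neg i _) (K.trans (K.-‿cong (d i l)) K.-0#≈0#)

  dg-zero : ∀ {N a} → a A.≈ A.0# → Dg N a
  dg-zero e i l = K.trans (ca-cong i e) (ca-0 i)

  dg-0 : ∀ {a} → Dg 0 a → a A.≈ A.0#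
  dg-0 d = ca-ext λ i → d i z≤n

  dg-ι : ∀ c → Dg 1 (ι.f c)
  dg-ι c (suc i) l = ca-ιs i c

  horner-tail : ∀ {N a c a'} → a A.≈ ι.f c A.+ v A.* a' → Dg (suc N) a → Dg N a'
  horner-tail {N} {a} {c} {a'} e d i l = K.trans (K.sym (K.trans (ca-cong (suc i) e) (K.trans (ca-+ (suc i) _ _) (K.trans (K.+-cong (ca-ιs i c) (ca-vs i a')) (K.+-identityˡ _))))) (d (suc i) (s≤s l))

  horner-induction : (P : ℕ → A.Carrier → Set) → (∀ {N a b} → a A.≈ b → P N a → P N b) → (∀ {N} → P N A.0#) →
    (∀ {N} c a → P N a → P (suc N) (ι.f c A.+ v A.* a)) → ∀ N a → Dg N a → P N a
  horner-induction P P-cong P-0 P-h zero a d = P-cong (A.sym (dg-0 d)) P-0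
  horner-induction P P-cong P-0 P-h (suc N) a d with horner a
  ... | c , a' , e = P-cong (A.sym e) (P-h c a' (horner-induction P P-cong P-0 P-h N a' (horner-tail {N} {a} {c} e d)))

  -- Tot U P: every monomial V^i S^j of P has i + j < U.
  record Tot (U : ℕ) (P : List A.Carrier) : Set where
    constructor tot
    field bound : ∀ j → Dg (U ℕ.∸ j) (coeff P j)
  open Tot public

  tot-cong : ∀ {U P Q} → P ≈ Q → Tot U P → Tot U Q
  tot-cong e t = tot λ j → dg-cong (at e j) (bound t j)

  tot-mono : ∀ {U U' P} → U ℕ.≤ U' → Tot U P → Tot U' P
  tot-mono le t = tot λ j → dg-mono (ℕ.∸-monoˡ-≤ j le) (bound t j)

  tot-+ : ∀ {U P Q} → Tot U P → Tot U Q → Tot U (P + Q)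
  tot-+ {U} {P} {Q} s t = tot λ j → dg-cong (A.sym (coeff-⊕ P Q j)) (dg-+ (bound s j) (bound t j))

  tot-neg : ∀ {U P} → Tot U P → Tot U (- P)
  tot-neg {U} {P} t = tot λ j → dg-cong (A.sym (coeff-⊖ P j)) (dg-neg (bound t j))

  tot-sub : ∀ {U P Q} → Tot U P → Tot U Q → Tot U (P - Q)
  tot-sub s t = tot-+ s (tot-neg t)

  tot-zero : ∀ {U P} → P ≈ 0# → Tot U P
  tot-zero e = tot λ j → dg-zero (at e j)

  tot-0 : ∀ {P} → Tot 0 P → P ≈ 0#
  tot-0 {P} t = mk λ j → dg-0 (≡.subst (λ k → Dg k (coeff P j)) (ℕ.0∸n≡0 j) (bound t j))

  tot-tail : ∀ {U a P} → Tot (suc U) (a ∷ P) → Tot U P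
  tot-tail t = tot λ j → bound t (suc j)

  tot-C : ∀ {U a} → Dg U a → Tot U (C a)
  tot-C d = tot λ { zero → d ; (suc j) → dg-zero A.refl }

  tot-∷ : ∀ {U a P} → Dg (suc U) a → Tot U P → Tot (suc U) (a ∷ P)
  tot-∷ d t = tot λ { zero → d ; (suc j) → bound t j }

  tot-⊙ : ∀ {M N a Q} → Dg M a → Tot (suc N) Q → Tot (M ℕ.+ N) (a ⊙ Q)
  tot-⊙ {M} {N} {a} {Q} da t = tot go
    where
    go : ∀ j → Dg (M ℕ.+ N ℕ.∸ j) (coeff (a ⊙ Q) j)
    go j with j ℕ.≤? N
    ... | yes l = dg-cong (A.sym (coeff-⊙ a Q j)) (≡.subst (λ k → Dg k (a A.* coeff Q j)) (≡.sym (ℕ.+-∸-assoc M l))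
                    (dg-* {M} {N ℕ.∸ j} da (≡.subst (λ k → Dg k (coeff Q j)) (ℕ.+-∸-assoc 1 l) (bound t j))))
    -- The truncated bound `suc N ∸ j` is zero here, so the coefficient itself vanishes.
    ... | no nl = dg-zero (A.trans (coeff-⊙ a Q j) (A.trans (A.*-congˡ (dg-0 (≡.subst (λ k → Dg k (coeff Q j)) (ℕ.m≤n⇒m∸n≡0 (ℕ.≰⇒> nl)) (bound t j)))) (A.zeroʳ a)))

  opaque
    unfolding _⊗_

    ⊗-unfold : ∀ a p q → (a ∷ p) ⊗ q ≋ a ⊙ q ⊕ (A.0# ∷ p ⊗ q)
    ⊗-unfold a p q = ≋-refl

    []-⊗ : ∀ q → [] ⊗ q ≋ []
    []-⊗ q = ≋-refl

  tot-* : ∀ {M N} P {Q} → Tot M P → Tot (suc N) Q → Tot (M ℕ.+ N) (P * Q)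
  tot-* [] {Q} s t = tot-zero ([]-⊗ Q)
  tot-* {zero} (a ∷ P) {Q} s t = tot-zero (trans (*-congʳ (tot-0 s)) (zeroˡ Q))
  tot-* {suc M} {N} (a ∷ P) {Q} s t = tot-cong (sym (⊗-unfold a P Q)) (tot-+ (tot-⊙ (bound s 0) t) (tot-∷ (dg-zero A.refl) (tot-* P (tot-tail s) t)))

  tot-X : Tot 2 X
  tot-X = tot-∷ (dg-zero A.refl) (tot-C dg-1)
    where
    dg-1 : Dg 1 A.1#
    dg-1 = dg-cong ι.f-1 (dg-ι K.1#)

  tot-X* : ∀ {U P} → Tot U P → Tot (suc U) (X * P)
  tot-X* {U} {P} t = tot-cong (*-comm P X) (tot-mono (ℕ.≤-reflexive (ℕ.+-comm U 1)) (tot-* P t tot-X))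

  V : List A.Carrier
  V = C v

  κ : Hom K poly
  κ = CHom A ∘H ι
  module κ = Hom κ

  dg-v* : ∀ {N a} → Dg N a → Dg (suc N) (v A.* a)
  dg-v* d (suc i) (s≤s l) = K.trans (ca-vs i _) (d i l)

  dg-v : Dg 2 v
  dg-v = dg-cong (A.*-identityʳ v) (dg-v* {1} (dg-cong ι.f-1 (dg-ι K.1#)))

  tot-V : Tot 2 V
  tot-V = tot-C dg-v

  tot-κ : ∀ c → Tot 1 (κ.f c)
  tot-κ c = tot-C (dg-ι c)

  module Derivation (dv ds : List A.Carrier) where
    δ : Der (CHom A)
    δ = derT (CHom A) dv

    module Ext = ExtendDer (CHom A) δ X ds

    ∂Der : Der (idHom poly)
    ∂Der = transportDer (ev-id A) Ext.DDer
    open Der ∂Der public renaming (d to ∂)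

    ∂-V : ∂ V ≈ dv
    ∂-V = trans (Ext.D-C v) (der-v (CHom A) dv)

    ∂-X : ∂ X ≈ ds
    ∂-X = Ext.D-X

    ∂-κ : ∀ c → ∂ (κ.f c) ≈ 0#
    ∂-κ c = trans (Ext.D-C (ι.f c)) (der-ι (CHom A) dv c)

    ∂-C : ∀ a → ∂ (C a) ≈ Der.d δ a
    ∂-C a = Ext.D-C a

    ∂-∷ : ∀ a P → ∂ (a ∷ P) ≈ ∂ (C a) + (ds * P + X * ∂ P)
    ∂-∷ a P = +-cong (sym (∂-C a)) (+-congʳ (*-congˡ (ev-id A P)))

    ∂-horner : ∀ c a → ∂ (C (ι.f c A.+ v A.* a)) ≈ dv * C a + V * ∂ (C a)
    ∂-horner c a = begin
      ∂ (C (ι.f c A.+ v A.* a))       ≈⟨ d-cong (trans (C-⊕ _ _) (+-congˡ (C-* v a))) ⟩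
      ∂ (κ.f c + V * C a)             ≈⟨ trans (d-+ _ _) (+-cong (∂-κ c) (d-* V (C a))) ⟩
      0# + (V * ∂ (C a) + C a * ∂ V)  ≈⟨ trans (+-identityˡ _) (trans (+-comm _ _) (+-congʳ (trans (*-congˡ ∂-V) (*-comm _ _)))) ⟩
      dv * C a + V * ∂ (C a) ∎

    module _ {s : ℕ} (tv : Tot (suc s) dv) (ts : Tot (suc s) ds) where
      tot-∂C : ∀ N a → Dg N a → Tot (N ℕ.+ s) (∂ (C a))
      tot-∂C N a d = horner-induction (λ N a → Dg N a → Tot (N ℕ.+ s) (∂ (C a)))
        (λ e f d → tot-cong (d-cong (C-cong e)) (f (dg-cong (A.sym e) d)))
        (λ _ → tot-zero (d-zero C-0))
        (λ {N} c a f d → let da = horner-tail {N} {_} {c} A.refl d in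
           tot-cong (sym (∂-horner c a)) (tot-+ (tot-mono (ℕ.n≤1+n _) (tot-cong (*-comm (C a) dv) (tot-* (C a) (tot-C da) tv)))
             (tot-cong (*-comm (∂ (C a)) V) (tot-mono (ℕ.≤-reflexive (ℕ.+-comm (N ℕ.+ s) 1)) (tot-* (∂ (C a)) (f da) tot-V)))))
        N a d d

      tot-∂ : ∀ U P → Tot U P → Tot (U ℕ.+ s) (∂ P)
      tot-∂ U [] t = tot-zero d-0
      tot-∂ zero (a ∷ P) t = tot-zero (d-zero (tot-0 t))
      tot-∂ (suc U) (a ∷ P) t = tot-cong (sym (∂-∷ a P)) (tot-+ (tot-∂C (suc U) a (bound t 0))
        (tot-+ (tot-mono (ℕ.n≤1+n _) (tot-cong (*-comm P ds) (tot-* P (tot-tail t) ts))) (tot-X* (tot-∂ U P (tot-tail t)))))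

  module ∂V = Derivation 1# 0#
  module ∂S = Derivation 0# 1#

  module _ (dv ds : List A.Carrier) where
    open Derivation dv ds using (∂)
    private module D = Derivation dv ds

    chain-C : ∀ a → ∂ (C a) ≈ dv * ∂V.∂ (C a) + ds * ∂S.∂ (C a)
    chain-C a = horner-induction (λ N a → ∂ (C a) ≈ dv * ∂V.∂ (C a) + ds * ∂S.∂ (C a))
      (λ e f → trans (D.d-cong (C-cong (A.sym e))) (trans f (+-cong (*-congˡ (∂V.d-cong (C-cong e))) (*-congˡ (∂S.d-cong (C-cong e))))))
      (trans (D.d-zero C-0) (sym (trans (+-cong (trans (*-congˡ (∂V.d-zero C-0)) (zeroʳ dv)) (trans (*-congˡ (∂S.d-zero C-0)) (zeroʳ ds))) (+-identityˡ _))))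
      (λ c a f → begin
        ∂ (C (ι.f c A.+ v A.* a)) ≈⟨ trans (D.∂-horner c a) (+-congˡ (*-congˡ f)) ⟩
        dv * C a + V * (dv * ∂V.∂ (C a) + ds * ∂S.∂ (C a))
          ≈⟨ solve 6 (λ dv a v ds x y → dv :* a :+ v :* (dv :* x :+ ds :* y) := dv :* (con (+ 1) :* a :+ v :* x) :+ ds :* (con (+ 0) :* a :+ v :* y)) refl dv (C a) V ds (∂V.∂ (C a)) (∂S.∂ (C a)) ⟩
        dv * (1# * C a + V * ∂V.∂ (C a)) + ds * (0# * C a + V * ∂S.∂ (C a)) ≈⟨ +-cong (*-congˡ (sym (∂V.∂-horner c a))) (*-congˡ (sym (∂S.∂-horner c a))) ⟩
        dv * ∂V.∂ (C (ι.f c A.+ v A.* a)) + ds * ∂S.∂ (C (ι.f c A.+ v A.* a)) ∎)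
      (proj₁ (finite a)) a (proj₂ (finite a))

    -- A derivation over `K` is determined by its values on `V` and `X`. The purpose is that the one
    -- with values `∂S G` and `- ∂V G` annihilates `G`.
    chain : ∀ P → ∂ P ≈ dv * ∂V.∂ P + ds * ∂S.∂ P
    chain [] = trans D.d-0 (sym (trans (+-cong (trans (*-congˡ ∂V.d-0) (zeroʳ dv)) (trans (*-congˡ ∂S.d-0) (zeroʳ ds))) (+-identityˡ _)))
    chain (a ∷ P) = begin
      ∂ (a ∷ P) ≈⟨ trans (D.∂-∷ a P) (+-cong (chain-C a) (+-congˡ (*-congˡ (chain P)))) ⟩
      (dv * ∂V.∂ (C a) + ds * ∂S.∂ (C a)) + (ds * P + X * (dv * ∂V.∂ P + ds * ∂S.∂ P))
        ≈⟨ solve 8 (λ dv ds a b p x c d → (dv :* a :+ ds :* b) :+ (ds :* p :+ x :* (dv :* c :+ ds :* d)) := dv :* (a :+ (con (+ 0) :* p :+ x :* c)) :+ ds :* (b :+ (con (+ 1) :* p :+ x :* d)))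
            refl dv ds (∂V.∂ (C a)) (∂S.∂ (C a)) P X (∂V.∂ P) (∂S.∂ P) ⟩
      dv * (∂V.∂ (C a) + (0# * P + X * ∂V.∂ P)) + ds * (∂S.∂ (C a) + (1# * P + X * ∂S.∂ P)) ≈⟨ +-cong (*-congˡ (sym (∂V.∂-∷ a P))) (*-congˡ (sym (∂S.∂-∷ a P))) ⟩
      dv * ∂V.∂ (a ∷ P) + ds * ∂S.∂ (a ∷ P) ∎

  tot-1 : Tot 1 1#
  tot-1 = tot-cong κ.f-1 (tot-κ K.1#)

  tot-∂V : ∀ U P → Tot U P → Tot U (∂V.∂ P)
  tot-∂V U P t = tot-mono (ℕ.≤-reflexive (ℕ.+-identityʳ U)) (∂V.tot-∂ tot-1 (tot-zero refl) U P t)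

  tot-∂S : ∀ U P → Tot U P → Tot U (∂S.∂ P)
  tot-∂S U P t = tot-mono (ℕ.≤-reflexive (ℕ.+-identityʳ U)) (∂S.tot-∂ (tot-zero refl) tot-1 U P t)

  -- The substitution V ↦ z, S ↦ xz turns the total degree into the degree in z.
  module Homogenise where
    private
      σA : Hom A poly
      σA = evalT κ X
      module σA = Hom σA

    σ : Hom poly poly
    σ = Evaluation.evHom σA (V * X)
    module σ = Hom σ

    shift : ∀ Q → V * X * Q ≈ (A.0# ∷ C v * Q)
    shift Q = trans (*-assoc V X Q) (trans (solve 3 (λ v x q → v :* (x :* q) := x :* (v :* q)) refl V X Q)
      (sym (trans (∷-decomp A.0# (V * Q)) (trans (+-congʳ C-0) (+-identityˡ _)))))

    coeff-σA : ∀ a m → coeff (σA.f a) m A.≈ ι.f (ca m a)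
    coeff-σA a = horner-induction (λ N a → ∀ m → coeff (σA.f a) m A.≈ ι.f (ca m a))
      (λ e f m → A.trans (at (σA.f-cong (A.sym e)) m) (A.trans (f m) (ι.f-cong (ca-cong m e))))
      (λ m → A.trans (at σA.f-0 m) (A.sym (ι.f-zero (ca-0 m))))
      (λ c a f m → A.trans (at (unfold c a) m) (step c a f m))
      (proj₁ (finite a)) a (proj₂ (finite a))
      where
      unfold : ∀ c a → σA.f (ι.f c A.+ v A.* a) ≈ (ι.f c ∷ σA.f a)
      unfold c a = trans (σA.f-+ _ _) (trans (+-cong (eval-ι κ X c) (trans (σA.f-* v a) (*-congʳ (eval-v κ X)))) (sym (∷-decomp (ι.f c) (σA.f a))))
      step : ∀ c a → (∀ m → coeff (σA.f a) m A.≈ ι.f (ca m a)) → ∀ m → coeff (ι.f c ∷ σA.f a) m A.≈ ι.f (ca m (ι.f c A.+ v A.* a))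
      step c a f zero = ι.f-cong (K.sym (K.trans (ca-+ 0 _ _) (K.trans (K.+-cong (ca-ι0 c) (ca-v0 a)) (K.+-identityʳ _))))
      step c a f (suc m) = A.trans (f m) (ι.f-cong (K.sym (K.trans (ca-+ (suc m) _ _) (K.trans (K.+-cong (ca-ιs m c) (ca-vs m a)) (K.+-identityˡ _)))))

    -- The term `V^i S^j` becomes `x^j z^(i+j)`: the power of `z` is the total degree, and the power
    -- of `x` keeps distinct monomials apart. In the target, `X` plays `z` and `V` plays `x`.
    σ-coeff : ∀ P j i → ca j (coeff (σ.f P) (j ℕ.+ i)) K.≈ ca i (coeff P j)
    σ-coeff [] j i = K.trans (ca-0 j) (K.sym (ca-0 i))
    σ-coeff (a ∷ P) j i = K.trans (ca-cong j (A.trans (coeff-⊕ (σA.f a) _ (j ℕ.+ i)) (A.+-cong (coeff-σA a (j ℕ.+ i)) (at (shift (σ.f P)) (j ℕ.+ i))))) (K.trans (ca-+ j _ _) (go j))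
      where
      go : ∀ j → ca j (ι.f (ca (j ℕ.+ i) a)) K.+ ca j (coeff (A.0# ∷ C v * σ.f P) (j ℕ.+ i)) K.≈ ca i (coeff (a ∷ P) j)
      go zero = K.trans (K.+-cong (ca-ι0 _) (zero-part i)) (K.+-identityʳ _)
        where
        zero-part : ∀ i → ca 0 (coeff (A.0# ∷ C v * σ.f P) i) K.≈ K.0#
        zero-part zero = ca-0 0
        zero-part (suc i) = K.trans (ca-cong 0 (coeff-C* v (σ.f P) i)) (ca-v0 _)
      go (suc j) = K.trans (K.+-cong (ca-ιs j _) (K.trans (ca-cong (suc j) (coeff-C* v (σ.f P) (j ℕ.+ i))) (K.trans (ca-vs j _) (σ-coeff P j i)))) (K.+-identityˡ _)

    σ-coeff< : ∀ P j m → m ℕ.< j → ca j (coeff (σ.f P) m) K.≈ K.0#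
    σ-coeff< [] j m l = ca-0 j
    σ-coeff< (a ∷ P) (suc j) m l = K.trans (ca-cong (suc j) (A.trans (coeff-⊕ (σA.f a) _ m) (A.+-cong (coeff-σA a m) (at (shift (σ.f P)) m)))) (K.trans (ca-+ (suc j) _ _)
      (K.trans (K.+-cong (ca-ιs j _) (go m l)) (K.+-identityˡ _)))
      where
      go : ∀ m → m ℕ.< suc j → ca (suc j) (coeff (A.0# ∷ C v * σ.f P) m) K.≈ K.0#
      go zero l = ca-0 (suc j)
      go (suc m) (s≤s l) = K.trans (ca-cong (suc j) (coeff-C* v (σ.f P) m)) (K.trans (ca-vs j _) (σ-coeff< P j m l))

    tot⇒deg : ∀ {U P} → Tot U P → Deg U (σ.f P)
    tot⇒deg {U} {P} t = deg λ m l → ca-ext λ j → go m l j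
      where
      go : ∀ m → U ℕ.≤ m → ∀ j → ca j (coeff (σ.f P) m) K.≈ K.0#
      go m l j with j ℕ.≤? m
      ... | yes le = K.trans (K.reflexive (≡.cong (λ k → ca j (coeff (σ.f P) k)) (≡.sym (ℕ.m+[n∸m]≡n le)))) (K.trans (σ-coeff P j (m ℕ.∸ j)) (bound t j (m ℕ.∸ j) (ℕ.∸-monoˡ-≤ j l)))
      ... | no nle = σ-coeff< P j m (ℕ.≰⇒> nle)

    deg⇒tot : ∀ {U P} → Deg U (σ.f P) → Tot U P
    deg⇒tot {U} {P} d = tot λ j i l → K.trans (K.sym (σ-coeff P j i)) (K.trans (ca-cong j (vanish d (j ℕ.+ i) (ℕ.≤-trans (ℕ.m≤n+m∸n U j) (ℕ.+-monoʳ-≤ j l)))) (ca-0 j))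

    top-σ : ∀ {a P} → Monic a P → ¬ coeff (σ.f P) (a ℕ.+ 0) A.≈ A.0#
    top-σ {a} {P} mP z = Domain.1≉0 domK (K.trans (K.sym (K.trans (ca-cong 0 (proj₂ mP)) (K.trans (ca-cong 0 (A.sym ι.f-1)) (ca-ι0 K.1#))))
      (K.trans (K.sym (σ-coeff P a 0)) (K.trans (ca-cong a z) (ca-0 a))))

    at-least : ∀ {a P m} → Monic a P → Lead m (σ.f P) → a ℕ.≤ m
    at-least {a} {P} {m} mP lm = ℕ.≮⇒≥ λ lt → top-σ mP (vanish (proj₁ lm) (a ℕ.+ 0) (ℕ.≤-trans lt (ℕ.≤-reflexive (≡.sym (ℕ.+-identityʳ a)))))

    -- The degrees of σ P and σ Q add up to at most a + b, and are at least a and b because P and Q are monic.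
    tot-factor : ∀ {a b P Q} → Monic a P → Monic b Q → Tot (suc (a ℕ.+ b)) (P * Q) → Tot (suc a) P
    tot-factor {a} {b} {P} {Q} mP mQ t with lead? (σ.f P) | lead? (σ.f Q)
    ... | inj₁ z | _ = ⊥-elim (top-σ mP (at z _))
    ... | inj₂ _ | inj₁ z = ⊥-elim (top-σ mQ (at z _))
    ... | inj₂ (m , lm) | inj₂ (n , ln) = deg⇒tot (deg-mono (s≤s m≤a) (proj₁ lm))
      where
      m+n≤ : m ℕ.+ n ℕ.≤ a ℕ.+ b
      m+n≤ = ℕ.≤-pred (lead-deg (lead-cong (sym (σ.f-* P Q)) (lead-* lm ln)) (tot⇒deg t))
      m≤a : m ℕ.≤ a
      m≤a = ℕ.+-cancelʳ-≤ n m a (ℕ.≤-trans m+n≤ (ℕ.+-monoʳ-≤ a (at-least mQ ln)))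

  module EvalAt (v₀ s₀ : K.Carrier) where
    evA : Hom A K
    evA = evalT (idHom K) v₀
    evB : Hom poly K
    evB = Evaluation.evHom evA s₀
    open Hom evB using (f)

    ev-X : f X K.≈ s₀
    ev-X = Evaluation.ev-X evA s₀
    ev-V : f V K.≈ v₀
    ev-V = K.trans (Evaluation.ev-C evA s₀ v) (eval-v (idHom K) v₀)
    ev-κ : ∀ c → f (κ.f c) K.≈ c
    ev-κ c = K.trans (Evaluation.ev-C evA s₀ (ι.f c)) (eval-ι (idHom K) v₀ c)

-- The coordinate ring of a plane curve monic in S.

idx-∈ : ∀ d U i j → j ℕ.< d → i ℕ.+ j ℕ.≤ U → (i , j) ∈ idx d U
idx-∈ (suc d) zero zero zero _ _ = here ≡.refl
idx-∈ (suc d) zero zero (suc j) _ ()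
idx-∈ (suc d) (suc U) i zero _ le = ∈-++⁺ˡ (∈-map⁺ (λ i → i , 0) (∈-upTo⁺ (s≤s (ℕ.≤-trans (ℕ.≤-reflexive (≡.sym (ℕ.+-identityʳ i))) le))))
idx-∈ (suc d) (suc U) i (suc j) (s≤s lt) le = ∈-++⁺ʳ (map (λ i → i , 0) (upTo (2 ℕ.+ U))) (∈-map⁺ (λ ij → proj₁ ij , suc (proj₂ ij))
  (idx-∈ d U i j lt (ℕ.≤-pred (ℕ.≤-trans (ℕ.≤-reflexive (≡.sym (ℕ.+-suc i j))) le))))

idx-< : ∀ d U → All (λ ij → proj₂ ij ℕ.< d) (idx d U)
idx-< zero U = []
idx-< (suc d) zero = s≤s z≤n ∷ []
idx-< (suc d) (suc U) = All.++⁺ (All.map⁺ (All.universal (λ _ → s≤s z≤n) (upTo (2 ℕ.+ U)))) (All.map⁺ (All.map s≤s (idx-< d U)))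

idx-unique : ∀ d U → AllPairs (λ x y → ¬ x ≡ y) (idx d U)
idx-unique zero U = []
idx-unique (suc d) zero = [] ∷ []
idx-unique (suc d) (suc U) = Unique.++⁺ (Unique.map⁺ (λ { ≡.refl → ≡.refl }) (Unique.upTo⁺ (2 ℕ.+ U)))
  (Unique.map⁺ (λ { {_ , _} {_ , _} ≡.refl → ≡.refl }) (idx-unique d U)) disjoint
  where
  disjoint : ∀ {x} → x ∈ map (λ i → i , 0) (upTo (2 ℕ.+ U)) × x ∈ map (λ ij → proj₁ ij , suc (proj₂ ij)) (idx d U) → ⊥
  disjoint (a , b) with ∈-map⁻ (λ i → i , 0) a | ∈-map⁻ (λ ij → proj₁ ij , suc (proj₂ ij)) b
  ... | _ , _ , ≡.refl | _ , _ , ()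

lookup-injective : ∀ {X : Set} {xs : List X} → AllPairs (λ x y → ¬ x ≡ y) xs → ∀ i j → lookup xs i ≡ lookup xs j → i ≡ j
lookup-injective (_ ∷ _) zero zero e = ≡.refl
lookup-injective (a ∷ _) zero (suc j) e = ⊥-elim (All.lookup a (∈-lookup j) e)
lookup-injective (a ∷ _) (suc i) zero e = ⊥-elim (All.lookup a (∈-lookup i) (≡.sym e))
lookup-injective (_ ∷ u) (suc i) (suc j) e = ≡.cong suc (lookup-injective u i j e)

module PlaneCurve (K A : CRing) (domK : Domain K) (domA : Domain A) (gr : Graded K A)
  (p : ℕ) (p·1 : CommutativeRing._≈_ K (RingTools._·_ K p (CommutativeRing.1# K)) (CommutativeRing.0# K))
  (fermat : ∀ c → CommutativeRing._≈_ K (RingTools._^_ K c p) c)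
  (small : ∀ i → 0 ℕ.< i → i ℕ.< p → ¬ CommutativeRing._≈_ K (RingTools._·_ K i (CommutativeRing.1# K)) (CommutativeRing.0# K))
  (e : ℕ) (G : List (Car A)) (mG : Division.Monic A domA (suc e) G) (tG : Bivariate.Tot K A domK domA gr (suc (suc e)) G)
  (domR : Domain (Quotient.quotient (PolyRing.poly A) G)) where
  open Bivariate K A domK domA gr
  private
    module K = RingTools K
    module dK = Domain domK
    module A where
      open RingTools A public
      open Domain domA public
    module ι = Hom ι
  R : CRing
  R = Quotient.quotient (PolyRing.poly A) G
  open Quotient (PolyRing.poly A) G
  private
    module R = RingTools R
    lG = monic⇒lead mG

  -- Horner's scheme: multiplying a remainder by `X` may raise its degree to `e + 1`, which one
  -- multiple of `G` repairs. Total degrees can be followed through this recursion.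
  rem : List A.Carrier → List A.Carrier
  rem [] = 0#
  rem (a ∷ P) = C a + X * rem P - C (coeff (rem P) e) * G

  X*≈ : ∀ P → X * P ≈ (A.0# ∷ P)
  X*≈ = PolyGraded.X* A

  deg-X* : ∀ {N P} → Deg N P → Deg (suc N) (X * P)
  deg-X* d = deg-cong (sym (X*≈ _)) (deg-∷ d)

  rem-deg : ∀ P → Deg (suc e) (rem P)
  rem-deg [] = deg-[]
  rem-deg (a ∷ P) = deg-pred (deg-sub (deg-⊕ (deg-mono (s≤s z≤n) deg-C) (deg-X* (rem-deg P))) (deg-C* _ (proj₁ mG)))
    (A.trans (coeff-sub (C a + X * rem P) (C (coeff (rem P) e) * G) (suc e)) (A.trans (A.+-cong
      (A.trans (coeff-⊕ (C a) (X * rem P) (suc e)) (A.trans (A.+-identityˡ _) (at (X*≈ (rem P)) (suc e))))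
      (A.-‿cong (A.trans (coeff-C* _ G (suc e)) (A.trans (A.*-congˡ (proj₂ mG)) (A.*-identityʳ _))))) (A.-‿inverseʳ _)))

  rem-≃ : ∀ P → P ≃ rem P
  rem-≃ [] = ≈⇒≃ refl
  rem-≃ (a ∷ P) = ≃-trans (≈⇒≃ (∷-decomp a P)) (≃-trans (+-cong' (≈⇒≃ refl) (*-cong' (≈⇒≃ refl) (rem-≃ P)))
    (quo (C (coeff (rem P) e)) (solve 3 (λ x c g → x :- (x :- c :* g) := g :* c) refl (C a + X * rem P) (C (coeff (rem P) e)) G)))

  small-zero : ∀ {r} → Deg (suc e) r → r ≃ 0# → r ≈ 0#
  small-zero {r} dr z with ≃0⇒∣ z
  ... | div q e = trans e (trans (*-congˡ (multiple-small lG q (deg-cong e dr))) (zeroʳ G))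

  unique : ∀ {r s} → Deg (suc e) r → Deg (suc e) s → r ≃ s → r ≈ s
  unique dr ds z = x-y≈0 (small-zero (deg-sub dr ds) (≃-trans (+-cong' z (≈⇒≃ refl)) (≈⇒≃ (-‿inverseʳ _))))

  rem-cong : ∀ {P Q} → P ≃ Q → rem P ≈ rem Q
  rem-cong {P} {Q} z = unique (rem-deg P) (rem-deg Q) (≃-trans (≃-sym (rem-≃ P)) (≃-trans z (rem-≃ Q)))

  rem-+ : ∀ P Q → rem (P + Q) ≈ rem P + rem Q
  rem-+ P Q = unique (rem-deg (P + Q)) (deg-⊕ (rem-deg P) (rem-deg Q)) (≃-trans (≃-sym (rem-≃ (P + Q))) (+-cong' (rem-≃ P) (rem-≃ Q)))

  rem-C* : ∀ c P → rem (C c * P) ≈ C c * rem P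
  rem-C* c P = unique (rem-deg (C c * P)) (deg-C* c (rem-deg P)) (≃-trans (≃-sym (rem-≃ (C c * P))) (*-cong' (≈⇒≃ refl) (rem-≃ P)))

  rem-id : ∀ {P} → Deg (suc e) P → rem P ≈ P
  rem-id {P} d = unique (rem-deg P) d (≃-sym (rem-≃ P))

  -- `G` is monic of degree `e + 1` in `S` and its total degree is no larger, so the multiple of `G`
  -- that is subtracted respects the bound of the term it corrects.
  rem-tot : ∀ U P → Tot U P → Tot U (rem P)
  rem-tot U [] t = tot-zero refl
  rem-tot zero (a ∷ P) t = tot-zero (rem-cong (≈⇒≃ (tot-0 t)))
  rem-tot (suc U) (a ∷ P) t = tot-sub (tot-+ (tot-C (bound t 0)) (tot-X* tr)) last
    where
    r = rem P
    tr : Tot U r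
    tr = rem-tot U P (tot-tail t)
    last : Tot (suc U) (C (coeff r e) * G)
    last with e ℕ.≤? U
    ... | yes le = tot-mono (ℕ.≤-reflexive (≡.trans (ℕ.+-suc _ e) (≡.cong suc (ℕ.m∸n+n≡m le)))) (tot-* (C (coeff r e)) (tot-C (bound tr e)) tG)
    ... | no nle = tot-zero (trans (*-congʳ (C-zero (dg-0 (≡.subst (λ k → Dg k (coeff r e)) (ℕ.m≤n⇒m∸n≡0 (ℕ.<⇒≤ (ℕ.≰⇒> nle))) (bound tr e))))) (zeroˡ G))

  coord : ℕ × ℕ → List A.Carrier → K.Carrier
  coord (i , j) P = ca i (coeff (rem P) j)

  coord-cong : ∀ ij {P Q} → P ≃ Q → coord ij P K.≈ coord ij Q
  coord-cong (i , j) z = ca-cong i (at (rem-cong z) j)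

  coord-+ : ∀ ij P Q → coord ij (P + Q) K.≈ coord ij P K.+ coord ij Q
  coord-+ (i , j) P Q = K.trans (ca-cong i (A.trans (at (rem-+ P Q) j) (coeff-⊕ (rem P) (rem Q) j))) (ca-+ i _ _)

  coord-κ : ∀ ij c P → coord ij (κ.f c * P) K.≈ c K.* coord ij P
  coord-κ (i , j) c P = K.trans (ca-cong i (A.trans (at (rem-C* (ι.f c) P) j) (coeff-C* (ι.f c) (rem P) j))) (ca-ι* i c _)

  -- `Tot` is strict, so `suc U` expresses degree at most `U`; the degree of a class is that of its
  -- best representative.
  Fil : ℕ → List A.Carrier → Set
  Fil U x = ∃ λ P → x ≃ P × Tot (suc U) P

  complete : ∀ {U x} → Fil U x → All (λ ij → coord ij x K.≈ K.0#) (idx (suc e) U) → x ≃ 0#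
  complete {U} {x} (P , z , t) a = ≃-trans (rem-≃ x) (≈⇒≃ (mk λ j → ca-ext λ i → go i j))
    where
    tr : Tot (suc U) (rem x)
    tr = tot-cong (rem-cong (≃-sym z)) (rem-tot (suc U) P t)
    go : ∀ i j → ca i (coeff (rem x) j) K.≈ K.0#
    go i j with j ℕ.<? suc e | (i ℕ.+ j) ℕ.≤? U
    ... | no nlt | _ = K.trans (ca-cong i (vanish (rem-deg x) j (ℕ.≮⇒≥ nlt))) (ca-0 i)
    ... | yes lt | yes le = All.lookup a (idx-∈ (suc e) U i j lt le)
    ... | yes lt | no nle = bound tr j i (ℕ.≤-trans (ℕ.∸-monoˡ-≤ j (ℕ.≰⇒> nle)) (ℕ.≤-reflexive (ℕ.m+n∸n≡m i j)))

  coeff-X^-diag : ∀ k → coeff (X ^ k) k A.≈ A.1#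
  coeff-X^-diag k = proj₂ (monic-X^ k)

  coeff-X^-off : ∀ k i → ¬ i ≡ k → coeff (X ^ k) i A.≈ A.0#
  coeff-X^-off zero zero ne = ⊥-elim (ne ≡.refl)
  coeff-X^-off zero (suc i) ne = A.refl
  coeff-X^-off (suc k) zero ne = at (X*≈ (X ^ k)) 0
  coeff-X^-off (suc k) (suc i) ne = A.trans (at (X*≈ (X ^ k)) (suc i)) (coeff-X^-off k i λ { ≡.refl → ne ≡.refl })

  ca-v^-diag : ∀ k → ca k (v A.^ k) K.≈ K.1#
  ca-v^-diag zero = K.trans (ca-cong 0 (A.sym ι.f-1)) (ca-ι0 K.1#)
  ca-v^-diag (suc k) = K.trans (ca-vs k _) (ca-v^-diag k)

  ca-v^-off : ∀ k i → ¬ i ≡ k → ca i (v A.^ k) K.≈ K.0#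
  ca-v^-off zero zero ne = ⊥-elim (ne ≡.refl)
  ca-v^-off zero (suc i) ne = K.trans (ca-cong (suc i) (A.sym ι.f-1)) (ca-ιs i K.1#)
  ca-v^-off (suc k) zero ne = ca-v0 _
  ca-v^-off (suc k) (suc i) ne = K.trans (ca-vs i _) (ca-v^-off k i λ { ≡.refl → ne ≡.refl })

  monR : ℕ × ℕ → List A.Carrier
  monR (i , j) = V R.^ i R.* X R.^ j

  mon≃ : ∀ i j → monR (i , j) ≃ C (v A.^ i) * X ^ j
  mon≃ i j = *-cong' (≃-sym (≃-trans (≈⇒≃ (C-^ v i)) (Hom.f-^ quotHom V i))) (≃-sym (Hom.f-^ quotHom X j))

  rem-mon : ∀ i j → j ℕ.< suc e → ∀ k → coeff (rem (monR (i , j))) k A.≈ v A.^ i A.* coeff (X ^ j) k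
  rem-mon i j lt k = A.trans (at (trans (rem-cong (mon≃ i j)) (rem-id (deg-C* (v A.^ i) (deg-mono lt (proj₁ (monic-X^ j)))))) k) (coeff-C* (v A.^ i) (X ^ j) k)

  coord-diag : ∀ i j → j ℕ.< suc e → coord (i , j) (monR (i , j)) K.≈ K.1#
  coord-diag i j lt = K.trans (ca-cong i (A.trans (rem-mon i j lt j) (A.trans (A.*-congˡ (coeff-X^-diag j)) (A.*-identityʳ _)))) (ca-v^-diag i)

  coord-off : ∀ i j i' j' → j' ℕ.< suc e → ¬ (i , j) ≡ (i' , j') → coord (i , j) (monR (i' , j')) K.≈ K.0#
  coord-off i j i' j' lt ne with j ℕ.≟ j'
  ... | no nj = K.trans (ca-cong i (A.trans (rem-mon i' j' lt j) (A.trans (A.*-congˡ (coeff-X^-off j' j nj)) (A.zeroʳ _)))) (ca-0 i)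
  ... | yes ≡.refl = K.trans (ca-cong i (A.trans (rem-mon i' j lt j) (A.trans (A.*-congˡ (coeff-X^-diag j)) (A.*-identityʳ _)))) (ca-v^-off i' i λ { ≡.refl → ne ≡.refl })

  private
    module SR = Sums R
    module SK = Sums K

  coord-sum : ∀ ij {n} (α : Fin n → K.Carrier) (y : Fin n → List A.Carrier) →
    coord ij (SR.sum (λ l → κ.f (α l) R.* y l)) K.≈ SK.sum (λ l → α l K.* coord ij (y l))
  coord-sum ij {zero} α y = K.trans (coord-cong ij SR.sum-zero) (K.trans (K.trans (ca-cong (proj₁ ij) A.refl) (ca-0 (proj₁ ij))) (K.sym SK.sum-zero))
  coord-sum ij {suc n} α y = K.trans (coord-cong ij (SR.sum-suc _)) (K.trans (coord-+ ij _ _)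
    (K.trans (K.+-cong (coord-κ ij (α zero) (y zero)) (coord-sum ij (α ∘ suc) (y ∘ suc))) (K.sym (SK.sum-suc _))))

  -- The functionals `coord` are dual to the monomials of `idx`, so each of them isolates one
  -- coefficient of the relation.
  independent : ∀ U (α : Fin (length (idx (suc e) U)) → K.Carrier) →
    SR.sum (λ l → κ.f (α l) R.* monR (lookup (idx (suc e) U) l)) ≃ 0# → ∀ l → α l K.≈ K.0#
  independent U α z l = K.trans (K.sym (K.trans (SK.sum-single _ l off) on)) (K.trans (K.sym (coord-sum ij α _)) (K.trans (coord-cong ij z) (K.trans (ca-cong (proj₁ ij) A.refl) (ca-0 (proj₁ ij)))))
    where
    ij = lookup (idx (suc e) U) l
    lt : ∀ k → proj₂ (lookup (idx (suc e) U) k) ℕ.< suc e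
    lt k = All.lookup (idx-< (suc e) U) (∈-lookup k)
    on : α l K.* coord ij (monR ij) K.≈ α l
    on = K.trans (K.*-congˡ (coord-diag (proj₁ ij) (proj₂ ij) (lt l))) (K.*-identityʳ _)
    off : ∀ k → ¬ k ≡ l → α k K.* coord ij (monR (lookup (idx (suc e) U) k)) K.≈ K.0#
    off k ne = K.trans (K.*-congˡ (coord-off (proj₁ ij) (proj₂ ij) _ _ (lt k) λ q → ne (lookup-injective (idx-unique (suc e) U) k l (≡.sym q)))) (K.zeroʳ _)

  GS GV : List A.Carrier
  GS = ∂S.∂ G
  GV = ∂V.∂ G

  -- The tangent direction: it annihilates `G` and therefore descends to the quotient.
  module D = Derivation GS (- GV)

  ∂G≈0 : D.∂ G ≈ 0#
  ∂G≈0 = trans (chain GS (- GV) G) (solve 2 (λ s v → s :* v :+ (:- v) :* s := con (+ 0)) refl GS GV)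

  ∂-≃ : ∀ {x y} → x ≃ y → D.∂ x ≃ D.∂ y
  ∂-≃ {x} {y} (quo q eq) = quo (D.∂ q) (trans (sym (D.d-sub x y)) (trans (D.d-cong eq) (trans (D.d-* G q) (trans (+-congˡ (trans (*-congˡ ∂G≈0) (zeroʳ q))) (+-identityʳ _)))))

  derR : Der (idHom R)
  derR = record { d = D.∂ ; d-cong = ∂-≃ ; d-+ = λ x y → ≈⇒≃ (D.d-+ x y) ; d-* = λ x y → ≈⇒≃ (D.d-* x y) }

  tot-GS : Tot (suc (suc e)) GS
  tot-GS = tot-∂S _ G tG

  tot-GV : Tot (suc (suc e)) GV
  tot-GV = tot-∂V _ G tG

  curve : Curve K R
  curve = record
    { domK = domK ; domR = domR ; ι = quotHom ∘H κ ; der = derR ; d-ι = λ c → ≈⇒≃ (D.∂-κ c) ; V = V ; S = X ; e = e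
    ; Fil = Fil
    ; fil-cong = λ { z (P , w , t) → P , ≃-trans (≃-sym z) w , t }
    ; fil-mono = λ { le (P , w , t) → P , w , tot-mono (s≤s le) t }
    ; fil-+ = λ { (P , w , t) (Q , w' , t') → P + Q , +-cong' w w' , tot-+ t t' }
    ; fil-* = λ { (P , w , t) (Q , w' , t') → P * Q , *-cong' w w' , tot-* P t t' }
    ; fil-ι = λ c → κ.f c , ≈⇒≃ refl , tot-κ c
    ; fil-V = V , ≈⇒≃ refl , tot-V
    ; fil-S = X , ≈⇒≃ refl , tot-X
    ; fil-d = λ { {U} (P , w , t) → D.∂ P , ∂-≃ w , D.tot-∂ tot-GS (tot-neg tot-GV) (suc U) P t }
    ; coord = coord ; coord-cong = coord-cong ; coord-+ = coord-+ ; coord-ι = coord-κ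
    ; complete = complete ; independent = independent
    ; p = p ; p·1 = ≃-trans (≃-sym (Hom.f-· (quotHom ∘H κ) p)) (Hom.f-zero (quotHom ∘H κ) p·1)
    ; fermat = fermat ; small = small }

  module Evaluate (v₀ s₀ : K.Carrier) where
    open EvalAt v₀ s₀ public
    open Hom evB

    module _ (on : f G K.≈ K.0#) (smooth : ¬ f GV K.≈ K.0#) where
      evR : Hom R K
      evR = record { f = f ; f-cong = λ { {x} {y} (quo q eq) → dK.x-y≈0 (K.trans (K.sym (f-sub x y)) (K.trans (f-cong eq) (K.trans (f-* G q) (K.trans (K.*-congʳ on) (K.zeroˡ _))))) }
        ; f-+ = f-+ ; f-* = f-* ; f-1 = f-1 }

      point : OnCurve.Point curve
      point = record { at = evR ; at-ι = ev-κ ; smooth = λ z → smooth (K.trans (K.sym (K.trans (K.-‿cong (K.trans (f-cong D.∂-X) (f-neg GV))) (K.-‿involutive _))) (K.trans (K.-‿cong z) K.-0#≈0#)) }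

-- The Wronskian argument of Voloch and Brownawell-Masser for y₁ⁿ - y₂ⁿ = y₃ⁿ - y₄ⁿ with y₁ = S+1, y₂ = S, y₃ = V+1, y₄ = V.
module Wronskian (R : CRing) (dom : Domain R) (der : Der (idHom R)) (V S : Car R) (N : ℕ) where
  open RingTools R
  open Domain dom
  open Der der

  a b a' b' m y₁ y₃ : Carrier
  a = d S
  b = d V
  a' = d a
  b' = d b
  m = suc N · 1#
  y₁ = S + 1#
  y₃ = V + 1#

  -- The determinant with columns `(y², w y, m w² + w' y)`, where `w` is the derivative of the
  -- entry, for `y₁`, `S` and `y`; it is expanded along the last column and simplified by
  -- `y₁ - S = 1`. Here `y` is `y₃` or `V`, both with derivative `b`.
  W : Carrier → Carrier
  W y = m * (a * a * a) * (y * y) - (m * (a * a) * (y₁ + S) + a' * (y₁ * S)) * b * y + a * (y₁ * S) * (m * (b * b) + b' * y)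

  d-+1 : ∀ x → d (x + 1#) ≈ d x
  d-+1 x = trans (d-+ x 1#) (trans (+-congˡ d-1) (+-identityʳ _))

  pow : ∀ k y w → d y ≈ w → d (y ^ suc k) ≈ (suc k · 1#) * (y ^ k * w)
  pow k y w e = trans (d-^ y k) (trans (*-assoc _ _ _) (*-congˡ (*-congˡ e)))

  module Relations (n≉0 : ¬ suc (suc N) · 1# ≈ 0#)
    (rel : (y₁ ^ suc (suc N) - S ^ suc (suc N)) - (y₃ ^ suc (suc N) - V ^ suc (suc N)) ≈ 0#) where

    z₁ z₂ z₃ z₄ : Carrier
    z₁ = y₁ ^ N
    z₂ = S ^ N
    z₃ = y₃ ^ N
    z₄ = V ^ N

    -- With `E₁` and `E₂` these are the relation and its first two derivatives, seen as linear
    -- equations in the `N`-th powers `z₁, ..., z₄`. The exponent `N + 2` leaves these powers after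
    -- two differentiations.
    E₀ : (y₁ * y₁ * z₁ - S * S * z₂) - (y₃ * y₃ * z₃ - V * V * z₄) ≈ 0#
    E₀ = trans (+-cong (+-cong (*-assoc _ _ _) (-‿cong (*-assoc _ _ _))) (-‿cong (+-cong (*-assoc _ _ _) (-‿cong (*-assoc _ _ _))))) rel

    rel₁ : (y₁ ^ suc N * a - S ^ suc N * a) - (y₃ ^ suc N * b - V ^ suc N * b) ≈ 0#
    rel₁ = cancel0 n≉0 (begin
      n * ((y₁ ^ suc N * a - S ^ suc N * a) - (y₃ ^ suc N * b - V ^ suc N * b))
        ≈⟨ solve 5 (λ n p q r s → n :* ((p :- q) :- (r :- s)) := (n :* p :- n :* q) :- (n :* r :- n :* s)) refl n _ _ _ _ ⟩
      (n * (y₁ ^ suc N * a) - n * (S ^ suc N * a)) - (n * (y₃ ^ suc N * b) - n * (V ^ suc N * b))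
        ≈⟨ +-cong (+-cong (sym (pow (suc N) y₁ a (d-+1 S))) (-‿cong (sym (pow (suc N) S a refl)))) (-‿cong (+-cong (sym (pow (suc N) y₃ b (d-+1 V))) (-‿cong (sym (pow (suc N) V b refl))))) ⟩
      (d (y₁ ^ suc (suc N)) - d (S ^ suc (suc N))) - (d (y₃ ^ suc (suc N)) - d (V ^ suc (suc N)))
        ≈⟨ sym (trans (d-sub _ _) (+-cong (d-sub _ _) (-‿cong (d-sub _ _)))) ⟩
      d ((y₁ ^ suc (suc N) - S ^ suc (suc N)) - (y₃ ^ suc (suc N) - V ^ suc (suc N))) ≈⟨ d-zero rel ⟩
      0# ∎)
      where n = suc (suc N) · 1#

    E₁ : (a * y₁ * z₁ - a * S * z₂) - (b * y₃ * z₃ - b * V * z₄) ≈ 0#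
    E₁ = trans (+-cong (+-cong (sw a y₁ z₁) (-‿cong (sw a S z₂))) (-‿cong (+-cong (sw b y₃ z₃) (-‿cong (sw b V z₄))))) rel₁
      where
      sw : ∀ a y z → a * y * z ≈ (y * z) * a
      sw = solve 3 (λ a y z → a :* y :* z := (y :* z) :* a) refl

    d-term : ∀ y w w' → d y ≈ w → d w ≈ w' → d (y ^ suc N * w) ≈ (m * (w * w) + w' * y) * y ^ N
    d-term y w w' e e' = trans (d-* _ _) (trans (+-cong (*-congˡ e') (*-congˡ (pow N y w e)))
      (solve 5 (λ y z w w' m → (y :* z) :* w' :+ w :* (m :* (z :* w)) := (m :* (w :* w) :+ w' :* y) :* z) refl y (y ^ N) w w' m))

    E₂ : ((m * (a * a) + a' * y₁) * z₁ - (m * (a * a) + a' * S) * z₂) - ((m * (b * b) + b' * y₃) * z₃ - (m * (b * b) + b' * V) * z₄) ≈ 0#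
    E₂ = trans (sym (trans (d-sub _ _) (+-cong (trans (d-sub _ _) (+-cong (d-term y₁ a a' (d-+1 S) refl) (-‿cong (d-term S a a' refl refl))))
        (-‿cong (trans (d-sub _ _) (+-cong (d-term y₃ b b' (d-+1 V) refl) (-‿cong (d-term V b b' refl refl)))))))) (d-zero rel₁)

    private
      n₁ n₂ n₃ : Carrier
      n₁ = m * (a * a * a)
      n₂ = m * (a * a) * (y₁ + S) + a' * (y₁ * S)
      n₃ = a * (y₁ * S)

      eliminate : ∀ n₁ n₂ n₃ p₁ p₂ p₃ p₄ q₁ q₂ q₃ q₄ r₁ r₂ r₃ r₄ →
        n₁ * ((p₁ - p₂) - (p₃ - p₄)) - n₂ * ((q₁ - q₂) - (q₃ - q₄)) + n₃ * ((r₁ - r₂) - (r₃ - r₄)) ≈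
        ((n₁ * p₁ - n₂ * q₁ + n₃ * r₁) - (n₁ * p₂ - n₂ * q₂ + n₃ * r₂)) - ((n₁ * p₃ - n₂ * q₃ + n₃ * r₃) - (n₁ * p₄ - n₂ * q₄ + n₃ * r₄))
      eliminate n₁ n₂ n₃ p₁ p₂ p₃ p₄ q₁ q₂ q₃ q₄ r₁ r₂ r₃ r₄ = trans (+-cong (+-cong (dist n₁ p₁ p₂ p₃ p₄) (-‿cong (dist n₂ q₁ q₂ q₃ q₄))) (dist n₃ r₁ r₂ r₃ r₄))
        (trans (+-congʳ (regroup _ _ _ _ _ _ _ _)) (regroup' _ _ _ _ _ _ _ _))
        where
        dist : ∀ n p q r s → n * ((p - q) - (r - s)) ≈ (n * p - n * q) - (n * r - n * s)
        dist = solve 5 (λ n p q r s → n :* ((p :- q) :- (r :- s)) := (n :* p :- n :* q) :- (n :* r :- n :* s)) refl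
        regroup : ∀ p q r s p' q' r' s' → ((p - q) - (r - s)) - ((p' - q') - (r' - s')) ≈ ((p - p') - (q - q')) - ((r - r') - (s - s'))
        regroup = solve 8 (λ p q r s p' q' r' s' → ((p :- q) :- (r :- s)) :- ((p' :- q') :- (r' :- s')) := ((p :- p') :- (q :- q')) :- ((r :- r') :- (s :- s'))) refl
        regroup' : ∀ p q r s p' q' r' s' → ((p - q) - (r - s)) + ((p' - q') - (r' - s')) ≈ ((p + p') - (q + q')) - ((r + r') - (s + s'))
        regroup' = solve 8 (λ p q r s p' q' r' s' → ((p :- q) :- (r :- s)) :+ ((p' :- q') :- (r' :- s')) := ((p :+ p') :- (q :+ q')) :- ((r :+ r') :- (s :+ s'))) refl

      column : ∀ w w' y z → n₁ * (y * y * z) - n₂ * (w * y * z) + n₃ * ((m * (w * w) + w' * y) * z) ≈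
        (n₁ * (y * y) - n₂ * w * y + n₃ * (m * (w * w) + w' * y)) * z
      column w w' y z = solve 7 (λ n₁ n₂ n₃ w y z c → n₁ :* (y :* y :* z) :- n₂ :* (w :* y :* z) :+ n₃ :* (c :* z) := (n₁ :* (y :* y) :- n₂ :* w :* y :+ n₃ :* c) :* z) refl n₁ n₂ n₃ w y z (m * (w * w) + w' * y)

      col₁ : n₁ * (y₁ * y₁) - n₂ * a * y₁ + n₃ * (m * (a * a) + a' * y₁) ≈ 0#
      col₁ = solve 5 (λ m a a' y s → m :* (a :* a :* a) :* (y :* y) :- (m :* (a :* a) :* (y :+ s) :+ a' :* (y :* s)) :* a :* y :+ a :* (y :* s) :* (m :* (a :* a) :+ a' :* y) := con (+ 0)) refl m a a' y₁ S

      col₂ : n₁ * (S * S) - n₂ * a * S + n₃ * (m * (a * a) + a' * S) ≈ 0#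
      col₂ = solve 5 (λ m a a' y s → m :* (a :* a :* a) :* (s :* s) :- (m :* (a :* a) :* (y :+ s) :+ a' :* (y :* s)) :* a :* s :+ a :* (y :* s) :* (m :* (a :* a) :+ a' :* s) := con (+ 0)) refl m a a' y₁ S

    -- `n₁`, `- n₂`, `n₃` form the cross product of the columns of `y₁` and `S`, so this combination
    -- of `E₀`, `E₁`, `E₂` eliminates both and leaves only `y₃` and `V`.
    W-relation : W y₃ * y₃ ^ N ≈ W V * V ^ N
    W-relation = sym (x-y≈0 (begin
      W V * z₄ - W y₃ * z₃
        ≈⟨ solve 4 (λ p q x y → p :- q := ((con (+ 0) :* x) :- (con (+ 0) :* y)) :- (q :- p)) refl (W V * z₄) (W y₃ * z₃) z₁ z₂ ⟩
      ((0# * z₁) - (0# * z₂)) - (W y₃ * z₃ - W V * z₄)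
        ≈⟨ +-congʳ (+-cong (*-congʳ (sym col₁)) (-‿cong (*-congʳ (sym col₂)))) ⟩
      ((n₁ * (y₁ * y₁) - n₂ * a * y₁ + n₃ * (m * (a * a) + a' * y₁)) * z₁ - (n₁ * (S * S) - n₂ * a * S + n₃ * (m * (a * a) + a' * S)) * z₂) - (W y₃ * z₃ - W V * z₄)
        ≈⟨ sym (+-cong (+-cong (column a a' y₁ z₁) (-‿cong (column a a' S z₂))) (-‿cong (+-cong (column b b' y₃ z₃) (-‿cong (column b b' V z₄))))) ⟩
      _ ≈⟨ sym (eliminate n₁ n₂ n₃ _ _ _ _ _ _ _ _ _ _ _ _) ⟩
      _ ≈⟨ +-cong (+-cong (trans (*-congˡ E₀) (zeroʳ n₁)) (-‿cong (trans (*-congˡ E₁) (zeroʳ n₂)))) (trans (*-congˡ E₂) (zeroʳ n₃)) ⟩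
      0# - 0# + 0# ≈⟨ trans (+-identityʳ _) (-‿inverseʳ 0#) ⟩
      0# ∎))

  module Degenerate (m≉0 : ¬ m ≈ 0#) (2≉0 : ¬ 1# + 1# ≈ 0#) (2m+1≉0 : ¬ m + m + 1# ≈ 0#) (a≉0 : ¬ a ≈ 0#) (V≉0 : ¬ V ≈ 0#) (y₃≉0 : ¬ y₃ ≈ 0#)
    (W₃ : W y₃ ≈ 0#) (W₄ : W V ≈ 0#) where

    -- The divided difference of `W` between `y₃` and `V`, which differ by one.
    T : Carrier
    T = m * (a * a * a) * (y₃ + V) - (m * (a * a) * (y₁ + S) + a' * (y₁ * S)) * b + a * (y₁ * S) * b'

    T≈0 : T ≈ 0#
    T≈0 = begin
      T ≈⟨ solve 6 (λ α β γ μ b' v → α :* ((v :+ con (+ 1)) :+ v) :- β :+ γ :* b' := (α :* ((v :+ con (+ 1)) :* (v :+ con (+ 1))) :- β :* (v :+ con (+ 1)) :+ γ :* (μ :+ b' :* (v :+ con (+ 1)))) :- (α :* (v :* v) :- β :* v :+ γ :* (μ :+ b' :* v)))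
             refl (m * (a * a * a)) ((m * (a * a) * (y₁ + S) + a' * (y₁ * S)) * b) (a * (y₁ * S)) (m * (b * b)) b' V ⟩
      W y₃ - W V ≈⟨ +-cong W₃ (-‿cong W₄) ⟩
      0# - 0# ≈⟨ -‿inverseʳ 0# ⟩
      0# ∎

    -- In `W V - V T` all terms with second derivatives cancel, and `m a` factors out of the rest.
    II : b * b * (y₁ * S) ≈ a * a * (y₃ * V)
    II = x-y≈0 (cancel0 (*≉0 m≉0 a≉0) (begin
      m * a * (b * b * (y₁ * S) - a * a * (y₃ * V))
        ≈⟨ solve 7 (λ m a b s β b' v → m :* a :* (b :* b :* s :- a :* a :* ((v :+ con (+ 1)) :* v)) :=
             (m :* (a :* a :* a) :* (v :* v) :- β :* v :+ a :* s :* (m :* (b :* b) :+ b' :* v)) :- v :* (m :* (a :* a :* a) :* ((v :+ con (+ 1)) :+ v) :- β :+ a :* s :* b'))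
           refl m a b (y₁ * S) ((m * (a * a) * (y₁ + S) + a' * (y₁ * S)) * b) b' V ⟩
      W V - V * T ≈⟨ +-cong W₄ (-‿cong (trans (*-congˡ T≈0) (zeroʳ V))) ⟩
      0# - 0# ≈⟨ -‿inverseʳ 0# ⟩
      0# ∎))

    dyy : ∀ x → d ((x + 1#) * x) ≈ d x * ((x + 1#) + x)
    dyy x = trans (d-* _ _) (trans (+-congˡ (*-congˡ (d-+1 x))) (solve 2 (λ x w → (x :+ con (+ 1)) :* w :+ x :* w := w :* ((x :+ con (+ 1)) :+ x)) refl x (d x)))

    d-sq : ∀ w q → d (w * w * q) ≈ w * w * d q + q * (w * d w + w * d w)
    d-sq w q = trans (d-* _ _) (+-congˡ (*-congˡ (d-* w w)))

    dII : b * b * (a * (y₁ + S)) + (y₁ * S) * (b * b' + b * b') ≈ a * a * (b * (y₃ + V)) + (y₃ * V) * (a * a' + a * a')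
    dII = trans (sym (trans (d-sq b (y₁ * S)) (+-congʳ (*-congˡ (dyy S))))) (trans (d-cong II) (trans (d-sq a (y₃ * V)) (+-congʳ (*-congˡ (dyy V)))))

    b≉0 : ¬ b ≈ 0#
    b≉0 z = *≉0 (*≉0 a≉0 a≉0) (*≉0 y₃≉0 V≉0) (trans (sym II) (trans (*-congʳ (trans (*-congʳ z) (zeroˡ b))) (zeroˡ _)))

    -- The derivative of `II` still contains second derivatives; `T ≈ 0` and `II` remove them,
    -- leaving the equation multiplied by `(2m + 1) a² b`.
    III : a * (y₃ + V) ≈ b * (y₁ + S)
    III = x-y≈0 (cancel0 (*≉0 2m+1≉0 (*≉0 (*≉0 a≉0 a≉0) b≉0)) (begin
      (m + m + 1#) * (a * a * b) * (a * p - b * q)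
        ≈⟨ solve 5 (λ m a b x y → (m :+ m :+ con (+ 1)) :* (a :* a :* b) :* (x :- y) := (b :+ b) :* (m :* (a :* a) :* (x :- y)) :+ (a :* a :* b) :* (x :- y)) refl m a b (a * p) (b * q) ⟩
      (b + b) * (m * (a * a) * (a * p - b * q)) + (a * a * b) * (a * p - b * q)
        ≈⟨ +-cong (*-congˡ lead) (sym tail) ⟩
      (b + b) * (a' * s * b - a * s * b') + (a * (s * (b * b' + b * b')) - (a' + a') * (b * b * s))
        ≈⟨ solve 5 (λ a b s a' b' → (b :+ b) :* (a' :* s :* b :- a :* s :* b') :+ (a :* (s :* (b :* b' :+ b :* b')) :- (a' :+ a') :* (b :* b :* s)) := con (+ 0)) refl a b s a' b' ⟩
      0# ∎))
      where
      p q s t : Carrier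
      p = y₃ + V
      q = y₁ + S
      s = y₁ * S
      t = y₃ * V
      lead : m * (a * a) * (a * p - b * q) ≈ a' * s * b - a * s * b'
      lead = x-y≈0 (trans (solve 8 (λ m a b p q s a' b' → m :* (a :* a) :* (a :* p :- b :* q) :- (a' :* s :* b :- a :* s :* b') := m :* (a :* a :* a) :* p :- (m :* (a :* a) :* q :+ a' :* s) :* b :+ a :* s :* b') refl m a b p q s a' b') T≈0)
      dII' : s * (b * b' + b * b') ≈ (a * a * (b * p) + t * (a * a' + a * a')) - b * b * (a * q)
      dII' = trans (solve 2 (λ x y → y := (x :+ y) :- x) refl (b * b * (a * q)) (s * (b * b' + b * b'))) (+-congʳ dII)
      tail : a * (s * (b * b' + b * b')) - (a' + a') * (b * b * s) ≈ (a * a * b) * (a * p - b * q)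
      tail = trans (+-cong (*-congˡ dII') (-‿cong (*-congˡ II)))
        (solve 6 (λ a b p q t a' → a :* ((a :* a :* (b :* p) :+ t :* (a :* a' :+ a :* a')) :- b :* b :* (a :* q)) :- (a' :+ a') :* (a :* a :* t) := (a :* a :* b) :* (a :* p :- b :* q)) refl a b p q t a')

    -- Squaring `III` and using `(2y + 1)² - 4 y (y + 1) = 1` for `y = V` and `y = S`, `II` reduces
    -- everything to `a² = b²`.
    squares : (a - b) * (a + b) ≈ 0#
    squares = begin
      (a - b) * (a + b)
        ≈⟨ solve 4 (λ a b v s → (a :- b) :* (a :+ b) := (a :* ((v :+ con (+ 1)) :+ v)) :* (a :* ((v :+ con (+ 1)) :+ v)) :- (b :* ((s :+ con (+ 1)) :+ s)) :* (b :* ((s :+ con (+ 1)) :+ s))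
              :+ con (+ 4) :* (b :* b :* ((s :+ con (+ 1)) :* s) :- a :* a :* ((v :+ con (+ 1)) :* v))) refl a b V S ⟩
      (a * (y₃ + V)) * (a * (y₃ + V)) - (b * (y₁ + S)) * (b * (y₁ + S)) + (4 · 1#) * (b * b * (y₁ * S) - a * a * (y₃ * V))
        ≈⟨ +-cong (trans (+-congʳ (*-cong III III)) (-‿inverseʳ _)) (trans (*-congˡ (trans (+-congʳ II) (-‿inverseʳ _))) (zeroʳ _)) ⟩
      0# + 0# ≈⟨ +-identityˡ 0# ⟩
      0# ∎

    lines : S - V ≈ 0# ⊎ S + V + 1# ≈ 0#
    lines = [ (λ z → inj₁ (equal z)) , (λ z → inj₂ (opposite z)) ]′ (zd (a - b) (a + b) squares)
      where
      equal : a - b ≈ 0# → S - V ≈ 0#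
      equal z = cancel0 (*≉0 a≉0 2≉0) (begin
        a * (1# + 1#) * (S - V) ≈⟨ solve 4 (λ a b v s → a :* (con (+ 1) :+ con (+ 1)) :* (s :- v) := (b :* ((s :+ con (+ 1)) :+ s) :- a :* ((v :+ con (+ 1)) :+ v)) :+ (a :- b) :* ((s :+ con (+ 1)) :+ s)) refl a b V S ⟩
        (b * (y₁ + S) - a * (y₃ + V)) + (a - b) * (y₁ + S) ≈⟨ +-cong (trans (+-congˡ (-‿cong III)) (-‿inverseʳ _)) (trans (*-congʳ z) (zeroˡ _)) ⟩
        0# + 0# ≈⟨ +-identityˡ 0# ⟩
        0# ∎)
      opposite : a + b ≈ 0# → S + V + 1# ≈ 0#
      opposite z = cancel0 (*≉0 a≉0 2≉0) (begin
        a * (1# + 1#) * (S + V + 1#) ≈⟨ solve 4 (λ a b v s → a :* (con (+ 1) :+ con (+ 1)) :* (s :+ v :+ con (+ 1)) := (a :* ((v :+ con (+ 1)) :+ v) :- b :* ((s :+ con (+ 1)) :+ s)) :+ (a :+ b) :* ((s :+ con (+ 1)) :+ s)) refl a b V S ⟩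
        (a * (y₃ + V) - b * (y₁ + S)) + (a + b) * (y₁ + S) ≈⟨ +-cong (trans (+-congʳ III) (-‿inverseʳ _)) (trans (*-congʳ z) (zeroˡ _)) ⟩
        0# + 0# ≈⟨ +-identityˡ 0# ⟩
        0# ∎)

-- The degree of the Wronskian and the degree bound for a component.

module DegreeSums where
  open import Data.Nat.Solver
  open +-*-Solver
  eq₁ : ∀ e → 0 ℕ.+ (suc (suc e) ℕ.+ suc (suc e) ℕ.+ suc (suc e)) ℕ.+ 2 ≡ suc e ℕ.+ (suc e ℕ.+ suc e) ℕ.+ 5
  eq₁ = solve 1 (λ e → (con 2 :+ e) :+ (con 2 :+ e) :+ (con 2 :+ e) :+ con 2 := (con 1 :+ e) :+ ((con 1 :+ e) :+ (con 1 :+ e)) :+ con 5) ≡.refl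
  eq₂ : ∀ e → (suc (suc e) ℕ.+ suc e ℕ.+ 2) ℕ.+ suc (suc e) ℕ.+ 1 ≡ suc e ℕ.+ (suc e ℕ.+ suc e) ℕ.+ 5
  eq₂ = solve 1 (λ e → ((con 2 :+ e) :+ (con 1 :+ e) :+ con 2) :+ (con 2 :+ e) :+ con 1 := (con 1 :+ e) :+ ((con 1 :+ e) :+ (con 1 :+ e)) :+ con 5) ≡.refl
  eq₃ : ∀ e → 0 ℕ.+ (suc (suc e) ℕ.+ suc (suc e)) ℕ.+ 1 ≡ suc (suc e) ℕ.+ suc e ℕ.+ 2
  eq₃ = solve 1 (λ e → (con 2 :+ e) :+ (con 2 :+ e) :+ con 1 := (con 2 :+ e) :+ (con 1 :+ e) :+ con 2) ≡.refl
  eq₄ : ∀ e → (suc (suc e) ℕ.+ 2) ℕ.+ (suc (suc e) ℕ.+ suc e ℕ.+ 1) ≡ suc e ℕ.+ (suc e ℕ.+ suc e) ℕ.+ 5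
  eq₄ = solve 1 (λ e → ((con 2 :+ e) :+ con 2) :+ ((con 2 :+ e) :+ (con 1 :+ e) :+ con 1) := (con 1 :+ e) :+ ((con 1 :+ e) :+ (con 1 :+ e)) :+ con 5) ≡.refl
  eq₅ : ∀ e → 0 ℕ.+ (suc (suc e) ℕ.+ suc (suc e)) ≡ suc (suc e) ℕ.+ suc e ℕ.+ 1
  eq₅ = solve 1 (λ e → (con 2 :+ e) :+ (con 2 :+ e) := (con 2 :+ e) :+ (con 1 :+ e) :+ con 1) ≡.refl

module Component (K A : CRing) (domK : Domain K) (domA : Domain A) (gr : Graded K A)
  (p : ℕ) (p·1 : CommutativeRing._≈_ K (RingTools._·_ K p (CommutativeRing.1# K)) (CommutativeRing.0# K))
  (fermat : ∀ c → CommutativeRing._≈_ K (RingTools._^_ K c p) c)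
  (small : ∀ i → 0 ℕ.< i → i ℕ.< p → ¬ CommutativeRing._≈_ K (RingTools._·_ K i (CommutativeRing.1# K)) (CommutativeRing.0# K))
  (e : ℕ) (G : List (Car A)) (mG : Division.Monic A domA (suc e) G) (tG : Bivariate.Tot K A domK domA gr (suc (suc e)) G)
  (domR : Domain (Quotient.quotient (PolyRing.poly A) G)) (N : ℕ) (2n<p : N ℕ.+ N ℕ.+ 4 ℕ.< p) where
  open PlaneCurve K A domK domA gr p p·1 fermat small e G mG tG domR
  open Bivariate K A domK domA gr
  open Quotient (PolyRing.poly A) G
  private
    module K = RingTools K
    module dK = Domain domK
    module A where
      open RingTools A public
      open Domain domA public
    module ι = Hom ι
    module R where
      open RingTools R public
      open Domain domR public

  -- A point off both lines certifies that `G` is neither of the two excluded factors.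
  record GoodPoint : Set where
    field
      v₀ s₀ : K.Carrier
    open Evaluate v₀ s₀ public
    open Hom evB public renaming (f to ev; f-cong to ev-cong; f-+ to ev-+; f-1 to ev-1; f-neg to ev-neg; f-sub to ev-sub) using ()
    field
      on     : ev G K.≈ K.0#
      smooth : ¬ ev GV K.≈ K.0#
      off₁   : ¬ s₀ K.- v₀ K.≈ K.0#
      off₂   : ¬ s₀ K.+ v₀ K.+ K.1# K.≈ K.0#

  -- Divisibility by `v^n`, read off the coefficients. In this form cancelling `v + 1`, a unit
  -- modulo `v^n`, is an induction on the index.
  low : ℕ → A.Carrier → Set
  low n a = ∀ i → i ℕ.< n → ca i a K.≈ K.0#

  low-cong : ∀ n {a b} → a A.≈ b → low n a → low n b
  low-cong n e l i lt = K.trans (ca-cong i (A.sym e)) (l i lt)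

  low-v^ : ∀ n a → low n (v A.^ n A.* a)
  low-v^ (suc n) a = low-cong (suc n) (A.sym (A.*-assoc _ _ _)) go
    where
    go : low (suc n) (v A.* (v A.^ n A.* a))
    go zero _ = ca-v0 _
    go (suc i) (s≤s lt) = K.trans (ca-vs i _) (low-v^ n a i lt)

  low-v+1 : ∀ n {a} → low n ((v A.+ A.1#) A.* a) → low n a
  low-v+1 n {a} l zero lt = K.trans (K.sym (K.trans (ca-cong 0 (A.trans (A.distribʳ _ _ _) (A.+-congˡ (A.*-identityˡ a)))) (K.trans (ca-+ 0 _ _) (K.trans (K.+-congʳ (ca-v0 a)) (K.+-identityˡ _))))) (l 0 lt)
  low-v+1 n {a} l (suc i) lt = K.trans (K.sym (K.trans (ca-cong (suc i) (A.trans (A.distribʳ _ _ _) (A.+-congˡ (A.*-identityˡ a)))) (K.trans (ca-+ (suc i) _ _)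
      (K.trans (K.+-congʳ (K.trans (ca-vs i a) (low-v+1 n l i (ℕ.<-trans ℕ.≤-refl lt)))) (K.+-identityˡ _))))) (l (suc i) lt)

  low-v+1^ : ∀ n k {a} → low n ((v A.+ A.1#) A.^ k A.* a) → low n a
  low-v+1^ n zero l = low-cong n (A.*-identityˡ _) l
  low-v+1^ n (suc k) {a} l = low-v+1^ n k (low-v+1 n (low-cong n (A.*-assoc _ _ _) l))

  ca-1-v : ∀ c → ca 1 (v A.+ ι.f c) K.≈ K.1#
  ca-1-v c = K.trans (ca-+ 1 _ _) (K.trans (K.+-cong (K.trans (ca-cong 1 (A.trans (A.sym (A.*-identityʳ v)) (A.*-congˡ (A.sym ι.f-1)))) (K.trans (ca-vs 0 _) (ca-ι0 K.1#))) (ca-ιs 0 c)) (K.+-identityʳ _))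

  -- `G` has positive degree in `S`, so a nonzero element of `K[V]` is already reduced and cannot
  -- vanish on the curve.
  linear≄0 : ∀ c → ¬ C (v A.+ ι.f c) ≃ 0#
  linear≄0 c z = dK.1≉0 (K.trans (K.sym (ca-1-v c)) (K.trans (ca-cong 1 (at (small-zero (deg-mono (s≤s z≤n) deg-C) z) 0)) (ca-0 1)))

  V≄0 : ¬ V ≃ 0#
  V≄0 z = linear≄0 K.0# (≃-trans (≈⇒≃ (C-cong (A.trans (A.+-congˡ ι.f-0) (A.+-identityʳ v)))) z)

  V+1≈ : V + 1# ≈ C (v A.+ A.1#)
  V+1≈ = sym (C-⊕ v A.1#)

  V+1≄0 : ¬ V + 1# ≃ 0#
  V+1≄0 z = linear≄0 K.1# (≃-trans (≈⇒≃ (trans (C-cong (A.+-congˡ ι.f-1)) (C-⊕ v A.1#))) z)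

  module W = Wronskian R domR derR V X N

  module _ (rel : ((X + 1#) R.^ suc (suc N) - X R.^ suc (suc N)) - ((V + 1#) R.^ suc (suc N) - V R.^ suc (suc N)) ≃ 0#) (P : GoodPoint) where
    open GoodPoint P
    private
      module F = Hom (evR on smooth)

    nat≉0 : ∀ k → 0 ℕ.< k → k ℕ.< p → ¬ k R.· R.1# ≃ 0#
    nat≉0 k 0<k k<p z = small k 0<k k<p (K.trans (K.sym (F.f-· k)) (F.f-zero z))

    N<p : suc (suc N) ℕ.< p
    N<p = ℕ.≤-<-trans (ℕ.≤-trans (ℕ.≤-reflexive (ℕ.+-comm 2 N)) (ℕ.≤-trans (ℕ.+-monoʳ-≤ N (s≤s (s≤s z≤n))) (ℕ.+-monoˡ-≤ 4 (ℕ.m≤m+n N N)))) 2n<p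

    2m+1≉0 : ¬ W.m R.+ W.m R.+ R.1# ≃ 0#
    2m+1≉0 z = nat≉0 (suc N ℕ.+ suc N ℕ.+ 1) (s≤s z≤n) (ℕ.≤-<-trans (ℕ.≤-trans (ℕ.≤-reflexive (≡.cong (ℕ._+ 1) (≡.cong suc (ℕ.+-suc N N))))
        (ℕ.≤-trans (ℕ.≤-reflexive (ℕ.+-comm (suc (suc (N ℕ.+ N))) 1)) (ℕ.≤-trans (ℕ.≤-reflexive (ℕ.+-comm 3 (N ℕ.+ N))) (ℕ.+-monoʳ-≤ (N ℕ.+ N) (ℕ.n≤1+n 3))))) 2n<p)
      (R.trans (R.·-homo-+ R.1# (suc N ℕ.+ suc N) 1) (R.trans (R.+-congʳ (R.·-homo-+ R.1# (suc N) (suc N))) z))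

    a≉0 : ¬ W.a ≃ 0#
    a≉0 z = smooth (K.trans (K.sym (K.trans (K.-‿cong (K.trans (ev-cong D.∂-X) (ev-neg GV))) (K.-‿involutive _))) (K.trans (K.-‿cong (F.f-zero z)) K.-0#≈0#))

    -- All terms of `W y` obey the same bound: `a` and `b` have degree at most `e + 2`, `a'` and
    -- `b'` at most `2e + 3`, and the first term gives `3 (e + 2) + 2`.
    δ : ℕ
    δ = suc e ℕ.+ (suc e ℕ.+ suc e) ℕ.+ 5

    open Curve curve using (fil-+; fil-*; fil-mono; fil-cong; fil-S; fil-V; fil-d; fil-ι)

    fil-1 : ∀ {U} → Fil U R.1#
    fil-1 = fil-mono z≤n (fil-cong (Hom.f-1 (quotHom ∘H κ)) (fil-ι K.1#))

    fil-nat : ∀ k → Fil 0 (k R.· R.1#)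
    fil-nat k = fil-cong (Hom.f-· (quotHom ∘H κ) k) (fil-ι _)

    fil-neg : ∀ {U x} → Fil U x → Fil U (R.- x)
    fil-neg (Q , w , t) = - Q , neg-cong' w , tot-neg t

    fil-a : Fil (suc (suc e)) W.a
    fil-a = fil-d fil-S

    fil-b : Fil (suc (suc e)) W.b
    fil-b = fil-d fil-V

    open DegreeSums

    fil-W : ∀ {y} → Fil 1 y → Fil δ (W.W y)
    fil-W {y} fy = fil-+ (fil-+ (fil-mono (ℕ.≤-reflexive (eq₁ e)) (fil-* (fil-* (fil-nat (suc N)) (fil-* (fil-* fil-a fil-a) fil-a)) (fil-* fy fy)))
        (fil-neg (fil-mono (ℕ.≤-reflexive (eq₂ e)) (fil-* (fil-* (fil-+ {suc (suc e) ℕ.+ suc e ℕ.+ 2} (fil-mono (ℕ.≤-reflexive (eq₃ e)) (fil-* (fil-* (fil-nat (suc N)) (fil-* fil-a fil-a)) (fil-+ fil-y₁ fil-S)))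
            (fil-* (fil-d fil-a) (fil-* fil-y₁ fil-S))) fil-b) fy))))
      (fil-mono (ℕ.≤-reflexive (eq₄ e)) (fil-* (fil-* fil-a (fil-* fil-y₁ fil-S)) (fil-+ {suc (suc e) ℕ.+ suc e ℕ.+ 1} (fil-mono (ℕ.≤-reflexive (eq₅ e)) (fil-* (fil-nat (suc N)) (fil-* fil-b fil-b))) (fil-* (fil-d fil-b) fy))))
      where
      fil-y₁ : Fil 1 W.y₁
      fil-y₁ = fil-+ fil-S fil-1

    module Small (δ<N : δ ℕ.< N) where
      W₃ W₄ ρ₃ ρ₄ : List A.Carrier
      W₃ = W.W W.y₃
      W₄ = W.W V
      ρ₃ = rem W₃
      ρ₄ = rem W₄

      W-relation : W₃ * (V + 1#) R.^ N ≃ W₄ * V R.^ N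
      W-relation = W.Relations.W-relation (nat≉0 (suc (suc N)) (s≤s z≤n) N<p) rel

      pow≃ : ∀ a k → C a R.^ k ≃ C (a A.^ k)
      pow≃ a k = ≃-trans (≃-sym (Hom.f-^ quotHom (C a) k)) (≈⇒≃ (sym (C-^ a k)))

      -- Powers of `V` and `V + 1` are scalars over `K[V]`, so both sides are reduced modulo `G` and
      -- the congruence becomes an identity of polynomials.
      coords : C ((v A.+ A.1#) A.^ N) * ρ₃ ≈ C (v A.^ N) * ρ₄
      coords = unique (deg-C* _ (rem-deg W₃)) (deg-C* _ (rem-deg W₄))
        (R.trans (R.*-comm (C ((v A.+ A.1#) A.^ N)) ρ₃) (R.trans (R.*-cong (R.sym (rem-≃ W₃)) (R.sym (R.trans (Hom.f-^ (idHom R) (V + 1#) N) (R.trans (R.^-congˡ N (≈⇒≃ V+1≈)) (pow≃ (v A.+ A.1#) N)))))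
          (R.trans W-relation (R.trans (R.*-cong (rem-≃ W₄) (pow≃ v N)) (R.*-comm ρ₄ (C (v A.^ N)))))))

      tot-ρ₃ : Tot (suc δ) ρ₃
      tot-ρ₃ = go (fil-W (fil-+ fil-V fil-1))
        where
        go : Fil δ W₃ → Tot (suc δ) ρ₃
        go (Q , w , t) = tot-cong (rem-cong (≃-sym w)) (rem-tot (suc δ) Q t)

      -- Since `v + 1` is prime to `v`, every coefficient is divisible by `v^N`, yet its degree is
      -- at most `δ < N`.
      ρ₃≈0 : ρ₃ ≈ 0#
      ρ₃≈0 = mk λ j → ca-ext λ i → vanishes i j
        where
        lowρ : ∀ j → low N (coeff ρ₃ j)
        lowρ j = low-v+1^ N N (low-cong N (A.sym (A.trans (A.sym (coeff-C* ((v A.+ A.1#) A.^ N) ρ₃ j)) (A.trans (at coords j) (coeff-C* (v A.^ N) ρ₄ j)))) (low-v^ N (coeff ρ₄ j)))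
        vanishes : ∀ i j → ca i (coeff ρ₃ j) K.≈ K.0#
        vanishes i j with i ℕ.<? N
        ... | yes lt = lowρ j i lt
        ... | no nlt = bound tot-ρ₃ j i (ℕ.≤-trans (ℕ.m∸n≤m (suc δ) j) (ℕ.≤-trans δ<N (ℕ.≮⇒≥ nlt)))

      W₃≃0 : W₃ ≃ 0#
      W₃≃0 = ≃-trans (rem-≃ W₃) (≈⇒≃ ρ₃≈0)

      W₄≃0 : W₄ ≃ 0#
      W₄≃0 = R.cancel0 (R.^≉0 N V≄0) (R.trans (R.*-comm (V R.^ N) W₄) (R.trans (R.sym W-relation) (R.trans (R.*-congʳ W₃≃0) (R.zeroˡ _))))

      lines : X - V ≃ 0# ⊎ X + V + 1# ≃ 0#
      lines = W.Degenerate.lines (nat≉0 (suc N) (s≤s z≤n) (ℕ.<-trans (ℕ.n<1+n (suc N)) N<p)) (nat≉0 2 (s≤s z≤n) (ℕ.≤-<-trans (s≤s (s≤s z≤n)) N<p)) 2m+1≉0 a≉0 V≄0 V+1≄0 W₃≃0 W₄≃0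

      impossible : ⊥
      impossible = [ (λ z → off₁ (K.trans (K.sym (K.trans (ev-sub X V) (K.+-cong ev-X (K.-‿cong ev-V)))) (F.f-zero z)))
                   , (λ z → off₂ (K.trans (K.sym (K.trans (ev-+ (X + V) 1#) (K.+-cong (K.trans (ev-+ X V) (K.+-cong ev-X ev-V)) ev-1))) (F.f-zero z))) ]′ lines

    -- Otherwise both Wronskians vanish, which puts the whole curve on one of the two lines; the
    -- point `P` lies on neither.
    degree-bound : N ℕ.≤ suc e ℕ.+ (suc e ℕ.+ suc e) ℕ.+ 5
    degree-bound = ℕ.≮⇒≥ Small.impossible

  toPoint : GoodPoint → OnCurve.Point curve
  toPoint P = Evaluate.point (GoodPoint.v₀ P) (GoodPoint.s₀ P) (GoodPoint.on P) (GoodPoint.smooth P)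

  Differ : GoodPoint → GoodPoint → Set
  Differ P Q = ¬ (GoodPoint.v₀ P K.≈ GoodPoint.v₀ Q × GoodPoint.s₀ P K.≈ GoodPoint.s₀ Q)

  differ⇒distinct : ∀ {P Q} → Differ P Q → OnCurve.Distinct curve (toPoint Q) (toPoint P)
  differ⇒distinct {P} {Q} ne (ev , es) = ne (K.trans (K.sym P.ev-V) (K.trans (K.sym ev) Q.ev-V) , K.trans (K.sym P.ev-X) (K.trans (K.sym es) Q.ev-X))
    where
    module P = GoodPoint P
    module Q = GoodPoint Q

  -- The independence is wanted over `Fin (suc M)`; the indices are transported so that the list of
  -- exponents stays untouched.
  reindex : ∀ {n} μ (eq : length (idx (suc e) μ) ≡ n) → (α : Fin n → K.Carrier) →
    Sums.sum R (λ l → κ.f (α l) * monR (lookup (idx (suc e) μ) (≡.subst Fin (≡.sym eq) l))) ≃ 0# → ∀ l → α l K.≈ K.0#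
  reindex μ ≡.refl α z = independent μ α z

  count : ∀ μ M → length (idx (suc e) μ) ≡ suc M → suc e ℕ.* μ ℕ.< p → M ℕ.≤ p → ∀ Ps → AllPairs Differ Ps →
    (length Ps ℕ.* M ℕ.≤ suc e ℕ.* (e ℕ.+ M ℕ.* (μ ℕ.+ M ℕ.* suc e) ℕ.+ p ℕ.* μ)) ⊎ (length Ps ℕ.* p ℕ.≤ suc e ℕ.* (e ℕ.+ M ℕ.* (μ ℕ.+ M ℕ.* suc e)))
  count μ M eq eμ<p M≤p Ps dist = ≡.subst (λ L → (L ℕ.* M ℕ.≤ _) ⊎ (L ℕ.* p ℕ.≤ _)) (length-map toPoint Ps)
    (StohrVoloch.stohr-voloch curve M μ (λ l → monR (lookup (idx (suc e) μ) (≡.subst Fin (≡.sym eq) l)))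
      (λ l → OnCurve.fil-mon curve {μ} (≡.subst Fin (≡.sym eq) l)) (reindex μ eq) eμ<p M≤p (map toPoint Ps) (AllPairs.map⁺ (AllPairs.map (λ {P} {Q} → differ⇒distinct {P} {Q}) dist)))

-- Estimates in natural numbers.

module NatBounds where
  open import Data.Nat
  open import Data.Nat.Properties
  open import Data.Nat.Solver
  open import Relation.Binary.PropositionalEquality
  open +-*-Solver

  module Numerics (e μ M p n : ℕ) (1≤μ : 1 ≤ μ) (hM : 2 * suc M ≡ suc μ * (2 + μ)) (d<n : suc e < n) (hp : μ * μ * μ * n ≤ p) where
    private
      instance
        μ≢0 : NonZero μ
        μ≢0 = >-nonZero 1≤μ

      n≥1 : 1 ≤ n
      n≥1 = ≤-trans (s≤s z≤n) d<n

      instance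
        n≢0 : NonZero n
        n≢0 = >-nonZero n≥1

      2M≡ : 2 * M ≡ μ * μ + 3 * μ
      2M≡ = +-cancelˡ-≡ 2 (2 * M) (μ * μ + 3 * μ) (trans (sym (*-suc 2 M)) (trans hM (solve 1 (λ m → (con 1 :+ m) :* (con 2 :+ m) := con 2 :+ (m :* m :+ con 3 :* m)) refl μ)))

      μ≤μμ : μ ≤ μ * μ
      μ≤μμ = m≤m*n μ μ

      M≤ : M ≤ 2 * (μ * μ)
      M≤ = *-cancelˡ-≤ 2 (begin
        2 * M                ≡⟨ 2M≡ ⟩
        μ * μ + 3 * μ        ≤⟨ +-monoʳ-≤ (μ * μ) (*-monoʳ-≤ 3 μ≤μμ) ⟩
        μ * μ + 3 * (μ * μ)  ≡⟨ solve 1 (λ x → x :+ con 3 :* x := con 2 :* (con 2 :* x)) refl (μ * μ) ⟩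
        2 * (2 * (μ * μ)) ∎)
        where open ≤-Reasoning

      μμ≤ : μ * μ ≤ 2 * M
      μμ≤ = ≤-trans (m≤m+n (μ * μ) (3 * μ)) (≤-reflexive (sym 2M≡))

      μμ≤p : μ * μ ≤ p
      μμ≤p = ≤-trans (≤-trans (m≤m*n (μ * μ) μ) (m≤m*n (μ * μ * μ) n)) hp

      U : ℕ
      U = e + M * (μ + M * suc e)

      -- The dominant term `M² (e + 1)` is of order `μ⁴ n`, and `μ³ n ≤ p` brings it down to `μ p`,
      -- the degree of `φ^p`. The constant is 1 + 2 + 4, one for each summand of `U`.
      U≤ : U ≤ 7 * (μ * p)
      U≤ = begin
        e + M * (μ + M * suc e)              ≡⟨ cong (λ x → e + x) (*-distribˡ-+ M μ (M * suc e)) ⟩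
        e + (M * μ + M * (M * suc e))        ≤⟨ +-mono-≤ e≤ (+-mono-≤ Mμ≤ MM≤) ⟩
        T + (2 * T + 4 * T)                  ≡⟨ solve 1 (λ t → t :+ (con 2 :* t :+ con 4 :* t) := con 7 :* t) refl T ⟩
        7 * T                                ≤⟨ *-monoʳ-≤ 7 (*-monoʳ-≤ μ hp) ⟩
        7 * (μ * p) ∎
        where
        open ≤-Reasoning
        T = μ * (μ * μ * μ * n)
        n≤T : n ≤ T
        n≤T = ≤-trans (m≤n*m n (μ * μ * μ) {{m*n≢0 (μ * μ) μ {{m*n≢0 μ μ}}}}) (m≤n*m (μ * μ * μ * n) μ)
        e≤ : e ≤ T
        e≤ = ≤-trans (≤-trans (n≤1+n e) (<⇒≤ d<n)) n≤T
        Mμ≤ : M * μ ≤ 2 * T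
        Mμ≤ = begin
          M * μ                ≤⟨ *-monoˡ-≤ μ M≤ ⟩
          2 * (μ * μ) * μ      ≡⟨ *-assoc 2 (μ * μ) μ ⟩
          2 * (μ * μ * μ)      ≤⟨ *-monoʳ-≤ 2 (≤-trans (m≤m*n (μ * μ * μ) n) (m≤n*m (μ * μ * μ * n) μ)) ⟩
          2 * T ∎
        MM≤ : M * (M * suc e) ≤ 4 * T
        MM≤ = begin
          M * (M * suc e)                        ≤⟨ *-mono-≤ M≤ (*-mono-≤ M≤ (<⇒≤ d<n)) ⟩
          2 * (μ * μ) * (2 * (μ * μ) * n)        ≡⟨ solve 2 (λ m n → con 2 :* (m :* m) :* (con 2 :* (m :* m) :* n) := con 4 :* (m :* (m :* m :* m :* n))) refl μ n ⟩
          4 * T ∎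

    degree<p : suc e * μ < p
    degree<p = <-≤-trans (*-monoˡ-< μ d<n) (≤-trans (≤-reflexive (*-comm n μ)) (≤-trans (*-monoˡ-≤ n (≤-trans μ≤μμ (m≤m*n (μ * μ) μ))) hp))

    M≤p : M ≤ p
    M≤p = ≤-trans M≤ (≤-trans (≤-trans (≤-reflexive (*-comm 2 (μ * μ))) (*-mono-≤ (m≤m*n (μ * μ) μ) (≤-trans (s≤s (s≤s z≤n)) d<n))) hp)

    -- In the first case `μ² ≤ 2 M` and `7 + 1` give the factor 16. In the second `c ≤ 7 (e + 1) μ`,
    -- and `μ² ≤ p` finishes.
    bound : ∀ c → (c * M ≤ suc e * (U + p * μ)) ⊎ (c * p ≤ suc e * U) → c * μ ≤ 16 * (suc e * p)
    bound c (inj₁ h) = *-cancelʳ-≤ (c * μ) (16 * (suc e * p)) μ (begin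
      c * μ * μ                          ≡⟨ *-assoc c μ μ ⟩
      c * (μ * μ)                        ≤⟨ *-monoʳ-≤ c μμ≤ ⟩
      c * (2 * M)                        ≡⟨ solve 2 (λ c m → c :* (con 2 :* m) := con 2 :* (c :* m)) refl c M ⟩
      2 * (c * M)                        ≤⟨ *-monoʳ-≤ 2 h ⟩
      2 * (suc e * (U + p * μ))          ≤⟨ *-monoʳ-≤ 2 (*-monoʳ-≤ (suc e) (+-monoˡ-≤ (p * μ) U≤)) ⟩
      2 * (suc e * (7 * (μ * p) + p * μ)) ≡⟨ solve 3 (λ d m p → con 2 :* (d :* (con 7 :* (m :* p) :+ p :* m)) := con 16 :* (d :* p) :* m) refl (suc e) μ p ⟩
      16 * (suc e * p) * μ ∎)
      where open ≤-Reasoning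
    bound c (inj₂ h) = begin
      c * μ                 ≤⟨ *-monoˡ-≤ μ c≤ ⟩
      suc e * (7 * μ) * μ   ≡⟨ solve 2 (λ d m → d :* (con 7 :* m) :* m := con 7 :* (d :* (m :* m))) refl (suc e) μ ⟩
      7 * (suc e * (μ * μ)) ≤⟨ *-mono-≤ (m≤m+n 7 9) (*-monoʳ-≤ (suc e) μμ≤p) ⟩
      16 * (suc e * p) ∎
      where
      open ≤-Reasoning
      instance
        p≢0 : NonZero p
        p≢0 = >-nonZero (≤-trans (s≤s z≤n) degree<p)
      c≤ : c ≤ suc e * (7 * μ)
      c≤ = *-cancelʳ-≤ c (suc e * (7 * μ)) p (≤-trans h (≤-trans (*-monoʳ-≤ (suc e) U≤) (≤-reflexive (solve 3 (λ d m p → d :* (con 7 :* (m :* p)) := d :* (con 7 :* m) :* p) refl (suc e) μ p))))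

  add-bounds : ∀ a b d d' μ p → a * μ ≤ 16 * (d * p) → b * μ ≤ 16 * (d' * p) → (a + b) * μ ≤ 16 * ((d + d') * p)
  add-bounds a b d d' μ p h h' = begin
    (a + b) * μ                     ≡⟨ *-distribʳ-+ μ a b ⟩
    a * μ + b * μ                   ≤⟨ +-mono-≤ h h' ⟩
    16 * (d * p) + 16 * (d' * p)    ≡⟨ solve 3 (λ d d' p → con 16 :* (d :* p) :+ con 16 :* (d' :* p) := con 16 :* ((d :+ d') :* p)) refl d d' p ⟩
    16 * ((d + d') * p) ∎
    where open ≤-Reasoning

  -- The exponents 4/3 and 2/3 are handled by comparing cubes throughout.
  cube-cancel : ∀ {a b} → a ^ 3 ≤ b ^ 3 → a ≤ b
  cube-cancel {a} {b} h = ≮⇒≥ λ lt → <⇒≱ (^-monoˡ-< 3 lt) h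

  length-cartesianProduct : ∀ (xs ys : List ℕ) → length (cartesianProduct xs ys) ≡ length xs * length ys
  length-cartesianProduct [] ys = refl
  length-cartesianProduct (x ∷ xs) ys = trans (length-++ (map (x ,_) ys)) (cong₂ _+_ (length-map (x ,_) ys) (length-cartesianProduct xs ys))

  Nn≤p² : ∀ p n → Nn p n ≤ p * p
  Nn≤p² p n = ≤-trans (length-filter _ (cartesianProduct (upTo p) (upTo p)))
    (≤-reflexive (trans (length-cartesianProduct (upTo p) (upTo p)) (cong₂ _*_ (length-upTo p) (length-upTo p))))

  module Bounds (p n t : ℕ) (h : n ^ 4 * p ^ 2 ≤ t ^ 3) where
    open ≤-Reasoning

    square≤ : n ≤ p → n * n ≤ t
    square≤ le = cube-cancel (begin
      (n * n) ^ 3      ≡⟨ solve 1 (λ n → (n :* n) :^ 3 := n :^ 4 :* n :^ 2) refl n ⟩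
      n ^ 4 * n ^ 2    ≤⟨ *-monoʳ-≤ (n ^ 4) (^-monoˡ-≤ 2 le) ⟩
      n ^ 4 * p ^ 2    ≤⟨ h ⟩
      t ^ 3 ∎)

    -- The loss of 2⁴ = 16 is rounded up to the cube 27 = 3³.
    p²≤ : p ≤ 2 * n → p * p ≤ 3 * t
    p²≤ le = cube-cancel (begin
      (p * p) ^ 3             ≡⟨ solve 1 (λ p → (p :* p) :^ 3 := p :^ 4 :* p :^ 2) refl p ⟩
      p ^ 4 * p ^ 2           ≤⟨ *-monoˡ-≤ (p ^ 2) (^-monoˡ-≤ 4 le) ⟩
      (2 * n) ^ 4 * p ^ 2     ≡⟨ solve 2 (λ n p → (con 2 :* n) :^ 4 :* p :^ 2 := con 16 :* (n :^ 4 :* p :^ 2)) refl n p ⟩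
      16 * (n ^ 4 * p ^ 2)    ≤⟨ *-mono-≤ (m≤m+n 16 11) h ⟩
      27 * t ^ 3              ≡⟨ solve 1 (λ t → con 27 :* t :^ 3 := (con 3 :* t) :^ 3) refl t ⟩
      (3 * t) ^ 3 ∎)

    -- Here `μ` is at least about `(p/n)^(1/3)`, so `n p / μ` is at most about `n^(4/3) p^(2/3)`.
    -- The constant 32 is the given 16 times 2, from `suc μ ≤ 2 μ`.
    large-μ : ∀ L m μ → 1 ≤ μ → .{{NonZero p}} → m ≤ n → L * μ ≤ 16 * (m * p) → p ≤ suc μ * suc μ * suc μ * n → L ≤ 32 * t
    large-μ L m μ 1≤μ m≤n hL hp = cube-cancel (*-cancelʳ-≤ (L ^ 3) ((32 * t) ^ 3) p (begin
      L ^ 3 * p                                ≤⟨ *-monoʳ-≤ (L ^ 3) hp ⟩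
      L ^ 3 * (suc μ * suc μ * suc μ * n)      ≤⟨ *-monoʳ-≤ (L ^ 3) (*-monoˡ-≤ n (*-mono-≤ (*-mono-≤ sμ sμ) sμ)) ⟩
      L ^ 3 * (2 * μ * (2 * μ) * (2 * μ) * n)  ≡⟨ solve 3 (λ l m n → l :^ 3 :* (con 2 :* m :* (con 2 :* m) :* (con 2 :* m) :* n) := con 8 :* n :* (l :* m) :^ 3) refl L μ n ⟩
      8 * n * (L * μ) ^ 3                      ≡⟨ solve 2 (λ n x → con 8 :* n :* x :^ 3 := n :* (con 2 :* x) :^ 3) refl n (L * μ) ⟩
      n * (2 * (L * μ)) ^ 3                    ≤⟨ *-monoʳ-≤ n (^-monoˡ-≤ 3 (*-monoʳ-≤ 2 (≤-trans hL (*-monoʳ-≤ 16 (*-monoˡ-≤ p m≤n))))) ⟩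
      n * (2 * (16 * (n * p))) ^ 3             ≡⟨ cong (λ x → n * x ^ 3) (sym (*-assoc 2 16 (n * p))) ⟩
      n * (32 * (n * p)) ^ 3                   ≡⟨ solve 3 (λ k n p → n :* (k :* (n :* p)) :^ 3 := k :^ 3 :* (n :^ 4 :* p :^ 2) :* p) refl 32 n p ⟩
      32 ^ 3 * (n ^ 4 * p ^ 2) * p             ≤⟨ *-monoˡ-≤ p (*-monoʳ-≤ (32 ^ 3) h) ⟩
      32 ^ 3 * t ^ 3 * p                       ≡⟨ cong (_* p) (solve 2 (λ k t → k :^ 3 :* t :^ 3 := (k :* t) :^ 3) refl 32 t) ⟩
      (32 * t) ^ 3 * p ∎))
      where
      sμ : suc μ ≤ 2 * μ
      sμ = +-mono-≤ 1≤μ (≤-reflexive (sym (+-identityʳ μ)))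

  -- μ is maximal for the two constraints, so one of them fails at μ + 1 and bounds μ from below.
  choose-μ : ∀ p n N → n ≤ p → 11 ≤ N → ∃ λ μ → 1 ≤ μ × 3 * suc μ + 5 ≤ N × μ * μ * μ * n ≤ p ×
    (N < 3 * suc (suc μ) + 5 ⊎ p < suc μ * suc μ * suc μ * n)
  choose-μ p n N n≤p 11≤N = search N 1 (m≤m+n N 1) (s≤s z≤n) 11≤N (≤-trans (≤-reflexive (+-identityʳ n)) n≤p)
    where
    search : ∀ k μ → N ≤ k + μ → 1 ≤ μ → 3 * suc μ + 5 ≤ N → μ * μ * μ * n ≤ p → ∃ λ μ → 1 ≤ μ × 3 * suc μ + 5 ≤ N × μ * μ * μ * n ≤ p ×
      (N < 3 * suc (suc μ) + 5 ⊎ p < suc μ * suc μ * suc μ * n)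
    search k μ le 1≤μ a b with 3 * suc (suc μ) + 5 ≤? N | suc μ * suc μ * suc μ * n ≤? p
    ... | no na | _ = μ , 1≤μ , a , b , inj₁ (≰⇒> na)
    ... | yes _ | no nb = μ , 1≤μ , a , b , inj₂ (≰⇒> nb)
    search zero μ le 1≤μ a b | yes a' | yes b' = ⊥-elim (<⇒≱ (≤-trans (s≤s (m≤m+n μ _)) (≤-trans (m≤m+n _ 5) a)) le)
    search (suc k) μ le 1≤μ a b | yes a' | yes b' = search k (suc μ) (≤-trans le (≤-reflexive (sym (+-suc k μ)))) (s≤s z≤n) a' b'

  module Conclusion (X p N t : ℕ) (h : suc (suc N) ^ 4 * p ^ 2 ≤ t ^ 3) where
    private
      n : ℕ
      n = suc (suc N)
    open Bounds p n t h
    open ≤-Reasoning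

    p-small : ¬ N + N + 4 < p → X ≤ p * p → X ≤ 227 * (p + t)
    p-small nlt hX = ≤-trans hX (≤-trans (p²≤ (≤-trans (≮⇒≥ nlt) (≤-reflexive (solve 1 (λ N → N :+ N :+ con 4 := con 2 :* (con 2 :+ N)) refl N)))) (*-mono-≤ (m≤m+n 3 224) (m≤n+m t p)))

    module Large (lt : N + N + 4 < p) .{{_ : NonZero p}} (L : ℕ) (hX : X ≤ 3 * p + n * n + L)
      (points-bound : ∀ μ → 1 ≤ μ → 3 * suc μ + 5 ≤ N → μ * μ * μ * n ≤ p → L * μ ≤ 16 * (suc N * p)) (points≤ : L ≤ p * suc N) where
      private
        n≤p : n ≤ p
        n≤p = ≤-trans (≤-trans (m≤m+n n (suc (suc N))) (≤-reflexive (solve 1 (λ N → (con 2 :+ N) :+ (con 2 :+ N) := N :+ N :+ con 4) refl N))) (<⇒≤ lt)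
        -- The final constant: 227 = 3 + 224 for `p` and 1 + 226 for `t`, where 224 = 16 · 14 is the
        -- loss when `μ` is about `N / 3`.
        collect : ∀ a b → a ≤ 224 → b ≤ 226 → L ≤ a * p + b * t → 3 * p + n * n + L ≤ 227 * (p + t)
        collect a b a≤ b≤ hL = begin
          3 * p + n * n + L              ≤⟨ +-mono-≤ (+-monoʳ-≤ (3 * p) (square≤ n≤p)) (≤-trans hL (+-mono-≤ (*-monoˡ-≤ p a≤) (*-monoˡ-≤ t b≤))) ⟩
          3 * p + t + (224 * p + 226 * t) ≡⟨ solve 2 (λ p t → con 3 :* p :+ t :+ (con 224 :* p :+ con 226 :* t) := con 227 :* (p :+ t)) refl p t ⟩
          227 * (p + t) ∎
        few : ∀ μ → 1 ≤ μ → 3 * suc (suc μ) + 5 ≤ 14 * μ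
        few μ 1≤μ = begin
          3 * suc (suc μ) + 5 ≡⟨ solve 1 (λ m → con 3 :* (con 2 :+ m) :+ con 5 := con 3 :* m :+ con 11 :* con 1) refl μ ⟩
          3 * μ + 11 * 1      ≤⟨ +-monoʳ-≤ (3 * μ) (*-monoʳ-≤ 11 1≤μ) ⟩
          3 * μ + 11 * μ      ≡⟨ sym (*-distribʳ-+ μ 3 11) ⟩
          14 * μ ∎
        by : (∃ λ μ → 1 ≤ μ × 3 * suc μ + 5 ≤ N × μ * μ * μ * n ≤ p × (N < 3 * suc (suc μ) + 5 ⊎ p < suc μ * suc μ * suc μ * n)) → 3 * p + n * n + L ≤ 227 * (p + t)
        by (μ , 1≤μ , a , b , inj₂ gt) = collect 0 32 z≤n (m≤m+n 32 194) (large-μ L (suc N) μ 1≤μ (n≤1+n (suc N)) (points-bound μ 1≤μ a b) (<⇒≤ gt))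
        by (μ , 1≤μ , a , b , inj₁ gt) = collect 224 0 ≤-refl z≤n (≤-trans (*-cancelʳ-≤ L (224 * p) μ {{>-nonZero 1≤μ}} (begin
          L * μ                   ≤⟨ points-bound μ 1≤μ a b ⟩
          16 * (suc N * p)        ≤⟨ *-monoʳ-≤ 16 (*-monoˡ-≤ p (≤-trans gt (few μ 1≤μ))) ⟩
          16 * (14 * μ * p)       ≡⟨ solve 2 (λ m p → con 16 :* (con 14 :* m :* p) := con 224 :* p :* m) refl μ p ⟩
          224 * p * μ ∎)) (≤-reflexive (sym (+-identityʳ (224 * p)))))

      bound : X ≤ 227 * (p + t)
      bound with 11 ≤? N
      ... | yes big = ≤-trans hX (by (choose-μ p n N n≤p big))
      -- Even `μ = 1` requires `3 * 2 + 5 = 11 ≤ N`. Below that, at most `N + 1 ≤ 11` points in each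
      -- column suffice.
      ... | no ≱11 = ≤-trans hX (collect 11 0 (m≤m+n 11 213) z≤n (≤-trans points≤ (≤-trans (*-monoʳ-≤ p (≰⇒> ≱11)) (≤-reflexive (solve 2 (λ p t → p :* con 11 := con 11 :* p :+ con 0 :* t) refl p t)))))

    p-large : N + N + 4 < p → .{{NonZero p}} → (∃ λ L → X ≤ 3 * p + n * n + L ×
      (∀ μ → 1 ≤ μ → 3 * suc μ + 5 ≤ N → μ * μ * μ * n ≤ p → L * μ ≤ 16 * (suc N * p)) × L ≤ p * suc N) → X ≤ 227 * (p + t)
    p-large lt (L , hX , points-bound , points≤) = Large.bound lt L hX points-bound points≤


-- The polynomial γ, its derivative and its degree.

module Gamma (R : CRing) where
  open RingTools R

  -- γ k y = (y + 1)^k - y^k, in a form that exhibits its degree k - 1.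
  γ : ℕ → Carrier → Carrier
  γ zero y = 0#
  γ (suc k) y = (y + 1#) * γ k y + y ^ k

  γ≈ : ∀ k y → γ k y ≈ (y + 1#) ^ k - y ^ k
  γ≈ zero y = sym (-‿inverseʳ 1#)
  γ≈ (suc k) y = trans (+-congʳ (*-congˡ (γ≈ k y))) (solve 3 (λ y p q → (y :+ con (+ 1)) :* (p :- q) :+ q := (y :+ con (+ 1)) :* p :- y :* q) refl y ((y + 1#) ^ k) (y ^ k))

  γ-cong : ∀ k {x y} → x ≈ y → γ k x ≈ γ k y
  γ-cong zero e = refl
  γ-cong (suc k) e = +-cong (*-cong (+-congʳ e) (γ-cong k e)) (^-congˡ k e)

  module _ (der : Der (idHom R)) where
    open Der der

    -- Differentiation lowers the index, so up to the factor `n` the critical points of `γ n` are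
    -- the zeros of `γ (n - 1)`.
    d-γ : ∀ k y → d (γ (suc k) y) ≈ (suc k · 1#) * γ k y * d y
    d-γ k y = begin
      d (γ (suc k) y) ≈⟨ trans (d-cong (γ≈ (suc k) y)) (d-sub _ _) ⟩
      d ((y + 1#) ^ suc k) - d (y ^ suc k)
        ≈⟨ +-cong (trans (d-^ (y + 1#) k) (*-congˡ (trans (d-+ y 1#) (trans (+-congˡ d-1) (+-identityʳ _))))) (-‿cong (d-^ y k)) ⟩
      (suc k · 1#) * (y + 1#) ^ k * d y - (suc k · 1#) * y ^ k * d y
        ≈⟨ solve 4 (λ m p q w → m :* p :* w :- m :* q :* w := m :* (p :- q) :* w) refl (suc k · 1#) ((y + 1#) ^ k) (y ^ k) (d y) ⟩
      (suc k · 1#) * ((y + 1#) ^ k - y ^ k) * d y ≈⟨ *-congʳ (*-congˡ (sym (γ≈ k y))) ⟩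
      (suc k · 1#) * γ k y * d y ∎

module GammaHom {R T : CRing} (h : Hom R T) where
  private
    module R = RingTools R
    module T = RingTools T
  open Hom h
  f-γ : ∀ k y → f (Gamma.γ R k y) T.≈ Gamma.γ T k (f y)
  f-γ zero y = f-0
  f-γ (suc k) y = T.trans (f-+ _ _) (T.+-cong (T.trans (f-* _ _) (T.*-cong (T.trans (f-+ y R.1#) (T.+-congˡ f-1)) (f-γ k y))) (f-^ y k))

module GammaPoly (R : CRing) (dom : Domain R) where
  open Division R dom
  open Gamma poly
  private
    module R = RingTools R

  deg-X+1 : Deg 2 (X + 1#)
  deg-X+1 = deg-⊕ (deg-∷ deg-C) (deg-mono (s≤s z≤n) deg-C)

  top-X+1 : coeff (X + 1#) 1 R.≈ R.1#
  top-X+1 = R.trans (coeff-⊕ X 1# 1) (R.+-identityʳ _)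

  deg-γ : ∀ k → Deg k (γ k X)
  deg-γ zero = deg-[]
  deg-γ (suc zero) = deg-⊕ (deg-zero (zeroʳ (X + 1#))) deg-C
  deg-γ (suc (suc k)) = deg-⊕ (deg-⊗ (X + 1#) deg-X+1 (deg-γ (suc k))) (proj₁ (monic-X^ (suc k)))

  top-γ : ∀ k → coeff (γ (suc k) X) k R.≈ suc k R.· R.1#
  top-γ zero = R.trans (coeff-⊕ ((X + 1#) * 0#) 1# 0) (R.trans (R.+-congʳ (at (zeroʳ (X + 1#)) 0)) (R.+-identityˡ _))
  top-γ (suc k) = R.trans (coeff-⊕ ((X + 1#) * γ (suc k) X) (X ^ suc k) (suc k)) (R.trans
    (R.+-cong (R.trans (top-⊗ (X + 1#) deg-X+1 (deg-γ (suc k))) (R.trans (R.*-cong top-X+1 (top-γ k)) (R.*-identityˡ _))) (proj₂ (monic-X^ (suc k))))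
    (R.trans (R.+-comm _ _) (R.sym (R.·-suc (suc k) R.1#))))

-- `noncritical` will provide smoothness on every factor through the point, and `off₁`, `off₂` keep
-- away from the lines that the Wronskian argument excludes.
record Good (K : CRing) (N : ℕ) : Set where
  open RingTools K
  open Gamma K
  field
    v₀ s₀ : Carrier
    curve : γ (suc (suc N)) s₀ ≈ γ (suc (suc N)) v₀
    noncritical : ¬ γ (suc N) v₀ ≈ 0#
    off₁  : ¬ s₀ - v₀ ≈ 0#
    off₂  : ¬ s₀ + v₀ + 1# ≈ 0#

Differ : ∀ K N → Good K N → Good K N → Set
Differ K N P Q = ¬ (Good.v₀ P ≈ Good.v₀ Q × Good.s₀ P ≈ Good.s₀ Q)
  where open RingTools K

-- Summation of the bounds over the prime factors.

module Assembly (K A : CRing) (domK : Domain K) (domA : Domain A) (gr : Graded K A) (splitting : Splitting A)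
  (p : ℕ) (p·1 : CommutativeRing._≈_ K (RingTools._·_ K p (CommutativeRing.1# K)) (CommutativeRing.0# K))
  (fermat : ∀ c → CommutativeRing._≈_ K (RingTools._^_ K c p) c)
  (small : ∀ i → 0 ℕ.< i → i ℕ.< p → ¬ CommutativeRing._≈_ K (RingTools._·_ K i (CommutativeRing.1# K)) (CommutativeRing.0# K))
  (N : ℕ) (2n<p : N ℕ.+ N ℕ.+ 4 ℕ.< p) (n⁻¹ : Car K)
  (n⁻¹-inverse : CommutativeRing._≈_ K (CommutativeRing._*_ K (RingTools._·_ K (suc (suc N)) (CommutativeRing.1# K)) n⁻¹) (CommutativeRing.1# K)) where
  open Bivariate K A domK domA gr
  open Gauss A domA splitting using (PrimePoly; prod; degrees; factorise)
  open PrimePoly using () renaming (e to deg₀; G to pol; monic to pol-monic; domain to pol-domain)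
  private
    module K = RingTools K
    module dK = Domain domK
    module A where
      open RingTools A public
      open Domain domA public
    module ι = Hom ι
    module γA = Gamma A
    module γK = Gamma K
    n : ℕ
    n = suc (suc N)
  open Gamma poly
  open GammaPoly A domA

  -- The leading coefficient of `γ n X` is `n`. Dividing by it makes `H` monic in `S` of degree
  -- `n - 1`, which also bounds its total degree; the factors inherit both properties.
  HB H : List A.Carrier
  HB = γ n X - γ n V
  H = κ.f n⁻¹ * HB

  γV : ∀ k → γ k V ≈ C (γA.γ k v)
  γV k = sym (GammaHom.f-γ (CHom A) k v)

  tot-γ : ∀ k {y} → Tot 2 y → Tot k (γ k y)
  tot-γ zero t = tot-zero refl
  tot-γ (suc k) {y} t = tot-+ (tot-mono (ℕ.≤-reflexive (ℕ.+-comm k 1)) (tot-cong (*-comm (γ k y) (y + 1#)) (tot-* (γ k y) (tot-γ k t) (tot-+ t (tot-mono (s≤s z≤n) tot-1))))) (tot-^ k)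
    where
    tot-^ : ∀ k → Tot (suc k) (y ^ k)
    tot-^ zero = tot-1
    tot-^ (suc k) = tot-* y t (tot-^ k)

  tot-H : Tot n H
  tot-H = tot-cong (*-comm HB (κ.f n⁻¹)) (tot-mono (ℕ.≤-reflexive (ℕ.+-identityʳ n)) (tot-* HB (tot-sub (tot-γ n tot-X) (tot-γ n tot-V)) (tot-κ n⁻¹)))

  monic-H : Monic (suc N) H
  monic-H = deg-C* (ι.f n⁻¹) (deg-sub (deg-γ n) (deg-cong (sym (γV n)) (deg-mono (s≤s z≤n) deg-C))) , top
    where
    top : coeff H (suc N) A.≈ A.1#
    top = A.begin
      coeff H (suc N) A.≈⟨ A.trans (coeff-C* (ι.f n⁻¹) HB (suc N)) (A.*-congˡ (coeff-sub (γ n X) (γ n V) (suc N))) ⟩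
      ι.f n⁻¹ A.* (coeff (γ n X) (suc N) A.- coeff (γ n V) (suc N)) A.≈⟨ A.*-congˡ (A.+-cong (top-γ (suc N)) (A.-‿cong (at (γV n) (suc N)))) ⟩
      ι.f n⁻¹ A.* (n A.· A.1# A.- A.0#) A.≈⟨ A.*-congˡ (A.trans (A.+-congˡ A.-0#≈0#) (A.trans (A.+-identityʳ _) (A.sym (ι.f-· n)))) ⟩
      ι.f n⁻¹ A.* ι.f (n K.· K.1#) A.≈⟨ A.trans (A.sym (ι.f-* _ _)) (A.trans (ι.f-cong (K.trans (K.*-comm _ _) n⁻¹-inverse)) ι.f-1) ⟩
      A.1# A.∎

  HB≈ : HB ≈ κ.f (n K.· K.1#) * H
  HB≈ = sym (trans (sym (*-assoc _ _ _)) (trans (*-congʳ (trans (sym (κ.f-* _ _)) (trans (κ.f-cong n⁻¹-inverse) κ.f-1))) (*-identityˡ HB)))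

  ∂V-HB : ∂V.∂ HB ≈ - ((n · 1#) * γ (suc N) V)
  ∂V-HB = trans (∂V.d-sub _ _) (trans (+-cong (trans (d-γ ∂V.∂Der (suc N) X) (trans (*-congˡ ∂V.∂-X) (zeroʳ _))) (-‿cong (trans (d-γ ∂V.∂Der (suc N) V) (trans (*-congˡ ∂V.∂-V) (*-identityʳ _))))) (+-identityˡ _))

  ∂V-H : ∂V.∂ H ≈ κ.f n⁻¹ * - ((n · 1#) * γ (suc N) V)
  ∂V-H = trans (∂V.d-* _ _) (trans (+-cong (*-congˡ ∂V-HB) (trans (*-congˡ (∂V.∂-κ n⁻¹)) (zeroʳ _))) (+-identityʳ _))

  monic-* : ∀ {a b P Q} → Monic a P → Monic b Q → Monic (a ℕ.+ b) (P * Q)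
  monic-* {P = P} (d₁ , t₁) (d₂ , t₂) = deg-⊗ P d₁ d₂ , A.trans (top-⊗ P d₁ d₂) (A.trans (A.*-cong t₁ t₂) (A.*-identityˡ _))

  prod-monic : ∀ Ps → Monic (degrees Ps) (prod Ps)
  prod-monic [] = deg-C , A.refl
  prod-monic (P ∷ Ps) = monic-* (pol-monic P) (prod-monic Ps)

  record Fact (P : PrimePoly) : Set where
    field
      total    : Tot (suc (suc (deg₀ P))) (pol P)
      cofactor : List A.Carrier
      divides  : H ≈ pol P * cofactor
      degree   : suc (deg₀ P) ℕ.< n

  -- `tot-factor` is applied to each factor against the product of the remaining ones, in both
  -- orders, so the bound on the total degree passes to either side.
  facts : ∀ Ps q → Tot (suc (degrees Ps)) (prod Ps) → H ≈ prod Ps * q → degrees Ps ℕ.< n → All Fact Ps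
  facts [] q t e l = []
  facts (P ∷ Ps) q t e l =
    record { total = Homogenise.tot-factor (pol-monic P) (prod-monic Ps) t ; cofactor = prod Ps * q ; divides = trans e (*-assoc _ _ _) ; degree = ℕ.≤-<-trans (ℕ.m≤m+n (suc (deg₀ P)) (degrees Ps)) l } ∷
    facts Ps (pol P * q) (Homogenise.tot-factor (prod-monic Ps) (pol-monic P) (tot-cong (*-comm (pol P) (prod Ps)) (tot-mono (ℕ.≤-reflexive (≡.cong suc (ℕ.+-comm (suc (deg₀ P)) (degrees Ps)))) t)))
      (trans e (solve 3 (λ a b c → a :* b :* c := b :* (a :* c)) refl (pol P) (prod Ps) q)) (ℕ.≤-<-trans (ℕ.m≤n+m (degrees Ps) (suc (deg₀ P))) l)

  module At (g : Good K N) where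
    open Good g public
    open EvalAt v₀ s₀ public
    open Hom evB public renaming (f to ev; f-cong to ev-cong; f-+ to ev-+; f-* to ev-*; f-0 to ev-0; f-1 to ev-1; f-neg to ev-neg; f-sub to ev-sub) using (f-·)

  module _ (g : Good K N) where
    open At g

    ev-γ : ∀ k y → ev (γ k y) K.≈ γK.γ k (ev y)
    ev-γ = GammaHom.f-γ evB

    ev-H : ev H K.≈ K.0#
    ev-H = K.trans (ev-* _ _) (K.trans (K.*-congˡ (K.trans (ev-sub _ _) (K.trans (K.+-cong (K.trans (ev-γ n X) (K.trans (γK.γ-cong n ev-X) curve)) (K.-‿cong (K.trans (ev-γ n V) (γK.γ-cong n ev-V)))) (K.-‿inverseʳ _)))) (K.zeroʳ _))

    ev-∂H : ¬ ev (∂V.∂ H) K.≈ K.0#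
    ev-∂H z = dK.*≉0 n⁻¹≉0 (λ w → dK.*≉0 n≉0 noncritical (K.trans (K.sym (K.-‿involutive _)) (K.trans (K.-‿cong w) K.-0#≈0#)))
        (K.trans (K.sym (K.trans (ev-cong ∂V-H) (K.trans (ev-* _ _) (K.*-cong (ev-κ n⁻¹) (K.trans (ev-neg _) (K.-‿cong (K.trans (ev-* _ _) (K.*-cong (f-· n) (K.trans (ev-γ (suc N) V) (γK.γ-cong (suc N) ev-V)))))))))) z)
      where
      n≉0 : ¬ n K.· K.1# K.≈ K.0#
      n≉0 w = dK.1≉0 (K.trans (K.sym n⁻¹-inverse) (K.trans (K.*-congʳ w) (K.zeroˡ _)))
      n⁻¹≉0 : ¬ n⁻¹ K.≈ K.0#
      n⁻¹≉0 w = dK.1≉0 (K.trans (K.sym n⁻¹-inverse) (K.trans (K.*-congˡ w) (K.zeroʳ _)))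

  module Factor (P : PrimePoly) (fact : Fact P) (μ : ℕ) (1≤μ : 1 ℕ.≤ μ) (μ-small : 3 ℕ.* suc μ ℕ.+ 5 ℕ.≤ N) (μ-p : μ ℕ.* μ ℕ.* μ ℕ.* n ℕ.≤ p) where
    open Fact fact
    private
      e : ℕ
      e = deg₀ P
      G : List A.Carrier
      G = pol P
    module Comp = Component K A domK domA gr p p·1 fermat small e G (pol-monic P) total (pol-domain P) N 2n<p
    open Quotient (PolyRing.poly A) G
    private
      module R = RingTools (Quotient.quotient (PolyRing.poly A) G)

    rel : ((X + 1#) R.^ n - X R.^ n) - ((V + 1#) R.^ n - V R.^ n) ≃ 0#
    rel = ≃-trans (≃-sym (+-cong' (+-cong' (Hom.f-^ quotHom (X + 1#) n) (neg-cong' (Hom.f-^ quotHom X n))) (neg-cong' (+-cong' (Hom.f-^ quotHom (V + 1#) n) (neg-cong' (Hom.f-^ quotHom V n))))))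
      (≃-trans (≈⇒≃ (sym (+-cong (γ≈ n X) (-‿cong (γ≈ n V))))) (∣⇒≃0 (div (κ.f (n K.· K.1#) * cofactor)
        (trans HB≈ (trans (*-congˡ divides) (solve 3 (λ a b c → a :* (b :* c) := b :* (a :* c)) refl (κ.f (n K.· K.1#)) G cofactor))))))

    on? : ∀ g → Dec (At.ev g G K.≈ K.0#)
    on? g = dK.dec0 (At.ev g G)

    -- At a zero of `G` the product rule leaves `∂V H = cofactor · ∂V G`, so a zero of `∂V G` there
    -- would be one of `∂V H`, against `ev-∂H`.
    good : ∀ g → At.ev g G K.≈ K.0# → Comp.GoodPoint
    good g z = record { v₀ = v₀ ; s₀ = s₀ ; on = z ; off₁ = off₁ ; off₂ = off₂
      ; smooth = λ w → ev-∂H g (K.trans (ev-cong (trans (∂V.d-cong divides) (∂V.d-* G cofactor))) (K.trans (ev-+ _ _)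
          (K.trans (K.+-cong (K.trans (ev-* _ _) (K.trans (K.*-congʳ z) (K.zeroˡ _))) (K.trans (ev-* _ _) (K.trans (K.*-congˡ w) (K.zeroʳ _)))) (K.+-identityˡ _)))) }
      where open At g

    ons : List (Good K N) → List Comp.GoodPoint
    ons [] = []
    ons (g ∷ gs) with on? g
    ... | yes z = good g z ∷ ons gs
    ... | no _ = ons gs

    offs : List (Good K N) → List (Good K N)
    offs [] = []
    offs (g ∷ gs) with on? g
    ... | yes _ = offs gs
    ... | no _ = g ∷ offs gs

    length-split : ∀ gs → length gs ≡ length (ons gs) ℕ.+ length (offs gs)
    length-split [] = ≡.refl
    length-split (g ∷ gs) with on? g
    ... | yes _ = ≡.cong suc (length-split gs)
    ... | no _ = ≡.trans (≡.cong suc (length-split gs)) (≡.sym (ℕ.+-suc (length (ons gs)) (length (offs gs))))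

    all-ons : ∀ {Q : K.Carrier → K.Carrier → Set} gs → All (λ g → Q (Good.v₀ g) (Good.s₀ g)) gs → All (λ g → Q (Comp.GoodPoint.v₀ g) (Comp.GoodPoint.s₀ g)) (ons gs)
    all-ons [] [] = []
    all-ons {Q} (g ∷ gs) (q ∷ qs) with on? g
    ... | yes _ = q ∷ all-ons {Q} gs qs
    ... | no _ = all-ons {Q} gs qs

    pairs-ons : ∀ gs → AllPairs (Differ K N) gs → AllPairs Comp.Differ (ons gs)
    pairs-ons [] [] = []
    pairs-ons (g ∷ gs) (q ∷ qs) with on? g
    ... | yes _ = all-ons {λ v s → ¬ (Good.v₀ g K.≈ v × Good.s₀ g K.≈ s)} gs q ∷ pairs-ons gs qs
    ... | no _ = pairs-ons gs qs

    all-offs : ∀ {Q : Good K N → Set} gs → All Q gs → All Q (offs gs)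
    all-offs [] [] = []
    all-offs (g ∷ gs) (q ∷ qs) with on? g
    ... | yes _ = all-offs gs qs
    ... | no _ = q ∷ all-offs gs qs

    pairs-offs : ∀ gs → AllPairs (Differ K N) gs → AllPairs (Differ K N) (offs gs)
    pairs-offs [] [] = []
    pairs-offs (g ∷ gs) (q ∷ qs) with on? g
    ... | yes _ = pairs-offs gs qs
    ... | no _ = all-offs gs q ∷ pairs-offs gs qs

    off-zero : ∀ Q gs → All (λ g → At.ev g (G * Q) K.≈ K.0#) gs → All (λ g → At.ev g Q K.≈ K.0#) (offs gs)
    off-zero Q [] [] = []
    off-zero Q (g ∷ gs) (z ∷ zs) with on? g
    ... | yes _ = off-zero Q gs zs
    ... | no ne = dK.cancel0 ne (K.trans (K.sym (At.ev-* g G Q)) z) ∷ off-zero Q gs zs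

    bound-points : ∀ Qs → AllPairs Comp.Differ Qs → length Qs ℕ.* μ ℕ.≤ 16 ℕ.* (suc e ℕ.* p)
    bound-points [] _ = z≤n
    bound-points Qs@(Q ∷ _) dist = go (length (idx (suc e) μ)) ≡.refl
      where
      -- The Wronskian bound requires a point, hence the separate empty case. It turns
      -- `3 (μ + 1) + 5 ≤ N` into `μ ≤ e`, so the monomials of degree at most `μ` are independent on
      -- `G`.
      μ<d : μ ℕ.< suc e
      μ<d = ℕ.*-cancelˡ-≤ 3 (ℕ.+-cancelʳ-≤ 5 (3 ℕ.* suc μ) (3 ℕ.* suc e) (ℕ.≤-trans μ-small (ℕ.≤-trans (Comp.degree-bound rel Q)
        (ℕ.≤-reflexive (≡.cong (λ k → suc e ℕ.+ (suc e ℕ.+ k) ℕ.+ 5) (≡.sym (ℕ.+-identityʳ (suc e))))))))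
      triangle : 2 ℕ.* length (idx (suc e) μ) ≡ suc μ ℕ.* (2 ℕ.+ μ)
      triangle = ≡.trans (≡.cong (2 ℕ.*_) (length-idx (suc e) μ)) (len-triangle (suc e) μ μ<d)
      go : ∀ L → length (idx (suc e) μ) ≡ L → length Qs ℕ.* μ ℕ.≤ 16 ℕ.* (suc e ℕ.* p)
      go zero eq = ⊥-elim (absurd (≡.trans (≡.sym triangle) (≡.cong (2 ℕ.*_) eq)))
        where
        absurd : ¬ suc μ ℕ.* (2 ℕ.+ μ) ≡ 0
        absurd ()
      go (suc M) eq = Num.bound (length Qs) (Comp.count μ M eq Num.degree<p Num.M≤p Qs dist)
        where module Num = NatBounds.Numerics e μ M p n 1≤μ (≡.trans (≡.cong (2 ℕ.*_) (≡.sym eq)) triangle) degree μ-p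

  module Total (μ : ℕ) (1≤μ : 1 ℕ.≤ μ) (μ-small : 3 ℕ.* suc μ ℕ.+ 5 ℕ.≤ N) (μ-p : μ ℕ.* μ ℕ.* μ ℕ.* n ℕ.≤ p) where

    -- Each point is charged to the first factor that vanishes there; the others are zeros of the
    -- remaining product.
    bound-list : ∀ Ps → All Fact Ps → ∀ gs → AllPairs (Differ K N) gs → All (λ g → At.ev g (prod Ps) K.≈ K.0#) gs → length gs ℕ.* μ ℕ.≤ 16 ℕ.* (degrees Ps ℕ.* p)
    bound-list [] [] [] _ _ = z≤n
    bound-list [] [] (g ∷ gs) _ (z ∷ _) = ⊥-elim (dK.1≉0 (K.trans (K.sym (At.ev-1 g)) z))
    bound-list (P ∷ Ps) (f ∷ fs) gs dist zs = ≡.subst (λ k → k ℕ.* μ ℕ.≤ _) (≡.sym (F.length-split gs))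
      (NatBounds.add-bounds (length (F.ons gs)) (length (F.offs gs)) (suc (deg₀ P)) (degrees Ps) μ p
        (F.bound-points (F.ons gs) (F.pairs-ons gs dist)) (bound-list Ps fs (F.offs gs) (F.pairs-offs gs dist) (F.off-zero (prod Ps) gs zs)))
      where module F = Factor P f μ 1≤μ μ-small μ-p

    -- Prime factorisations exist only up to ¬ ¬, which the decidable goal absorbs.
    main-bound : ∀ gs → AllPairs (Differ K N) gs → length gs ℕ.* μ ℕ.≤ 16 ℕ.* (suc N ℕ.* p)
    main-bound gs dist = decidable-stable (_ ℕ.≤? _) λ no → factorise (suc (suc N)) (suc N) H ℕ.≤-refl monic-H λ { (Ps , prod≈ , deg≡) →
      no (≡.subst (λ k → length gs ℕ.* μ ℕ.≤ 16 ℕ.* (k ℕ.* p)) deg≡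
        (bound-list Ps (facts Ps 1# (tot-cong (sym prod≈) (≡.subst (λ k → Tot (suc k) H) (≡.sym deg≡) tot-H)) (trans (sym prod≈) (sym (*-identityʳ _))) (≡.subst (ℕ._< n) (≡.sym deg≡) ℕ.≤-refl))
          gs dist (All.universal (λ g → K.trans (At.ev-cong g prod≈) (ev-H g)) gs))) }

-- Additivity of the Frobenius map.

module Frobenius (K : CRing) (domK : Domain K) (p : ℕ)
  (p·1 : CommutativeRing._≈_ K (RingTools._·_ K p (CommutativeRing.1# K)) (CommutativeRing.0# K))
  (small : ∀ i → 0 ℕ.< i → i ℕ.< p → ¬ CommutativeRing._≈_ K (RingTools._·_ K i (CommutativeRing.1# K)) (CommutativeRing.0# K)) where
  open Division K domK
  private
    module K = RingTools K
    module dK = Domain domK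
    gr = PolyGraded.graded K
  ∂Der : Der (idHom poly)
  ∂Der = Graded.derT gr (idHom poly) 1#
  open Der ∂Der

  d-∷ : ∀ a f → d (a ∷ f) ≈ f + (K.0# ∷ d f)
  d-∷ a f = begin
    d (a ∷ f)              ≈⟨ trans (d-cong (∷-decomp a f)) (d-+ (C a) (X * f)) ⟩
    d (C a) + d (X * f)    ≈⟨ +-cong (Graded.der-ι gr (idHom poly) 1# a) (d-* X f) ⟩
    0# + (X * d f + f * d X) ≈⟨ trans (+-identityˡ _) (+-cong (PolyGraded.X* K (d f)) (trans (*-congˡ (Graded.der-v gr (idHom poly) 1#)) (*-identityʳ f))) ⟩
    (K.0# ∷ d f) + f       ≈⟨ +-comm _ f ⟩
    f + (K.0# ∷ d f) ∎

  coeff-d : ∀ f i → coeff (d f) i K.≈ (suc i K.· K.1#) K.* coeff f (suc i)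
  coeff-d [] i = K.trans (at d-0 i) (K.sym (K.zeroʳ _))
  coeff-d (a ∷ f) i = K.trans (at (d-∷ a f) i) (K.trans (coeff-⊕ f (K.0# ∷ d f) i) (go i))
    where
    go : ∀ i → coeff f i K.+ coeff (K.0# ∷ d f) i K.≈ (suc i K.· K.1#) K.* coeff f i
    go zero = K.trans (K.+-identityʳ _) (K.sym (K.*-identityˡ _))
    go (suc i) = K.trans (K.+-congˡ (coeff-d f i)) (K.trans (K.solve 2 (λ m c → c K.:+ m K.:* c K.:= (K.con (+ 1) K.:+ m) K.:* c) K.refl (suc i K.· K.1#) (coeff f (suc i)))
      (K.*-congʳ (K.sym (K.·-suc (suc i) K.1#))))

  private
    module γP = Gamma poly
    module γK = Gamma K
    g : List K.Carrier
    g = γP.γ p X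

    dg : ∀ q → q K.· K.1# K.≈ K.0# → d (γP.γ q X) ≈ 0#
    dg zero z = d-0
    dg (suc q) z = trans (γP.d-γ ∂Der q X) (trans (*-congʳ (trans (*-congʳ (trans (sym (Hom.f-· (CHom K) (suc q))) (C-zero z))) (zeroˡ _))) (zeroˡ _))

    -- At positive indices below `p` the vanishing derivative kills the coefficient; from `p` on the
    -- degree of `γ p` does.
    const : Deg 1 g
    const = deg λ { (suc i) l → go i }
      where
      go : ∀ i → coeff g (suc i) K.≈ K.0#
      go i with suc i ℕ.<? p
      ... | yes lt = dK.cancel0 (small (suc i) (s≤s z≤n) lt) (K.trans (K.sym (coeff-d g i)) (at (dg p p·1) i))
      ... | no nlt = vanish (GammaPoly.deg-γ K domK p) (suc i) (ℕ.≮⇒≥ nlt)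

    ev-g : ∀ x → γK.γ p x K.≈ coeff g 0
    ev-g x = K.trans (K.sym (K.trans (GammaHom.f-γ E.evHom p X) (γK.γ-cong p E.ev-X))) (K.trans (E.ev-cong (deg1⇒C const)) (E.ev-C (coeff g 0)))
      where module E = Evaluation (idHom K) x

  1^ᴷ : ∀ k → K.1# K.^ k K.≈ K.1#
  1^ᴷ zero = K.refl
  1^ᴷ (suc k) = K.trans (K.*-identityˡ _) (1^ᴷ k)

  0<p⇒0^p : 0 ℕ.< p → K.0# K.^ p K.≈ K.0#
  0<p⇒0^p (s≤s _) = K.zeroˡ _

  -- The derivative of (X + 1)^p - X^p vanishes and its degree is less than p.
  freshman : 0 ℕ.< p → ∀ x → (x K.+ K.1#) K.^ p K.≈ x K.^ p K.+ K.1#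
  freshman 0<p x = K.trans (K.solve 2 (λ a b → a K.:= b K.:+ (a K.:- b)) K.refl _ (x K.^ p)) (K.+-congˡ (K.trans (K.sym (γK.γ≈ p x)) (K.trans (ev-g x) (K.trans (K.sym (ev-g K.0#))
    (K.trans (γK.γ≈ p K.0#) (K.trans (K.+-cong (K.trans (K.^-congˡ p (K.+-identityˡ K.1#)) (1^ᴷ p)) (K.trans (K.-‿cong (0<p⇒0^p 0<p)) K.-0#≈0#)) (K.+-identityʳ _)))))))

-- The number of roots of a polynomial.

module Roots (R : CRing) (dom : Domain R) where
  open Division R dom
  private
    module R = RingTools R
    module dR = Domain dom
    module E (x : R.Carrier) = Evaluation (idHom R) x

  monic-linear : ∀ x → Monic 1 (X - C x)
  monic-linear x = deg-sub (deg-∷ deg-C) (deg-mono (s≤s z≤n) deg-C) , R.trans (coeff-sub X (C x) 1) (R.trans (R.+-congˡ R.-0#≈0#) (R.+-identityʳ _))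

  ev-linear : ∀ x y → E.ev y (X - C x) R.≈ y R.- x
  ev-linear x y = R.trans (Hom.f-sub (E.evHom y) X (C x)) (R.+-cong (E.ev-X y) (R.-‿cong (E.ev-C y x)))

  root-factor : ∀ f x → E.ev x f R.≈ R.0# → ∃ λ q → f ≈ (X - C x) * q
  root-factor f x z = go (divide (monic-linear x) f)
    where
    go : (∃ λ q → ∃ λ r → f ≈ (X - C x) * q + r × Deg 1 r) → ∃ λ q → f ≈ (X - C x) * q
    go (q , r , e , dr) = q , trans e (trans (+-congˡ (trans (deg1⇒C dr) (C-zero r₀≈0))) (+-identityʳ _))
      where
      r₀≈0 : coeff r 0 R.≈ R.0#
      r₀≈0 = R.trans (R.sym (R.trans (E.ev-cong x (trans e (+-congˡ (deg1⇒C dr)))) (R.trans (E.ev-⊕ x ((X - C x) * q) (C (coeff r 0)))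
        (R.trans (R.+-cong (R.trans (E.ev-⊗ x (X - C x) q) (R.trans (R.*-congʳ (R.trans (ev-linear x x) (R.-‿inverseʳ x))) (R.zeroˡ _))) (E.ev-C x _)) (R.+-identityˡ _))))) z

  roots : ∀ m f → Lead m f → ∀ xs → AllPairs (λ x y → ¬ x R.≈ y) xs → All (λ x → E.ev x f R.≈ R.0#) xs → length xs ℕ.≤ m
  roots m f lf [] _ _ = z≤n
  roots m f lf (x ∷ xs) (px ∷ pxs) (zx ∷ zxs) = go m lf (root-factor f x zx)
    where
    go : ∀ m → Lead m f → (∃ λ q → f ≈ (X - C x) * q) → suc (length xs) ℕ.≤ m
    go m lf (q , e) = [ (λ z → ⊥-elim (lead≉0 lf (trans e (trans (*-congˡ z) (zeroʳ _))))) , step ]′ (lead? q)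
      where
      zq : All (λ y → E.ev y q R.≈ R.0#) xs
      zq = All.zipWith (λ { {y} (ne , z) → dR.cancel0 (λ w → ne (R.sym (dR.x-y≈0 (R.trans (R.sym (ev-linear x y)) w)))) (R.trans (R.sym (E.ev-⊗ y (X - C x) q)) (R.trans (E.ev-cong y (sym e)) z)) }) (px , zxs)
      step : (∃ λ k → Lead k q) → suc (length xs) ℕ.≤ m
      step (k , lq) = ≡.subst (suc (length xs) ℕ.≤_) (≡.sym (lead-unique lf (lead-cong (sym e) (lead-* (monic⇒lead (monic-linear x)) lq)))) (s≤s (roots k q lq xs pxs zq))

-- The prime field as a quotient of the integers.

module ModP (p : ℕ) (pr : Prime p) where
  ℤR : CRing
  ℤR = ℤ.+-*-commutativeRing

  K : CRing
  K = Quotient.quotient ℤR (+ p)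

  open Quotient ℤR (+ p)
  private
    module K = RingTools K
    module Z = RingTools ℤR

  ∣⇒≃ : ∀ x → p ℕ.∣ ℤ.∣ x ∣ → x ≃ + 0
  ∣⇒≃ x d with ℤ.∣ᵤ⇒∣ {+ p} {x} d
  ... | ℤ.divides q e = ∣⇒≃0 (div q (≡.trans e (ℤ.*-comm q (+ p))))

  ≃⇒∣ : ∀ x → x ≃ + 0 → p ℕ.∣ ℤ.∣ x ∣
  ≃⇒∣ x z with ≃0⇒∣ z
  ... | div q e = ℕ.divides ℤ.∣ q ∣ (≡.trans (≡.cong ℤ.∣_∣ e) (≡.trans (ℤ.abs-* (+ p) q) (ℕ.*-comm p ℤ.∣ q ∣)))

  1<p : 1 ℕ.< p
  1<p = ℕ.nonTrivial⇒n>1 p {{prime⇒nonTrivial pr}}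

  not-small : ∀ i → 0 ℕ.< i → i ℕ.< p → ¬ (+ i) ≃ + 0
  not-small i 0<i i<p z = ℕ.<⇒≱ i<p (ℕ.∣⇒≤ {{ℕ.>-nonZero 0<i}} (≃⇒∣ (+ i) z))

  domK : Domain K
  domK = record
    { zd = λ x y z → Data.Sum.map (∣⇒≃ x) (∣⇒≃ y) (euclidsLemma ℤ.∣ x ∣ ℤ.∣ y ∣ pr (≡.subst (p ℕ.∣_) (ℤ.abs-* x y) (≃⇒∣ (x ℤ.* y) z)))
    ; dec0 = λ x → Relation.Nullary.Decidable.map′ (∣⇒≃ x) (≃⇒∣ x) (p ∣? ℤ.∣ x ∣)
    ; 1≉0 = not-small 1 (s≤s z≤n) 1<p }

  nat≃ : ∀ i → i K.· K.1# ≃ + i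
  nat≃ i = K.trans (K.sym (Hom.f-· quotHom i)) (≈⇒≃ (go i))
    where
    go : ∀ i → i Z.· (+ 1) ≡ + i
    go zero = ≡.refl
    go (suc i) = ≡.trans (Z.·-suc i (+ 1)) (≡.cong (ℤ._+_ (+ 1)) (go i))

  p·1 : p K.· K.1# ≃ + 0
  p·1 = K.trans (nat≃ p) (∣⇒≃ (+ p) ℕ.∣-refl)

  small : ∀ i → 0 ℕ.< i → i ℕ.< p → ¬ i K.· K.1# ≃ + 0
  small i a b z = not-small i a b (K.trans (K.sym (nat≃ i)) z)

  private
    freshman = Frobenius.freshman K domK p p·1 small (ℕ.<-trans (s≤s z≤n) 1<p)
    0^p = Frobenius.0<p⇒0^p K domK p p·1 small (ℕ.<-trans (s≤s z≤n) 1<p)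

  -- The Frobenius identity steps by one in either direction, so the induction starts at 0 and runs
  -- both ways through the integers.
  fermat : ∀ c → c K.^ p ≃ c
  fermat (+ zero) = 0^p
  fermat (+ suc n) = K.trans (K.^-congˡ p (≈⇒≃ (ℤ.+-comm (+ 1) (+ n)))) (K.trans (freshman (+ n)) (K.trans (K.+-congʳ (fermat (+ n))) (≈⇒≃ (ℤ.+-comm (+ n) (+ 1)))))
  fermat -[1+ n ] = K.+-cancelʳ (+ 1) _ _ (K.trans (K.sym (freshman -[1+ n ])) (back n))
    where
    back : ∀ n → (-[1+ n ] ℤ.+ + 1) K.^ p ≃ -[1+ n ] ℤ.+ + 1
    back zero = 0^p
    back (suc n) = fermat -[1+ n ]

  -- A total function; Fermat makes it the inverse of every nonzero `x`.
  recip : ℤ → ℤ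
  recip x = x K.^ (p ℕ.∸ 2)

  recip-inverse : ∀ x → ¬ x ≃ + 0 → x ℤ.* recip x ≃ + 1
  recip-inverse x ne = Domain.cancelˡ domK {x} {x ℤ.* recip x} {+ 1} ne (K.trans (go p 1<p (fermat x)) (K.sym (K.*-identityʳ x)))
    where
    go : ∀ q → 1 ℕ.< q → x K.^ q ≃ x → x ℤ.* (x ℤ.* x K.^ (q ℕ.∸ 2)) ≃ x
    go (suc zero) (s≤s ()) z
    go (suc (suc q)) lt z = z

  fld : Field K
  fld = record { dom = domK ; recip = recip ; recip-inverse = recip-inverse }

  apart : ∀ {x y} → x ℕ.< y → y ℕ.< p → ¬ + y ≃ + x
  apart {x} {y} l y<p (quo q e) = not-small (y ℕ.∸ x) (ℕ.m<n⇒0<n∸m l) (ℕ.≤-<-trans (ℕ.m∸n≤m y x) y<p)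
    (∣⇒≃0 (div q (≡.trans (≡.sym (≡.trans (ℤ.m-n≡m⊖n y x) (ℤ.⊖-≥ (ℕ.<⇒≤ l)))) e)))

  nat-inj : ∀ {x y} → x ℕ.< p → y ℕ.< p → + x ≃ + y → x ≡ y
  nat-inj {x} {y} x<p y<p z with ℕ.<-cmp x y
  ... | tri≈ _ e _ = e
  ... | tri< l _ _ = ⊥-elim (apart l y<p (≃-sym z))
  ... | tri> _ _ l = ⊥-elim (apart l x<p z)

  pow≃ : ∀ a k → a ℤ.^ k ≃ a K.^ k
  pow≃ a zero = ≈⇒≃ ≡.refl
  pow≃ a (suc k) = *-cong' {a} {a} {a ℤ.^ k} {a K.^ k} (≈⇒≃ ≡.refl) (pow≃ a k)

-- The change of variables from F_n to γ.

module Polynomial (R : CRing) where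
  open RingTools R

  F : ℕ → Carrier → Carrier → Carrier
  F n x y = x ^ n + y ^ n - (x + y - 1#) ^ n - 1#

module Transform (R : CRing) where
  open RingTools R
  open Gamma R

  *-^ : ∀ a b k → (a * b) ^ k ≈ a ^ k * b ^ k
  *-^ a b zero = sym (*-identityˡ 1#)
  *-^ a b (suc k) = trans (*-congˡ (*-^ a b k)) (solve 4 (λ a b c d → (a :* b) :* (c :* d) := (a :* c) :* (b :* d)) refl a b (a ^ k) (b ^ k))

  -- The change of variables v = 1/(x-1), s = y/(x-1).
  transform : ∀ k x y z v → x * v ≈ v + 1# → z * v ≈ y * v + 1# → x ^ k + y ^ k - z ^ k - 1# ≈ 0# → γ k (y * v) ≈ γ k v
  transform k x y z v xv zv rel = sym (begin
    γ k v ≈⟨ solve 2 (λ a b → a := (a :- b) :+ b) refl _ (γ k (y * v)) ⟩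
    (γ k v - γ k (y * v)) + γ k (y * v) ≈⟨ +-congʳ difference ⟩
    0# + γ k (y * v) ≈⟨ +-identityˡ _ ⟩
    γ k (y * v) ∎)
    where
    difference : γ k v - γ k (y * v) ≈ 0#
    difference = begin
      γ k v - γ k (y * v) ≈⟨ +-cong (γ≈ k v) (-‿cong (γ≈ k (y * v))) ⟩
      ((v + 1#) ^ k - v ^ k) - ((y * v + 1#) ^ k - (y * v) ^ k)
        ≈⟨ +-cong (+-congʳ (trans (^-congˡ k (sym xv)) (*-^ x v k))) (-‿cong (+-cong (trans (^-congˡ k (sym zv)) (*-^ z v k)) (-‿cong (*-^ y v k)))) ⟩
      (x ^ k * v ^ k - v ^ k) - (z ^ k * v ^ k - y ^ k * v ^ k)
        ≈⟨ solve 4 (λ x y z v → (x :* v :- v) :- (z :* v :- y :* v) := v :* (x :+ y :- z :- con (+ 1))) refl (x ^ k) (y ^ k) (z ^ k) (v ^ k) ⟩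
      v ^ k * (x ^ k + y ^ k - z ^ k - 1#) ≈⟨ trans (*-congˡ rel) (zeroʳ _) ⟩
      0# ∎

-- Counting solutions column by column.

module Lists where
  length-filter-row : ∀ {Q : ℕ × ℕ → Set} (Q? : ∀ xy → Dec (Q xy)) x ys zs →
    length (filter Q? (map (x ,_) ys ++ zs)) ≡ length (filter (λ y → Q? (x , y)) ys) ℕ.+ length (filter Q? zs)
  length-filter-row Q? x [] zs = ≡.refl
  length-filter-row Q? x (y ∷ ys) zs with Q? (x , y)
  ... | yes _ = ≡.cong suc (length-filter-row Q? x ys zs)
  ... | no _ = length-filter-row Q? x ys zs

  at-most-one : ∀ {Q : ℕ → Set} (Q? : ∀ y → Dec (Q y)) (B : ℕ → Set) → (∀ {y y'} → B y → B y' → Q y → Q y' → y ≡ y') →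
    ∀ ys → AllPairs (λ y y' → ¬ y ≡ y') ys → All B ys → length (filter Q? ys) ℕ.≤ 1
  at-most-one Q? B inj [] _ _ = z≤n
  at-most-one {Q} Q? B inj (y ∷ ys) (u ∷ us) (b ∷ bs) with Q? y
  ... | no _ = at-most-one Q? B inj ys us bs
  ... | yes q = s≤s (ℕ.≤-reflexive (none ys u bs))
    where
    none : ∀ ys → All (λ y' → ¬ y ≡ y') ys → All B ys → length (filter Q? ys) ≡ 0
    none [] _ _ = ≡.refl
    none (y' ∷ ys) (n ∷ ns) (b' ∷ bs) with Q? y'
    ... | yes q' = ⊥-elim (n (inj b b' q q'))
    ... | no _ = none ys ns bs

Distinctℕ : List ℕ → Set
Distinctℕ = AllPairs (λ x y → ¬ x ≡ y)

-- `Z` marks the zeros in one column; `O` and `P` will be the conditions that put such a zero on one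
-- of the two lines.
module Rows (Good : Set) (Z O P : ℕ → Set) (z? : ∀ y → Dec (Z y)) (o? : ∀ y → Dec (O y)) (p? : ∀ y → Dec (P y))
  (mk : ∀ y → Z y → ¬ O y → ¬ P y → Good) where

  row : List ℕ → List Good
  row [] = []
  row (y ∷ ys) with z? y | o? y | p? y
  ... | yes z | no o | no q = mk y z o q ∷ row ys
  ... | yes _ | no _ | yes _ = row ys
  ... | yes _ | yes _ | _ = row ys
  ... | no _ | _ | _ = row ys

  length-row : ∀ ys → length (filter z? ys) ℕ.≤ length (row ys) ℕ.+ (length (filter o? ys) ℕ.+ length (filter p? ys))
  length-row [] = z≤n
  length-row (y ∷ ys) with z? y | o? y | p? y
  ... | yes _ | no _ | no _ = s≤s (length-row ys)
  ... | yes _ | no _ | yes _ = ℕ.≤-trans (s≤s (length-row ys)) (ℕ.≤-reflexive (≡.trans (≡.sym (ℕ.+-suc (length (row ys)) _)) (≡.cong (length (row ys) ℕ.+_) (≡.sym (ℕ.+-suc (length (filter o? ys)) _)))))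
  ... | yes _ | yes _ | no _ = ℕ.≤-trans (s≤s (length-row ys)) (ℕ.≤-reflexive (≡.sym (ℕ.+-suc (length (row ys)) _)))
  ... | yes _ | yes _ | yes _ = ℕ.≤-trans (s≤s (length-row ys)) (ℕ.≤-trans (ℕ.≤-reflexive (≡.sym (ℕ.+-suc (length (row ys)) _))) (ℕ.+-monoʳ-≤ (length (row ys)) (s≤s (ℕ.+-monoʳ-≤ (length (filter o? ys)) (ℕ.n≤1+n _)))))
  ... | no _ | no _ | no _ = length-row ys
  ... | no _ | no _ | yes _ = ℕ.≤-trans (length-row ys) (ℕ.+-monoʳ-≤ (length (row ys)) (ℕ.+-monoʳ-≤ (length (filter o? ys)) (ℕ.n≤1+n _)))
  ... | no _ | yes _ | no _ = ℕ.≤-trans (length-row ys) (ℕ.+-monoʳ-≤ (length (row ys)) (ℕ.n≤1+n _))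
  ... | no _ | yes _ | yes _ = ℕ.≤-trans (length-row ys) (ℕ.+-monoʳ-≤ (length (row ys)) (ℕ.≤-trans (ℕ.+-monoʳ-≤ (length (filter o? ys)) (ℕ.n≤1+n _)) (ℕ.n≤1+n _)))

  row≤ : ∀ ys → length (row ys) ℕ.≤ length (filter z? ys)
  row≤ [] = z≤n
  row≤ (y ∷ ys) with z? y | o? y | p? y
  ... | yes _ | no _ | no _ = s≤s (row≤ ys)
  ... | yes _ | no _ | yes _ = ℕ.≤-trans (row≤ ys) (ℕ.n≤1+n _)
  ... | yes _ | yes _ | _ = ℕ.≤-trans (row≤ ys) (ℕ.n≤1+n _)
  ... | no _ | _ | _ = row≤ ys

  all-row : ∀ {Q : Good → Set} ys → All (λ y → ∀ z o q → Q (mk y z o q)) ys → All Q (row ys)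
  all-row [] [] = []
  all-row (y ∷ ys) (a ∷ as) with z? y | o? y | p? y
  ... | yes z | no o | no q = a z o q ∷ all-row ys as
  ... | yes _ | no _ | yes _ = all-row ys as
  ... | yes _ | yes _ | _ = all-row ys as
  ... | no _ | _ | _ = all-row ys as

  pairs-row : ∀ {B : ℕ → Set} {R : Good → Good → Set} → (∀ {y y'} → B y → B y' → ¬ y ≡ y' → ∀ z o q z' o' q' → R (mk y z o q) (mk y' z' o' q')) →
    ∀ ys → Distinctℕ ys → All B ys → AllPairs R (row ys)
  pairs-row r [] _ _ = []
  pairs-row r (y ∷ ys) (u ∷ us) (b ∷ bs) with z? y | o? y | p? y
  ... | yes z | no o | no q = all-row ys (All.zipWith (λ { (ne , b') z' o' q' → r b b' ne z o q z' o' q' }) (u , bs)) ∷ pairs-row r ys us bs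
  ... | yes _ | no _ | yes _ = pairs-row r ys us bs
  ... | yes _ | yes _ | _ = pairs-row r ys us bs
  ... | no _ | _ | _ = pairs-row r ys us bs

module Grid (Good : Set) (One Bad Fine : ℕ → Set) (classify : ∀ x → One x ⊎ (Bad x ⊎ Fine x)) (Z : ℕ × ℕ → Set) (z? : ∀ xy → Dec (Z xy))
  (row : ∀ x → Fine x → List Good) (ys : List ℕ) (b : ℕ)
  (bad-row : ∀ x → Bad x → length (filter (λ y → z? (x , y)) ys) ℕ.≤ b)
  (fine-row : ∀ x f → length (filter (λ y → z? (x , y)) ys) ℕ.≤ length (row x f) ℕ.+ 2)
  (row≤b : ∀ x f → length (row x f) ℕ.≤ b) where

  ones bads : List ℕ → List ℕ
  ones [] = []
  ones (x ∷ xs) with classify x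
  ... | inj₁ _ = x ∷ ones xs
  ... | inj₂ _ = ones xs
  bads [] = []
  bads (x ∷ xs) with classify x
  ... | inj₁ _ = bads xs
  ... | inj₂ (inj₁ _) = x ∷ bads xs
  ... | inj₂ (inj₂ _) = bads xs

  points : List ℕ → List Good
  points [] = []
  points (x ∷ xs) with classify x
  ... | inj₁ _ = points xs
  ... | inj₂ (inj₁ _) = points xs
  ... | inj₂ (inj₂ f) = row x f ++ points xs

  total : List ℕ → ℕ
  total xs = length (filter z? (cartesianProduct xs ys))

  private
    open import Data.Nat.Solver
    open +-*-Solver

    add₁ : ∀ y a b c d → y ℕ.+ (a ℕ.+ b ℕ.+ c ℕ.+ d) ℕ.≤ y ℕ.+ a ℕ.+ b ℕ.+ (2 ℕ.+ c) ℕ.+ d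
    add₁ y a b c d = ℕ.≤-trans (ℕ.m≤n+m _ 2) (ℕ.≤-reflexive (solve 5 (λ y a b c d → con 2 :+ (y :+ (a :+ b :+ c :+ d)) := y :+ a :+ b :+ (con 2 :+ c) :+ d) ≡.refl y a b c d))
    add₂ : ∀ y a b c d → y ℕ.+ (a ℕ.+ b ℕ.+ c ℕ.+ d) ℕ.≤ a ℕ.+ (y ℕ.+ b) ℕ.+ (2 ℕ.+ c) ℕ.+ d
    add₂ y a b c d = ℕ.≤-trans (ℕ.m≤n+m _ 2) (ℕ.≤-reflexive (solve 5 (λ y a b c d → con 2 :+ (y :+ (a :+ b :+ c :+ d)) := a :+ (y :+ b) :+ (con 2 :+ c) :+ d) ≡.refl y a b c d))
    add₃ : ∀ y a b c d → y ℕ.+ 2 ℕ.+ (a ℕ.+ b ℕ.+ c ℕ.+ d) ≡ a ℕ.+ b ℕ.+ (2 ℕ.+ c) ℕ.+ (y ℕ.+ d)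
    add₃ = solve 5 (λ y a b c d → y :+ con 2 :+ (a :+ b :+ c :+ d) := a :+ b :+ (con 2 :+ c) :+ (y :+ d)) ≡.refl

  total-∷ : ∀ x xs → total (x ∷ xs) ≡ length (filter (λ y → z? (x , y)) ys) ℕ.+ total xs
  total-∷ x xs = Lists.length-filter-row z? x ys (cartesianProduct xs ys)

  -- Every column is granted the allowance 2 for the lines, also those of the first two kinds that
  -- do not use it; this keeps the sum uniform.
  total-bound : ∀ xs → total xs ℕ.≤ length (ones xs) ℕ.* length ys ℕ.+ length (bads xs) ℕ.* b ℕ.+ length xs ℕ.* 2 ℕ.+ length (points xs)
  total-bound [] = z≤n
  total-bound (x ∷ xs) with classify x
  ... | inj₁ _ = ℕ.≤-trans (ℕ.≤-trans (ℕ.≤-reflexive (total-∷ x xs)) (ℕ.+-mono-≤ (length-filter (λ y → z? (x , y)) ys) (total-bound xs))) (add₁ (length ys) (length (ones xs) ℕ.* length ys) (length (bads xs) ℕ.* b) (length xs ℕ.* 2) (length (points xs)))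
  ... | inj₂ (inj₁ β) = ℕ.≤-trans (ℕ.≤-trans (ℕ.≤-reflexive (total-∷ x xs)) (ℕ.+-mono-≤ (bad-row x β) (total-bound xs))) (add₂ b (length (ones xs) ℕ.* length ys) (length (bads xs) ℕ.* b) (length xs ℕ.* 2) (length (points xs)))
  ... | inj₂ (inj₂ f) = ℕ.≤-trans (ℕ.≤-trans (ℕ.≤-reflexive (total-∷ x xs)) (ℕ.+-mono-≤ (fine-row x f) (total-bound xs)))
      (ℕ.≤-reflexive (≡.trans (add₃ (length (row x f)) (length (ones xs) ℕ.* length ys) (length (bads xs) ℕ.* b) (length xs ℕ.* 2) (length (points xs)))
        (≡.cong (λ k → length (ones xs) ℕ.* length ys ℕ.+ length (bads xs) ℕ.* b ℕ.+ (2 ℕ.+ length xs ℕ.* 2) ℕ.+ k) (≡.sym (length-++ (row x f))))))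

  points≤ : ∀ xs → length (points xs) ℕ.≤ length xs ℕ.* b
  points≤ [] = z≤n
  points≤ (x ∷ xs) with classify x
  ... | inj₁ _ = ℕ.≤-trans (points≤ xs) (ℕ.m≤n+m _ b)
  ... | inj₂ (inj₁ _) = ℕ.≤-trans (points≤ xs) (ℕ.m≤n+m _ b)
  ... | inj₂ (inj₂ f) = ℕ.≤-trans (ℕ.≤-reflexive (length-++ (row x f))) (ℕ.+-mono-≤ (row≤b x f) (points≤ xs))

  module _ {B : ℕ → Set} where

    ones≤1 : (∀ {x x'} → B x → B x' → One x → One x' → x ≡ x') → ∀ xs → Distinctℕ xs → All B xs → length (ones xs) ℕ.≤ 1
    ones≤1 inj [] _ _ = z≤n
    ones≤1 inj (x ∷ xs) (u ∷ us) (b ∷ bs) with classify x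
    ... | inj₂ _ = ones≤1 inj xs us bs
    ... | inj₁ o = s≤s (ℕ.≤-reflexive (none xs u bs))
      where
      none : ∀ xs → All (λ x' → ¬ x ≡ x') xs → All B xs → length (ones xs) ≡ 0
      none [] _ _ = ≡.refl
      none (x' ∷ xs) (n ∷ ns) (b' ∷ bs) with classify x'
      ... | inj₁ o' = ⊥-elim (n (inj b b' o o'))
      ... | inj₂ _ = none xs ns bs

    all-bads : ∀ {Q : ℕ → Set} xs → All Q xs → All (λ x → Q x × Bad x) (bads xs)
    all-bads [] [] = []
    all-bads (x ∷ xs) (q ∷ qs) with classify x
    ... | inj₁ _ = all-bads xs qs
    ... | inj₂ (inj₁ β) = (q , β) ∷ all-bads xs qs
    ... | inj₂ (inj₂ _) = all-bads xs qs

    pairs-bads : ∀ {R : ℕ → ℕ → Set} → (∀ {x x'} → B x → B x' → ¬ x ≡ x' → Bad x → Bad x' → R x x') → ∀ xs → Distinctℕ xs → All B xs → AllPairs R (bads xs)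
    pairs-bads r [] _ _ = []
    pairs-bads r (x ∷ xs) (u ∷ us) (b ∷ bs) with classify x
    ... | inj₁ _ = pairs-bads r xs us bs
    ... | inj₂ (inj₂ _) = pairs-bads r xs us bs
    ... | inj₂ (inj₁ β) = All.map (λ { ((ne , b') , β') → r b b' ne β β' }) (all-bads xs (All.zip (u , bs))) ∷ pairs-bads r xs us bs

    all-points : ∀ {Q : Good → Set} xs → All (λ x → ∀ f → All Q (row x f)) xs → All Q (points xs)
    all-points [] [] = []
    all-points (x ∷ xs) (q ∷ qs) with classify x
    ... | inj₁ _ = all-points xs qs
    ... | inj₂ (inj₁ _) = all-points xs qs
    ... | inj₂ (inj₂ f) = All.++⁺ (q f) (all-points xs qs)

    pairs-points : ∀ {R : Good → Good → Set} → (∀ x f → AllPairs R (row x f)) →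
      (∀ {x x'} → B x → B x' → ¬ x ≡ x' → ∀ f f' → All (λ g → All (R g) (row x' f')) (row x f)) → ∀ xs → Distinctℕ xs → All B xs → AllPairs R (points xs)
    pairs-points r c [] _ _ = []
    pairs-points r c (x ∷ xs) (u ∷ us) (b ∷ bs) with classify x
    ... | inj₁ _ = pairs-points r c xs us bs
    ... | inj₂ (inj₁ _) = pairs-points r c xs us bs
    ... | inj₂ (inj₂ f) = AllPairs.++⁺ (r x f) (pairs-points r c xs us bs)
        (All.tabulate λ {g} g∈ → all-points xs (All.zipWith (λ { (ne , b') f' → All.lookup (c b b' ne f f') g∈ }) (u , bs)))

-- Assembling the count over the prime field.

module Counting (K : CRing) (fld : Field K) (p : ℕ)
  (p·1 : CommutativeRing._≈_ K (RingTools._·_ K p (CommutativeRing.1# K)) (CommutativeRing.0# K))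
  (fermat : ∀ c → CommutativeRing._≈_ K (RingTools._^_ K c p) c)
  (small : ∀ i → 0 ℕ.< i → i ℕ.< p → ¬ CommutativeRing._≈_ K (RingTools._·_ K i (CommutativeRing.1# K)) (CommutativeRing.0# K))
  (num : ℕ → Car K) (num-inj : ∀ {x y} → x ℕ.< p → y ℕ.< p → CommutativeRing._≈_ K (num x) (num y) → x ≡ y)
  (N : ℕ) (2n<p : N ℕ.+ N ℕ.+ 4 ℕ.< p) (Zero : ℕ → ℕ → Set) (zero? : ∀ x y → Dec (Zero x y))
  (zero⇒ : ∀ x y → Zero x y → CommutativeRing._≈_ K (Polynomial.F K (suc (suc N)) (num x) (num y)) (CommutativeRing.0# K)) where
  open Field fld using (recip; recip-inverse) renaming (dom to domK)
  open Lists
  private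
    module K where
      open RingTools K public
      open Domain domK public
    A : CRing
    A = PolyRing.poly K
    module γK = Gamma K
    module P = Division K domK
    module γP = Gamma P.poly
    n : ℕ
    n = suc (suc N)
    n<p : n ℕ.< p
    n<p = ℕ.≤-<-trans (ℕ.≤-trans (ℕ.≤-reflexive (ℕ.+-comm 2 N)) (ℕ.≤-trans (ℕ.+-monoʳ-≤ N (s≤s (s≤s z≤n))) (ℕ.+-monoˡ-≤ 4 (ℕ.m≤m+n N N)))) 2n<p

  w v : ℕ → K.Carrier
  w x = num x K.- K.1#
  v x = recip (w x)

  module _ (x : ℕ) (w≉0 : ¬ w x K.≈ K.0#) where
    wv : w x K.* v x K.≈ K.1#
    wv = recip-inverse (w x) w≉0

    xv : (num x) K.* v x K.≈ v x K.+ K.1#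
    xv = K.trans (K.solve 2 (λ x v → x K.:* v K.:= v K.:+ (x K.:- K.con (+ 1)) K.:* v) K.refl (num x) (v x)) (K.+-congˡ wv)

    on-curve : ∀ y → Zero x y → γK.γ n (num y K.* v x) K.≈ γK.γ n (v x)
    on-curve y z = Transform.transform K n (num x) (num y) (num x K.+ num y K.- K.1#) (v x) xv
      (K.trans (K.solve 3 (λ x y v → (x K.:+ y K.:- K.con (+ 1)) K.:* v K.:= y K.:* v K.:+ (x K.:- K.con (+ 1)) K.:* v) K.refl (num x) (num y) (v x)) (K.+-congˡ wv))
      (zero⇒ x y z)

    v≉0 : ¬ v x K.≈ K.0#
    v≉0 z = K.1≉0 (K.trans (K.sym wv) (K.trans (K.*-congˡ z) (K.zeroʳ (w x))))

    s-inj : ∀ {y y'} → y ℕ.< p → y' ℕ.< p → num y K.* v x K.≈ num y' K.* v x → y ≡ y'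
    s-inj {y} {y'} l l' z = num-inj l l' (K.cancelˡ {v x} {num y} {num y'} v≉0 (K.trans (K.*-comm (v x) (num y)) (K.trans z (K.*-comm (num y') (v x)))))

  v-inj : ∀ {x x'} → x ℕ.< p → x' ℕ.< p → (w≉0 : ¬ w x K.≈ K.0#) (w'≉0 : ¬ w x' K.≈ K.0#) → v x K.≈ v x' → x ≡ x'
  v-inj {x} {x'} l l' nw nw' z = num-inj l l' (K.trans (K.solve 1 (λ x → x K.:= (x K.:- K.con (+ 1)) K.:+ K.con (+ 1)) K.refl (num x))
    (K.trans (K.+-congʳ w≈) (K.solve 1 (λ x → (x K.:- K.con (+ 1)) K.:+ K.con (+ 1) K.:= x) K.refl (num x'))))
    where
    w≈ : w x K.≈ w x'
    w≈ = K.begin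
      w x K.≈⟨ K.sym (K.*-identityʳ (w x)) ⟩
      w x K.* K.1# K.≈⟨ K.*-congˡ (K.sym (wv x' nw')) ⟩
      w x K.* (w x' K.* v x') K.≈⟨ K.*-congˡ (K.*-congˡ (K.sym z)) ⟩
      w x K.* (w x' K.* v x) K.≈⟨ K.solve 3 (λ a b c → a K.:* (b K.:* c) K.:= b K.:* (a K.:* c)) K.refl (w x) (w x') (v x) ⟩
      w x' K.* (w x K.* v x) K.≈⟨ K.*-congˡ (wv x nw) ⟩
      w x' K.* K.1# K.≈⟨ K.*-identityʳ (w x') ⟩
      w x' K.∎

  lead-γ : ∀ k → suc k ℕ.< p → P.Lead k (γP.γ (suc k) P.X)
  lead-γ k lt = GammaPoly.deg-γ K domK (suc k) , λ z → small (suc k) (s≤s z≤n) lt (K.trans (K.sym (GammaPoly.top-γ K domK k)) z)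

  ev-γX : ∀ k c → Evaluation.ev (idHom K) c (γP.γ k P.X) K.≈ γK.γ k c
  ev-γX k c = K.trans (GammaHom.f-γ (Evaluation.evHom (idHom K) c) k P.X) (γK.γ-cong k (Evaluation.ev-X (idHom K) c))

  -- For fixed `x` the values `s = y v` are distinct roots of `γ n (S) - γ n (v)`, whose degree is
  -- `n - 1 = N + 1`.
  row-bound : ∀ x → ¬ w x K.≈ K.0# → ∀ ys → AllPairs (λ y y' → ¬ y ≡ y') ys → All (ℕ._< p) ys → length (filter (zero? x) ys) ℕ.≤ suc N
  row-bound x nw ys us bs = ≡.subst (ℕ._≤ suc N) (length-map (λ y → num y K.* v x) (filter (zero? x) ys))
    (Roots.roots K domK (suc N) f lead-f (map (λ y → num y K.* v x) (filter (zero? x) ys)) (AllPairs.map⁺ (pairs ys us bs)) (All.map⁺ (All.map (λ {y} z → root y z) (All.all-filter (zero? x) ys))))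
    where
    f : List K.Carrier
    f = γP.γ n P.X P.- P.C (γK.γ n (v x))
    lead-f : P.Lead (suc N) f
    lead-f = P.deg-sub (proj₁ (lead-γ (suc N) n<p)) (P.deg-mono (s≤s z≤n) P.deg-C) , λ z → proj₂ (lead-γ (suc N) n<p)
      (K.trans (K.sym (K.trans (P.coeff-sub (γP.γ n P.X) (P.C (γK.γ n (v x))) (suc N)) (K.trans (K.+-congˡ K.-0#≈0#) (K.+-identityʳ _)))) z)
    root : ∀ y → Zero x y → Evaluation.ev (idHom K) (num y K.* v x) f K.≈ K.0#
    root y z = K.trans (Hom.f-sub (Evaluation.evHom (idHom K) (num y K.* v x)) (γP.γ n P.X) (P.C (γK.γ n (v x))))
      (K.trans (K.+-cong (K.trans (ev-γX n (num y K.* v x)) (on-curve x nw y z)) (K.-‿cong (Evaluation.ev-C (idHom K) (num y K.* v x) (γK.γ n (v x))))) (K.-‿inverseʳ _))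
    pairs : ∀ ys → AllPairs (λ y y' → ¬ y ≡ y') ys → All (ℕ._< p) ys → AllPairs (λ y y' → ¬ (num y K.* v x K.≈ num y' K.* v x)) (filter (zero? x) ys)
    pairs [] _ _ = []
    pairs (y ∷ ys) (u ∷ us) (b ∷ bs) with zero? x y
    ... | no _ = pairs ys us bs
    ... | yes _ = All.filter⁺ (zero? x) (All.zipWith (λ { (ne , b') e → ne (s-inj x nw b b' e) }) (u , bs)) ∷ pairs ys us bs

  Fine : ℕ → Set
  Fine x = ¬ w x K.≈ K.0# × ¬ γK.γ (suc N) (v x) K.≈ K.0#

  -- Over a critical value of `v` the `V`-derivative vanishes and `S` may fail to be a local
  -- parameter, so the whole column is estimated by `row-bound`.
  Bad : ℕ → Set
  Bad x = ¬ w x K.≈ K.0# × γK.γ (suc N) (v x) K.≈ K.0#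

  opaque
    one? : ∀ x → Dec (w x K.≈ K.0#)
    one? x = K.dec0 (w x)

    opposite? : ∀ x y → Dec (num x K.+ num y K.≈ K.0#)
    opposite? x y = K.dec0 (num x K.+ num y)

    classify : ∀ x → w x K.≈ K.0# ⊎ (Bad x ⊎ Fine x)
    classify x = decide (K.dec0 (w x)) (K.dec0 (γK.γ (suc N) (v x)))
      where
      decide : Dec (w x K.≈ K.0#) → Dec (γK.γ (suc N) (v x) K.≈ K.0#) → w x K.≈ K.0# ⊎ (Bad x ⊎ Fine x)
      decide (yes z) _ = inj₁ z
      decide (no nw) (yes z) = inj₂ (inj₁ (nw , z))
      decide (no nw) (no nz) = inj₂ (inj₂ (nw , nz))

  one-inj : ∀ {y y'} → y ℕ.< p → y' ℕ.< p → w y K.≈ K.0# → w y' K.≈ K.0# → y ≡ y'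
  one-inj {y} {y'} l l' z z' = num-inj l l' (K.trans (K.x-y≈0 {num y} {K.1#} z) (K.sym (K.x-y≈0 {num y'} {K.1#} z')))

  opposite-inj : ∀ x {y y'} → y ℕ.< p → y' ℕ.< p → num x K.+ num y K.≈ K.0# → num x K.+ num y' K.≈ K.0# → y ≡ y'
  opposite-inj x {y} {y'} l l' z z' = num-inj l l' (K.+-cancelˡ (num x) (num y) (num y') (K.trans z (K.sym z')))

  -- In the original variables the line `S = V` is `y = 1`, and because `v + 1 = x v` the line
  -- `S + V + 1 = 0` is `x + y = 0`.
  mkGood : ∀ x → Fine x → ∀ y → Zero x y → ¬ w y K.≈ K.0# → ¬ num x K.+ num y K.≈ K.0# → Good K N
  mkGood x (nw , nγ) y z ny nopp = record { v₀ = v x ; s₀ = num y K.* v x ; curve = on-curve x nw y z ; noncritical = nγ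
    ; off₁ = λ e → ny (K.cancel0 {v x} {w y} (v≉0 x nw) (K.trans (K.solve 2 (λ y v → v K.:* (y K.:- K.con (+ 1)) K.:= y K.:* v K.:- v) K.refl (num y) (v x)) e))
    ; off₂ = λ e → nopp (K.cancel0 {v x} {num x K.+ num y} (v≉0 x nw) (K.trans (K.solve 3 (λ x y v → v K.:* (x K.:+ y) K.:= y K.:* v K.:+ x K.:* v) K.refl (num x) (num y) (v x))
               (K.trans (K.+-congˡ {num y K.* v x} (xv x nw)) (K.trans (K.sym (K.+-assoc (num y K.* v x) (v x) K.1#)) e)))) }

  module Row (x : ℕ) (f : Fine x) = Rows (Good K N) (Zero x) (λ y → w y K.≈ K.0#) (λ y → num x K.+ num y K.≈ K.0#) (zero? x) one? (opposite? x) (mkGood x f)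

  distinct : Distinctℕ (upTo p)
  distinct = Unique.upTo⁺ p

  below : All (ℕ._< p) (upTo p)
  below = All.applyUpTo⁺₁ (λ x → x) p λ l → l

  fine-row : ∀ x f → length (filter (zero? x) (upTo p)) ℕ.≤ length (Row.row x f (upTo p)) ℕ.+ 2
  fine-row x f = ℕ.≤-trans (Row.length-row x f (upTo p)) (ℕ.+-monoʳ-≤ (length (Row.row x f (upTo p)))
    (ℕ.+-mono-≤ (at-most-one one? (ℕ._< p) one-inj (upTo p) distinct below) (at-most-one (opposite? x) (ℕ._< p) (opposite-inj x) (upTo p) distinct below)))

  module G = Grid (Good K N) (λ x → w x K.≈ K.0#) Bad Fine classify (λ xy → Zero (proj₁ xy) (proj₂ xy)) (λ xy → zero? (proj₁ xy) (proj₂ xy))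
    (λ x f → Row.row x f (upTo p)) (upTo p) (suc N) (λ x β → row-bound x (proj₁ β) (upTo p) distinct below) fine-row
    (λ x f → ℕ.≤-trans (Row.row≤ x f (upTo p)) (row-bound x (proj₁ f) (upTo p) distinct below))

  points : List (Good K N)
  points = G.points (upTo p)

  pairs-points : AllPairs (Differ K N) points
  pairs-points = G.pairs-points {B = ℕ._< p}
    (λ x f → Row.pairs-row x f (λ b b' ne _ _ _ _ _ _ e → ne (s-inj x (proj₁ f) b b' (proj₂ e))) (upTo p) distinct below)
    (λ {x} {x'} b b' ne f f' → Row.all-row x f (upTo p) (All.universal (λ y _ _ _ → Row.all-row x' f' (upTo p) (All.universal (λ y' _ _ _ e → ne (v-inj b b' (proj₁ f) (proj₁ f') (proj₁ e))) (upTo p))) (upTo p)))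
    (upTo p) distinct below

  -- The values `v x` are distinct roots of `γ (n - 1)`, whose degree is `n - 2 = N`.
  bads≤N : length (G.bads (upTo p)) ℕ.≤ N
  bads≤N = ≡.subst (ℕ._≤ N) (length-map v (G.bads (upTo p))) (Roots.roots K domK N (γP.γ (suc N) P.X) (lead-γ N (ℕ.<-trans (ℕ.n<1+n (suc N)) n<p)) (map v (G.bads (upTo p)))
    (AllPairs.map⁺ (G.pairs-bads {B = ℕ._< p} (λ b b' ne β β' e → ne (v-inj b b' (proj₁ β) (proj₁ β') e)) (upTo p) distinct below))
    (All.map⁺ (All.map (λ { {x} (_ , (_ , z)) → K.trans (ev-γX (suc N) (v x)) z }) (G.all-bads {B = ℕ._< p} (upTo p) below))))

  -- One column `x = 1` with `p` points, at most `N` critical columns with at most `N + 1` points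
  -- each, and two line points in each of the `p` columns.
  total≤ : G.total (upTo p) ℕ.≤ 3 ℕ.* p ℕ.+ n ℕ.* n ℕ.+ length points
  total≤ = ℕ.≤-trans (G.total-bound (upTo p)) (ℕ.+-monoˡ-≤ (length points) (ℕ.≤-trans
    (ℕ.+-mono-≤ (ℕ.+-mono-≤ (ℕ.*-mono-≤ (G.ones≤1 {B = ℕ._< p} one-inj (upTo p) distinct below) (ℕ.≤-reflexive (length-upTo p))) (ℕ.*-mono-≤ (ℕ.≤-trans bads≤N (ℕ.≤-trans (ℕ.n≤1+n N) (ℕ.n≤1+n (suc N)))) (ℕ.n≤1+n (suc N)))) (ℕ.*-monoˡ-≤ 2 (ℕ.≤-reflexive (length-upTo p))))
    (ℕ.≤-reflexive (solve 2 (λ p m → con 1 :* p :+ m :+ p :* con 2 := con 3 :* p :+ m) ≡.refl p (n ℕ.* n)))))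
    where
    open import Data.Nat.Solver
    open +-*-Solver

  points-bound : ∀ μ → 1 ℕ.≤ μ → 3 ℕ.* suc μ ℕ.+ 5 ℕ.≤ N → μ ℕ.* μ ℕ.* μ ℕ.* n ℕ.≤ p → length points ℕ.* μ ℕ.≤ 16 ℕ.* (suc N ℕ.* p)
  points-bound μ a b c = Assembly.Total.main-bound K A domK (Degree.polyDomain K domK) (PolyGraded.graded K) (PrimeFactors.splitting K fld) p p·1 fermat small N 2n<p
    (recip (n K.· K.1#)) (recip-inverse (n K.· K.1#) (small n (s≤s z≤n) n<p)) μ a b c points pairs-points

  points≤ : length points ℕ.≤ p ℕ.* suc N
  points≤ = ℕ.≤-trans (G.points≤ (upTo p)) (ℕ.≤-reflexive (≡.cong (ℕ._* suc N) (length-upTo p)))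

  summary : ∃ λ L → length (filter (λ xy → zero? (proj₁ xy) (proj₂ xy)) (cartesianProduct (upTo p) (upTo p))) ℕ.≤ 3 ℕ.* p ℕ.+ n ℕ.* n ℕ.+ L ×
    (∀ μ → 1 ℕ.≤ μ → 3 ℕ.* suc μ ℕ.+ 5 ℕ.≤ N → μ ℕ.* μ ℕ.* μ ℕ.* n ℕ.≤ p → L ℕ.* μ ℕ.≤ 16 ℕ.* (suc N ℕ.* p)) × L ℕ.≤ p ℕ.* suc N
  summary = length points , total≤ , points-bound , points≤

open import Data.Nat using (_+_; _*_; _^_; _≤_; _<_; _≤?_; _<?_)

module _ (p : ℕ) (pr : Prime p) (N : ℕ) (2n<p : N + N + 4 < p) where
  private
    module M = ModP p pr
    module K = RingTools M.K
    n : ℕ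
    n = suc (suc N)

    zero⇒ : ∀ x y → p ∣ ∣ Fn n (+ x) (+ y) ∣ → Quotient._≃_ M.ℤR (+ p) (Polynomial.F M.K n (+ x) (+ y)) (+ 0)
    zero⇒ x y z = K.trans (K.sym (K.+-cong (K.+-cong (K.+-cong (M.pow≃ (+ x) n) (M.pow≃ (+ y) n)) (K.-‿cong (M.pow≃ (+ x ℤ.+ + y ℤ.- + 1) n))) K.refl)) (M.∣⇒≃ (Fn n (+ x) (+ y)) z)

  count : ∃ λ L → Nn p n ≤ 3 * p + n * n + L ×
    (∀ μ → 1 ≤ μ → 3 * suc μ + 5 ≤ N → μ * μ * μ * n ≤ p → L * μ ≤ 16 * (suc N * p)) × L ≤ p * suc N
  count = Counting.summary M.K M.fld p M.p·1 M.fermat M.small (λ x → + x) M.nat-inj N 2n<p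
    (λ x y → p ∣ ∣ Fn n (+ x) (+ y) ∣) (λ x y → p ∣? ∣ Fn n (+ x) (+ y) ∣) zero⇒

-- Fractional exponents are avoided by letting `t` be any natural number with `t³ ≥ n⁴ p²`, that is
-- `t ≥ n^(4/3) p^(2/3)`; rounding the latter up costs less than 1, which `p` absorbs.
theorem2p4 : ∃ λ (c : ℕ) → ∀ (p n : ℕ) → Prime p → 2 ≤ n →
    ∀ (t : ℕ) → n ^ 4 * p ^ 2 ≤ t ^ 3 → Nn p n ≤ c * (p + t)
theorem2p4 = 227 , bound
  where
  -- The threshold `N + N + 4` is `2n`: the Wronskian argument divides by `2m + 1 = 2n - 1`, which
  -- must be nonzero modulo `p`.
  by-size : ∀ p N → Prime p → ∀ t → suc (suc N) ^ 4 * p ^ 2 ≤ t ^ 3 → Dec (N + N + 4 < p) → Nn p (suc (suc N)) ≤ 227 * (p + t)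
  by-size p N pr t h (no nlt) = NatBounds.Conclusion.p-small (Nn p (suc (suc N))) p N t h nlt (NatBounds.Nn≤p² p (suc (suc N)))
  by-size p N pr t h (yes lt) = NatBounds.Conclusion.p-large (Nn p (suc (suc N))) p N t h lt {{prime⇒nonZero pr}} (count p pr N lt)

  bound : ∀ p n → Prime p → 2 ≤ n → ∀ t → n ^ 4 * p ^ 2 ≤ t ^ 3 → Nn p n ≤ 227 * (p + t)
  bound p (suc (suc N)) pr (s≤s (s≤s z≤n)) t h = by-size p N pr t h (N + N + 4 <? p)
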